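{- Let $R$ be a finite chain ring of length $2$ with residue field $\mathbb{F}_q$, where $q\ge5$ is a prime power. Then $$\mathrm{m}_3(R)\le\begin{cases}2q^2-2q+4 & \text{if } q \text{ is odd},\\ 2q^2-q+4 & \text{if } q \text{ is even}.\end{cases}$$
   Context: Throughout, $R$ is a finite chain ring of nilpotency index (length) $2$, i.e. a finite local ring with radical $\mathrm{rad}R\neq 0$, $(\mathrm{rad}R)^2=0$, whose one-sided ideals form the chain $R\supsetneq\mathrm{rad}R\supsetneq 0$, with residue field $R/\mathrm{rad}R\cong\mathbb{F}_q$ ($q$ a prime power); then $|R|=q^2$. The projective Hjelmslev plane $\mathrm{PHG}(2,R)$ is the incidence structure whose points are the free rank-$1$ submodules of the right module $R_R^3$, whose lines are the free rank-$2$ submodules of $R_R^3$, with incidence given by inclusion; it has $q^4+q^3+q^2$ points and each line contains $q^2+q$ points. A $(k,n)$-arc is a map $\mathcal{K}$ from the point set to $\mathbb{N}_0$ with $\sum_x\mathcal{K}(x)=k$ and $\sum_{x\in L}\mathcal{K}(x)\le n$ for every line $L$; it is projective if $\mathcal{K}$ takes only values in $\{0,1\}$ (i.e. it is a set of $k$ points meeting every line in at most $n$ points). For $0\le n\le q^2+q$, $\mathrm{m}_n(R)$ denotes the largest $k$ such that a projective $(k,n)$-arc exists in $\mathrm{PHG}(2,R)$. -}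

module Defs where

open import Algebra.Bundles using (Ring; RawRing)
open import Algebra.Module.Bundles using (RightModule)
import Algebra.Module.Construct.DirectProduct as DirectProduct
import Algebra.Module.Construct.TensorUnit as TensorUnit
import Algebra.Properties.CommutativeMonoid.Sum as CMSum
open import Algebra.Structures using (IsCommutativeRing)
open import Data.Bool.Base using (if_then_else_)
open import Data.Fin.Base using (Fin; zero; suc)
import Data.Fin.Properties as Finₚ
open import Data.List.Base
  using (List; []; _∷_; [_]; map; filter; allFin; concatMap; deduplicate;
         cartesianProduct; cartesianProductWith)
import Data.List.Extrema as ListExtrema
import Data.List.Membership.Propositional as ListMem
import Data.List.Membership.Propositional.Properties as ListMemₚ
import Data.List.Membership.Setoid as SetoidMem
import Data.List.Membership.Setoid.Properties as SetoidMemₚ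
open import Data.List.Properties using (map-cong; filter-≐)
open import Data.List.Relation.Unary.All as All using (All; all?)
import Data.List.Relation.Unary.All.Properties as Allₚ
open import Data.List.Relation.Unary.Any as Any using (any?; here; there)
import Data.List.Relation.Unary.Any.Properties as Anyₚ
open import Data.List.Relation.Unary.Enumerates.Setoid using (IsEnumeration)
import Data.List.Relation.Unary.Enumerates.Setoid.Properties as Enumₚ
import Data.List.Relation.Unary.Unique.DecSetoid.Properties as UniqueDecₚ
import Data.List.Relation.Unary.Unique.Setoid as UniqueSetoid
open import Data.Nat.Base as ℕ using (ℕ; z≤n; z<s; s<s)
import Data.Nat.Properties as ℕₚ
open import Data.Nat.ListAction using (sum)
open import Data.Nat.Primality using (Prime)
open import Data.Product.Base using (Σ; Σ-syntax; ∃; ∃-syntax; ∃₂; _×_; _,_; proj₁; proj₂)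
open import Data.Sum.Base using (_⊎_; inj₁; inj₂)
open import Data.Vec.Functional as Vector using (Vector)
import Data.Vec.Functional.Relation.Binary.Equality.Setoid as VecEq
open import Function.Base using (_∘_)
open import Function.Bundles using (Inverse; Injection; _⇔_; Equivalence; mk⇔)
open import Function.Properties.Inverse using (Inverse⇒Injection)
open import Level using (Level; _⊔_; 0ℓ) renaming (suc to lsuc)
open import Relation.Binary.Bundles using (Setoid; DecSetoid)
open import Relation.Binary.Core using (_Preserves_⟶_)
open import Relation.Binary.Definitions using (_Respects_)
open import Relation.Binary.PropositionalEquality.Core as ≡ using (_≡_)
import Relation.Binary.PropositionalEquality.Properties as ≡ₚ
import Relation.Binary.Reasoning.Setoid as ≈-Reasoning
open import Relation.Nullary.Decidable
  using (Dec; yes; no; does; True; toWitness; fromWitness; map′; _×-dec_; _→-dec_)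
open import Relation.Nullary.Negation using (¬_; contradiction)
open import Relation.Unary using (Pred; Decidable; U; _⊆_; _⊂_; _≐_)

IsPrimePower : ℕ → Set
IsPrimePower q = ∃₂ λ p e → Prime p × 1 ℕ.≤ e × q ≡ p ℕ.^ e

HasOrder : ∀ {a ℓ} → Setoid a ℓ → ℕ → Set (a ⊔ ℓ)
HasOrder S n = Inverse S (≡ₚ.setoid (Fin n))

IsFinite : ∀ {a ℓ} → Setoid a ℓ → Set (a ⊔ ℓ)
IsFinite S = ∃ (HasOrder S)

-- Subsets of a finite structure are taken to be decidable; this is no
-- restriction classically, and it lets all of them live in Pred _ 0ℓ.

record LeftIdeal {c ℓ : Level} (R : Ring c ℓ) : Set (c ⊔ ℓ ⊔ lsuc 0ℓ) where
  open Ring R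
  field
    Mem      : Pred Carrier 0ℓ
    mem?     : Decidable Mem
    resp     : Mem Respects _≈_
    0∈       : Mem 0#
    +-closed : ∀ {x y} → Mem x → Mem y → Mem (x + y)
    *-closed : ∀ r {x} → Mem x → Mem (r * x)

record Submodule {c ℓ m ℓm : Level} {R : Ring c ℓ} (M : RightModule R m ℓm)
                 : Set (c ⊔ m ⊔ ℓm ⊔ lsuc 0ℓ) where
  open RightModule M
  field
    Mem      : Pred Carrierᴹ 0ℓ
    mem?     : Decidable Mem
    resp     : Mem Respects _≈ᴹ_
    0∈       : Mem 0ᴹ
    +-closed : ∀ {x y} → Mem x → Mem y → Mem (x +ᴹ y)
    *-closed : ∀ r {x} → Mem x → Mem (x *ᵣ r)

RightIdeal : ∀ {c ℓ} → Ring c ℓ → Set (c ⊔ ℓ ⊔ lsuc 0ℓ)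
RightIdeal R = Submodule (TensorUnit.rightModule {R = R})

module _ {c ℓ : Level} (R : Ring c ℓ) where
  open Ring R
  open LeftIdeal using (Mem)

  IsMaximal : LeftIdeal R → Set (c ⊔ ℓ ⊔ lsuc 0ℓ)
  IsMaximal I = Mem I ⊂ U × ((J : LeftIdeal R) → Mem I ⊆ Mem J → Mem J ⊂ U → Mem J ⊆ Mem I)

  IsLocal : Set (c ⊔ ℓ ⊔ lsuc 0ℓ)
  IsLocal = Σ[ I ∈ LeftIdeal R ] (IsMaximal I × (∀ J → IsMaximal J → Mem J ≐ Mem I))

  -- Maximal left and maximal right ideals have the same intersection, so the
  -- choice of side is immaterial.
  rad : Pred Carrier (c ⊔ ℓ ⊔ lsuc 0ℓ)
  rad x = ∀ I → IsMaximal I → Mem I x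

  -- R / rad R, presented by coarsening the equality of R.
  R/rad : RawRing c (c ⊔ ℓ ⊔ lsuc 0ℓ)
  R/rad = record
    { _≈_ = λ x y → rad (x - y)
    ; _+_ = _+_ ; _*_ = _*_ ; -_ = -_ ; 0# = 0# ; 1# = 1#
    }

-- 𝔽_q is determined up to isomorphism as the field with q elements.
record IsFieldOfOrder {c ℓ : Level} (F : RawRing c ℓ) (q : ℕ) : Set (c ⊔ ℓ) where
  open RawRing F
  field
    isCommutativeRing : IsCommutativeRing _≈_ _+_ _*_ -_ 0# 1#
    0≉1               : ¬ (0# ≈ 1#)
    inverse           : ∀ x → ¬ (x ≈ 0#) → ∃[ y ] (x * y ≈ 1#)
    order             : HasOrder
      (record { isEquivalence = IsCommutativeRing.isEquivalence isCommutativeRing }) q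

-- Chain rings of length 2 are finite local rings with one-sided ideals
-- R ⊋ rad R ⊋ 0; the fields are not independent of each other.
record IsChainRing₂ {c ℓ : Level} (R : Ring c ℓ) (q : ℕ) : Set (c ⊔ ℓ ⊔ lsuc 0ℓ) where
  open Ring R
  field
    finite      : IsFinite setoid
    local       : IsLocal R
    0⊂rad       : (_≈ 0#) ⊂ rad R
    rad⊂R       : rad R ⊂ U
    rad²≈0      : ∀ {x y} → rad R x → rad R y → x * y ≈ 0#
    left-chain  : (I : LeftIdeal R) → let open LeftIdeal I in
                  (Mem ≐ U) ⊎ (Mem ≐ rad R) ⊎ (Mem ≐ (_≈ 0#))
    right-chain : (I : RightIdeal R) → let open Submodule I in
                  (Mem ≐ U) ⊎ (Mem ≐ rad R) ⊎ (Mem ≐ (_≈ 0#))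
    residue     : IsFieldOfOrder (R/rad R) q

record ChainRing₂ (c ℓ : Level) (q : ℕ) : Set (lsuc (c ⊔ ℓ)) where
  field
    ring         : Ring c ℓ
    isChainRing₂ : IsChainRing₂ ring q
  open IsChainRing₂ isChainRing₂ public

module Free {c ℓ m ℓm : Level} {R : Ring c ℓ} (M : RightModule R m ℓm) where
  open Ring R using (Carrier; _≈_; 0#)
  open RightModule M
  open Submodule using (Mem)
  open CMSum +ᴹ-commutativeMonoid public
    using () renaming (sum to sumᴹ; sum-cong-≋ to sumᴹ-cong; ∑-distrib-+ to sumᴹ-+)

  lincomb : ∀ {k} → Vector Carrierᴹ k → Vector Carrier k → Carrierᴹ
  lincomb v r = sumᴹ (λ i → v i *ᵣ r i)

  Independent : ∀ {k} → Vector Carrierᴹ k → Set (c ⊔ ℓ ⊔ ℓm)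
  Independent v = ∀ r → lincomb v r ≈ᴹ 0ᴹ → ∀ i → r i ≈ 0#

  IsBasis : ∀ {k} → Submodule M → Vector Carrierᴹ k → Set (c ⊔ ℓ ⊔ m ⊔ ℓm)
  IsBasis S v = Independent v × (∀ w → Mem S w ⇔ (∃[ r ] (lincomb v r ≈ᴹ w)))

  IsFreeOfRank : ℕ → Submodule M → Set (c ⊔ ℓ ⊔ m ⊔ ℓm)
  IsFreeOfRank k S = Σ[ v ∈ Vector Carrierᴹ k ] IsBasis S v

  FreeSubmodule : ℕ → Set (c ⊔ ℓ ⊔ m ⊔ ℓm ⊔ lsuc 0ℓ)
  FreeSubmodule k = ∃ (IsFreeOfRank k)

  ∣_∣ : ∀ {k} → FreeSubmodule k → Pred Carrierᴹ 0ℓ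
  ∣ S , _ ∣ = Mem S

  -- Two free submodules are equal when they have the same elements; the
  -- chosen bases are irrelevant.
  freeSetoid : ℕ → Setoid (c ⊔ ℓ ⊔ m ⊔ ℓm ⊔ lsuc 0ℓ) m
  freeSetoid k = record
    { Carrier       = FreeSubmodule k
    ; _≈_           = λ S T → ∣ S ∣ ≐ ∣ T ∣
    ; isEquivalence = record
      { refl  = (λ x∈ → x∈) , (λ x∈ → x∈)
      ; sym   = λ (f , g) → g , f
      ; trans = λ (f , g) (h , k) → (λ x∈ → h (f x∈)) , (λ x∈ → g (k x∈))
      }
    }

module Finite where

  enum : ∀ {a ℓ} {S : Setoid a ℓ} → IsFinite S → List (Setoid.Carrier S)
  enum (n , inv) = map (Inverse.from inv) (allFin n)

  enum-complete : ∀ {a ℓ} {S : Setoid a ℓ} (fin : IsFinite S) →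
                  IsEnumeration S (enum fin)
  enum-complete {S = S} (n , inv) x =
    SetoidMemₚ.∈-resp-≈ S (Inverse.strictlyInverseʳ inv x)
      (SetoidMemₚ.∈-map⁺ (≡ₚ.setoid (Fin n)) S (Inverse.from-cong inv)
        (ListMemₚ.∈-allFin (Inverse.to inv x)))

  module _ {a ℓ : Level} (S : Setoid a ℓ) where
    open Setoid S
    open VecEq S using (≋-setoid)

    tuples : List Carrier → (k : ℕ) → List (Vector Carrier k)
    tuples xs ℕ.zero    = [ Vector.[] ]
    tuples xs (ℕ.suc k) = cartesianProductWith Vector._∷_ xs (tuples xs k)

    tuples-complete : ∀ {xs} → IsEnumeration S xs → ∀ k →
                      IsEnumeration (≋-setoid k) (tuples xs k)
    tuples-complete e ℕ.zero    v = here λ ()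
    tuples-complete e (ℕ.suc k) v =
      SetoidMemₚ.∈-resp-≈ (≋-setoid (ℕ.suc k)) {x = Vector.head v Vector.∷ Vector.tail v}
        (λ { zero → refl ; (suc i) → refl })
        (SetoidMemₚ.∈-cartesianProductWith⁺ S (≋-setoid k) (≋-setoid (ℕ.suc k))
          (λ { x≈y us≈vs zero → x≈y ; x≈y us≈vs (suc i) → us≈vs i })
          (e (Vector.head v)) (tuples-complete e k (Vector.tail v)))

    module _ {xs : List Carrier} (e : IsEnumeration S xs)
             {p : Level} {P : Pred Carrier p} (resp : P Respects _≈_) (P? : Decidable P) where

      ∀? : Dec (∀ x → P x)
      ∀? = map′ (λ ps x → All.lookupₛ S resp ps (e x)) (λ f → All.universal f xs) (all? P? xs)

      ∃? : Dec (∃ P)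
      ∃? = map′ Any.satisfied (λ (x , px) → SetoidMem.lose S resp (e x) px) (any? P? xs)

-- In a finite module the free submodules of a given rank are listed
-- explicitly, without repetition.
module FreeEnum {c ℓ m ℓm : Level} {R : Ring c ℓ} (M : RightModule R m ℓm)
                (_≟_ : ∀ x y → Dec (Ring._≈_ R x y))
                (_≟ᴹ_ : ∀ x y → Dec (RightModule._≈ᴹ_ M x y))
                {rs : List (Ring.Carrier R)} (rs-enum : IsEnumeration (Ring.setoid R) rs)
                {ms : List (RightModule.Carrierᴹ M)}
                (ms-enum : IsEnumeration (RightModule.≈ᴹ-setoid M) ms) where
  open Ring R using (Carrier; _≈_; 0#; _+_; _*_)
  module R = Ring R
  open RightModule M
  open Free M
  open Finite
  open VecEq R.setoid using () renaming (_≋_ to _≋ᴿ_)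
  open VecEq ≈ᴹ-setoid using () renaming (_≋_ to _≋ᴹ_)

  lincomb-cong : ∀ {k} {v v′ : Vector Carrierᴹ k} {r r′ : Vector Carrier k} →
                 v ≋ᴹ v′ → r ≋ᴿ r′ → lincomb v r ≈ᴹ lincomb v′ r′
  lincomb-cong v≋v′ r≋r′ = sumᴹ-cong (λ i → *ᵣ-cong (v≋v′ i) (r≋r′ i))

  lincomb-0 : ∀ {k} (v : Vector Carrierᴹ k) → lincomb v (λ _ → 0#) ≈ᴹ 0ᴹ
  lincomb-0 {ℕ.zero}  v = ≈ᴹ-refl
  lincomb-0 {ℕ.suc k} v =
    ≈ᴹ-trans (+ᴹ-cong (*ᵣ-zeroʳ _) (lincomb-0 (Vector.tail v))) (+ᴹ-identityˡ _)

  lincomb-+ : ∀ {k} (v : Vector Carrierᴹ k) r s →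
              lincomb v (λ i → r i + s i) ≈ᴹ lincomb v r +ᴹ lincomb v s
  lincomb-+ v r s = ≈ᴹ-trans (sumᴹ-cong (λ i → *ᵣ-distribˡ (v i) (r i) (s i)))
                             (sumᴹ-+ (λ i → v i *ᵣ r i) (λ i → v i *ᵣ s i))

  lincomb-* : ∀ {k} (v : Vector Carrierᴹ k) r s →
              lincomb v (λ i → r i * s) ≈ᴹ lincomb v r *ᵣ s
  lincomb-* {ℕ.zero}  v r s = ≈ᴹ-sym (*ᵣ-zeroˡ s)
  lincomb-* {ℕ.suc k} v r s =
    ≈ᴹ-trans (+ᴹ-cong (≈ᴹ-sym (*ᵣ-assoc _ _ _)) (lincomb-* (Vector.tail v) (Vector.tail r) s))
             (≈ᴹ-sym (*ᵣ-distribʳ s _ _))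

  combination? : ∀ {k} (v : Vector Carrierᴹ k) w → Dec (∃[ r ] (lincomb v r ≈ᴹ w))
  combination? {k} v w = ∃? (VecEq.≋-setoid R.setoid k) (tuples-complete R.setoid rs-enum k)
    (λ r≋s eq → ≈ᴹ-trans (lincomb-cong (λ _ → ≈ᴹ-refl) (λ i → R.sym (r≋s i))) eq)
    (λ r → lincomb v r ≟ᴹ w)

  independent? : ∀ {k} (v : Vector Carrierᴹ k) → Dec (Independent v)
  independent? {k} v = ∀? (VecEq.≋-setoid R.setoid k) (tuples-complete R.setoid rs-enum k)
    (λ r≋s ind eq i → R.trans (R.sym (r≋s i))
      (ind (≈ᴹ-trans (lincomb-cong (λ _ → ≈ᴹ-refl) r≋s) eq) i))
    (λ r → (lincomb v r ≟ᴹ 0ᴹ) →-dec zero? r)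
    where
    zero? : ∀ {k} (r : Vector Carrier k) → Dec (∀ i → r i ≈ 0#)
    zero? {ℕ.zero}  r = yes λ ()
    zero? {ℕ.suc k} r = map′ (λ { (p , ps) zero → p ; (p , ps) (suc i) → ps i })
                             (λ f → f zero , f ∘ suc)
                             ((r zero ≟ 0#) ×-dec zero? (r ∘ suc))

  span : ∀ {k} → Vector Carrierᴹ k → Submodule M
  span v = record
    { Mem      = λ w → True (combination? v w)
    ; mem?     = λ w → map′ fromWitness toWitness (combination? v w)
    ; resp     = λ x≈y x∈ → let r , eq = toWitness x∈ in fromWitness (r , ≈ᴹ-trans eq x≈y)
    ; 0∈       = fromWitness ((λ _ → 0#) , lincomb-0 v)
    ; +-closed = λ x∈ y∈ → let r , eq = toWitness x∈ ; s , eq′ = toWitness y∈ in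
        fromWitness ((λ i → r i + s i) , ≈ᴹ-trans (lincomb-+ v r s) (+ᴹ-cong eq eq′))
    ; *-closed = λ s x∈ → let r , eq = toWitness x∈ in
        fromWitness ((λ i → r i * s) , ≈ᴹ-trans (lincomb-* v r s) (*ᵣ-cong eq R.refl))
    }

  spanFree : ∀ {k} (v : Vector Carrierᴹ k) → Independent v → FreeSubmodule k
  spanFree v ind = span v , v , ind , λ w → mk⇔ toWitness fromWitness

  abstract
    _⊆?_ : ∀ {j k} (S : FreeSubmodule j) (T : FreeSubmodule k) → Dec (∣ S ∣ ⊆ ∣ T ∣)
    (S , _) ⊆? (T , _) = map′ (λ f {x} → f x) (λ f x → f {x})
      (∀? ≈ᴹ-setoid ms-enum
        (λ x≈y f y∈ → Submodule.resp T x≈y (f (Submodule.resp S (≈ᴹ-sym x≈y) y∈)))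
        (λ x → Submodule.mem? S x →-dec Submodule.mem? T x))

  freeDecSetoid : ℕ → DecSetoid (c ⊔ ℓ ⊔ m ⊔ ℓm ⊔ lsuc 0ℓ) m
  freeDecSetoid k = record
    { Carrier          = FreeSubmodule k
    ; _≈_              = λ S T → ∣ S ∣ ≐ ∣ T ∣
    ; isDecEquivalence = record
      { isEquivalence = Setoid.isEquivalence (freeSetoid k)
      ; _≟_           = λ S T → (S ⊆? T) ×-dec (T ⊆? S)
      }
    }

  private
    candidate : ∀ {k} (v : Vector Carrierᴹ k) → Dec (Independent v) → List (FreeSubmodule k)
    candidate v (yes ind) = [ spanFree v ind ]
    candidate v (no _)    = []

    spans : ∀ k → List (FreeSubmodule k)
    spans k = concatMap (λ v → candidate v (independent? v)) (tuples ≈ᴹ-setoid ms k)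

    spans-complete : ∀ k → IsEnumeration (freeSetoid k) (spans k)
    spans-complete k S@(_ , v , ind , gen) =
      Anyₚ.concatMap⁺ (λ u → candidate u (independent? u))
        (Any.map (λ {u} v≋u → hit u v≋u (independent? u))
          (tuples-complete ≈ᴹ-setoid ms-enum k v))
      where
      hit : ∀ u → v ≋ᴹ u → (d : Dec (Independent u)) →
            SetoidMem._∈_ (freeSetoid k) S (candidate u d)
      hit u v≋u (yes _)  = here
        ( (λ {w} w∈ → let r , eq = Equivalence.to (gen w) w∈ in
             fromWitness (r , ≈ᴹ-trans (lincomb-cong (λ i → ≈ᴹ-sym (v≋u i)) (λ _ → R.refl)) eq))
        , (λ {w} w∈ → let r , eq = toWitness w∈ in
             Equivalence.from (gen w)
               (r , ≈ᴹ-trans (lincomb-cong v≋u (λ _ → R.refl)) eq)))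
      hit u v≋u (no ¬ind) = contradiction
        (λ r eq → ind r (≈ᴹ-trans (lincomb-cong v≋u (λ _ → R.refl)) eq)) ¬ind

  abstract
    frees : ∀ k → List (FreeSubmodule k)
    frees k = deduplicate (DecSetoid._≟_ (freeDecSetoid k)) (spans k)

    frees-complete : ∀ k → IsEnumeration (freeSetoid k) (frees k)
    frees-complete k = Enumₚ.deduplicate⁺ (freeDecSetoid k) (spans-complete k)

    frees-unique : ∀ k → UniqueSetoid.Unique (freeSetoid k) (frees k)
    frees-unique k = UniqueDecₚ.deduplicate-! (freeDecSetoid k) (spans k)

-- PHG(2,R): the sums below run over a repetition-free list of all points, and
-- by points-complete and points-unique do not depend on how it is produced.
module PHG {c ℓ : Level} (R : Ring c ℓ) (finite : IsFinite (Ring.setoid R)) where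
  open Ring R using (Carrier; _≈_; setoid)
  open Finite

  R¹ R² R³ : RightModule R c ℓ
  R¹ = TensorUnit.rightModule
  R² = DirectProduct.rightModule R¹ R¹
  R³ = DirectProduct.rightModule R¹ R²

  open Free R³ public using (∣_∣; FreeSubmodule; freeSetoid)

  Point Line : Set (c ⊔ ℓ ⊔ lsuc 0ℓ)
  Point = FreeSubmodule 1
  Line  = FreeSubmodule 2

  infix 4 _≈ᴾ_ _On_

  _≈ᴾ_ : Point → Point → Set c
  x ≈ᴾ y = ∣ x ∣ ≐ ∣ y ∣

  _On_ : Point → Line → Set c
  x On L = ∣ x ∣ ⊆ ∣ L ∣

  private
    _≟_ : ∀ x y → Dec (x ≈ y)
    x ≟ y = map′ (Injection.injective (Inverse⇒Injection inv)) (Inverse.to-cong inv)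
                 (Inverse.to inv x Finₚ.≟ Inverse.to inv y)
      where
      inv = proj₂ finite

    _≟³_ : ∀ x y → Dec (RightModule._≈ᴹ_ R³ x y)
    (a , b , c) ≟³ (a′ , b′ , c′) = (a ≟ a′) ×-dec ((b ≟ b′) ×-dec (c ≟ c′))

    rs-enum : IsEnumeration setoid (enum finite)
    rs-enum = enum-complete finite

    vectors-enum : IsEnumeration (RightModule.≈ᴹ-setoid R³)
      (cartesianProduct (enum finite) (cartesianProduct (enum finite) (enum finite)))
    vectors-enum =
      Enumₚ.cartesianProduct⁺ setoid (RightModule.≈ᴹ-setoid R²) rs-enum
        (Enumₚ.cartesianProduct⁺ setoid setoid rs-enum rs-enum)

    module E = FreeEnum R³ _≟_ _≟³_ rs-enum vectors-enum

  _on?_ : ∀ x L → Dec (x On L)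
  x on? L = x E.⊆? L

  points : List Point
  points = E.frees 1

  points-complete : IsEnumeration (freeSetoid 1) points
  points-complete = E.frees-complete 1

  points-unique : UniqueSetoid.Unique (freeSetoid 1) points
  points-unique = E.frees-unique 1

  lines : List Line
  lines = E.frees 2

  lines-complete : IsEnumeration (freeSetoid 2) lines
  lines-complete = E.frees-complete 2

  lines-unique : UniqueSetoid.Unique (freeSetoid 2) lines
  lines-unique = E.frees-unique 2

  ∑ : (Point → ℕ) → ℕ
  ∑ K = sum (map K points)

  ∑[_] : Line → (Point → ℕ) → ℕ
  ∑[ L ] K = sum (map K (filter (_on? L) points))

  record IsArc (k n : ℕ) (K : Point → ℕ) : Set (c ⊔ ℓ ⊔ lsuc 0ℓ) where
    field
      cong  : K Preserves _≈ᴾ_ ⟶ _≡_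
      total : ∑ K ≡ k
      line≤ : ∀ L → ∑[ L ] K ℕ.≤ n

  IsProjective : (Point → ℕ) → Set (c ⊔ ℓ ⊔ lsuc 0ℓ)
  IsProjective K = ∀ x → K x ≡ 0 ⊎ K x ≡ 1

  ProjectiveArcExists : ℕ → ℕ → Set (c ⊔ ℓ ⊔ lsuc 0ℓ)
  ProjectiveArcExists k n = ∃[ K ] (IsArc k n K × IsProjective K)

  IsLargest : ℕ → ℕ → Set (c ⊔ ℓ ⊔ lsuc 0ℓ)
  IsLargest n k = ProjectiveArcExists k n × (∀ k′ → ProjectiveArcExists k′ n → k′ ℕ.≤ k)

  private
    _≟ᴾ_ : ∀ x y → Dec (x ≈ᴾ y)
    _≟ᴾ_ = DecSetoid._≟_ (E.freeDecSetoid 1)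

    PointSet : Set (c ⊔ ℓ ⊔ lsuc 0ℓ)
    PointSet = ∃[ K ] ((K Preserves _≈ᴾ_ ⟶ _≡_) × IsProjective K)

    ∅ : PointSet
    ∅ = (λ _ → 0) , (λ _ → ≡.refl) , (λ _ → inj₁ ≡.refl)

    module ≈ᴾ = Setoid (freeSetoid 1)

    update : Point → (b : ℕ) → b ≡ 0 ⊎ b ≡ 1 → PointSet → PointSet
    update p b b01 (K , cong , proj) = K′ , cong′ , proj′
      where
      K′ : Point → ℕ
      K′ x = if does (x ≟ᴾ p) then b else K x
      agree : ∀ {x y} → x ≈ᴾ y → (d : Dec (x ≈ᴾ p)) (d′ : Dec (y ≈ᴾ p)) →
              (if does d then b else K x) ≡ (if does d′ then b else K y)
      agree {x} {y} x≈y (yes _)   (yes _)   = ≡.refl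
      agree {x} {y} x≈y (yes x≈p) (no y≉p)  =
        contradiction (≈ᴾ.trans {y} {x} {p} (≈ᴾ.sym {x} {y} x≈y) x≈p) y≉p
      agree {x} {y} x≈y (no x≉p)  (yes y≈p) =
        contradiction (≈ᴾ.trans {x} {y} {p} x≈y y≈p) x≉p
      agree {x} {y} x≈y (no _)    (no _)    = cong {x} {y} x≈y
      cong′ : K′ Preserves _≈ᴾ_ ⟶ _≡_
      cong′ {x} {y} x≈y = agree {x} {y} x≈y (x ≟ᴾ p) (y ≟ᴾ p)
      values : ∀ x (d : Dec (x ≈ᴾ p)) →
               (if does d then b else K x) ≡ 0 ⊎ (if does d then b else K x) ≡ 1
      values x (yes _) = b01
      values x (no _)  = proj x
      proj′ : IsProjective K′
      proj′ x = values x (x ≟ᴾ p)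

    pointSets : List Point → List PointSet
    pointSets []       = [ ∅ ]
    pointSets (p ∷ ps) =
      concatMap (λ K → update p 0 (inj₁ ≡.refl) K ∷ update p 1 (inj₂ ≡.refl) K ∷ []) (pointSets ps)

    AgreeOn : List Point → (Point → ℕ) → PointSet → Set (c ⊔ ℓ ⊔ lsuc 0ℓ)
    AgreeOn ps K (K′ , _) = ∀ x → SetoidMem._∈_ (freeSetoid 1) x ps → K′ x ≡ K x

    update-agrees : ∀ {p ps K} b b01 K′ → K Preserves _≈ᴾ_ ⟶ _≡_ → K p ≡ b →
                    AgreeOn ps K K′ → AgreeOn (p ∷ ps) K (update p b b01 K′)
    update-agrees {p} {ps} {K} b b01 K′ cong Kp≡b agree x = helper (x ≟ᴾ p)
      where
      helper : (d : Dec (x ≈ᴾ p)) → SetoidMem._∈_ (freeSetoid 1) x (p ∷ ps) →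
               (if does d then b else proj₁ K′ x) ≡ K x
      helper (yes x≈p) _          = ≡.trans (≡.sym Kp≡b) (≡.sym (cong {x} {p} x≈p))
      helper (no x≉p)  (here x≈p) = contradiction x≈p x≉p
      helper (no _)    (there x∈) = agree x x∈

    pointSets-complete : ∀ ps ((K , _) : PointSet) → Any.Any (AgreeOn ps K) (pointSets ps)
    pointSets-complete []       _ = here λ _ ()
    pointSets-complete (p ∷ ps) S@(K , cong , proj) =
      Anyₚ.concatMap⁺ (λ K → update p 0 (inj₁ ≡.refl) K ∷ update p 1 (inj₂ ≡.refl) K ∷ [])
        (Any.map (λ {K′} agree → pick K′ agree (proj p)) (pointSets-complete ps S))
      where
      pick : ∀ K′ → AgreeOn ps K K′ → K p ≡ 0 ⊎ K p ≡ 1 →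
             Any.Any (AgreeOn (p ∷ ps) K)
               (update p 0 (inj₁ ≡.refl) K′ ∷ update p 1 (inj₂ ≡.refl) K′ ∷ [])
      pick K′ agree (inj₁ Kp≡0) = here (update-agrees 0 (inj₁ ≡.refl) K′ cong Kp≡0 agree)
      pick K′ agree (inj₂ Kp≡1) = there (here (update-agrees 1 (inj₂ ≡.refl) K′ cong Kp≡1 agree))

    Bounded : ℕ → PointSet → Set (c ⊔ ℓ ⊔ lsuc 0ℓ)
    Bounded n (K , _) = ∀ L → ∑[ L ] K ℕ.≤ n

    bounded? : ∀ n → Decidable (Bounded n)
    bounded? n (K , _) = ∀? (freeSetoid 2) lines-complete
      (λ {L} {L′} L≈L′ → ≡.subst (λ xs → sum (map K xs) ℕ.≤ n)
        (filter-≐ (_on? L) (_on? L′)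
          ((λ x⊆ y∈ → proj₁ L≈L′ (x⊆ y∈)) , (λ x⊆ y∈ → proj₂ L≈L′ (x⊆ y∈))) points))
      (λ L → ∑[ L ] K ℕₚ.≤? n)

    ∅-bounded : ∀ n → Bounded n ∅
    ∅-bounded n L = ℕₚ.≤-trans (ℕₚ.≤-reflexive (sum-0 (filter (_on? L) points))) z≤n
      where
      sum-0 : ∀ (xs : List Point) → sum (map (λ _ → 0) xs) ≡ 0
      sum-0 []       = ≡.refl
      sum-0 (_ ∷ xs) = sum-0 xs

    size : PointSet → ℕ
    size (K , _) = ∑ K

    open ListExtrema ℕₚ.≤-totalOrder using (argmax; argmax-all; f[xs]≤f[argmax])

    boundedSets : ℕ → List PointSet
    boundedSets n = filter (bounded? n) (pointSets points)

    best : ℕ → PointSet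
    best n = argmax size ∅ (boundedSets n)

  abstract
    largest : ∀ n → ∃ (IsLargest n)
    largest n = size (best n) ,
      ( proj₁ (best n)
      , record
        { cong  = proj₁ (proj₂ (best n))
        ; total = ≡.refl
        ; line≤ = argmax-all size {P = Bounded n} (∅-bounded n)
                    (Allₚ.all-filter (bounded? n) (pointSets points))
        }
      , proj₂ (proj₂ (best n))
      ) , maximal
      where
      maximal : ∀ k → ProjectiveArcExists k n → k ℕ.≤ size (best n)
      maximal k (K , arc , proj) =
        compare (ListMem.find (pointSets-complete points (K , IsArc.cong arc , proj)))
        where
        compare : (∃[ K′ ] (K′ ListMem.∈ pointSets points × AgreeOn points K K′)) →
                  k ℕ.≤ size (best n)
        compare (K′ , K′∈ , agree) = ≡.subst (ℕ._≤ size (best n)) size≡k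
          (All.lookup {P = λ S → size S ℕ.≤ size (best n)} (f[xs]≤f[argmax] {f = size} ∅ (boundedSets n))
            (ListMemₚ.∈-filter⁺ (bounded? n) K′∈ K′-bounded))
          where
          K′≗K : ∀ x → proj₁ K′ x ≡ K x
          K′≗K x = agree x (points-complete x)
          size≡k : size K′ ≡ k
          size≡k = ≡.trans (≡.cong sum (map-cong K′≗K points)) (IsArc.total arc)
          K′-bounded : Bounded n K′
          K′-bounded L = ≡.subst (ℕ._≤ n)
            (≡.cong sum (map-cong (λ x → ≡.sym (K′≗K x)) (filter (_on? L) points)))
            (IsArc.line≤ arc L)

-- m_n(R), characterised by IsLargest through the second component of largest.
𝔪 : ∀ {c ℓ q} → ℕ → ChainRing₂ c ℓ q → ℕ
𝔪 n R = proj₁ (PHG.largest (ChainRing₂.ring R) (ChainRing₂.finite R) n)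

{-# OPTIONS --safe #-}

-- Collapsing neighbour classes turns PHG(2,R) into PG(2,q), with R / rad R ≅ F_q.  Each of the q² lines
-- of a line class ℓ meets each neighbour class x on ℓ in one of q parallel segments, and two of them
-- share a segment of exactly one x.  Counting along the q lines through a segment with w arc points
-- gives κ + q w ≤ u + 3 q, where u and κ are the numbers of arc points in x and in ℓ.  Summed over the
-- q + 1 line classes through x this settles u ≥ 4, except that an equality case with u = 4 is a
-- parallelogram with parallel diagonals, which forces characteristic 2.  Now let all u ≤ 3.  A class x
-- with u ≥ 1 owns line classes ℓ of total excess Σ (w - 1) = u - 1, where κ is about q smaller than
-- usual; ℓ has only one owner, as otherwise some line would contain four arc points.  The total
-- excess is large if k is, but little of it passes through any one class, a contradiction for q ≥ 6.
-- For q = 5 the count is weighted by 2 - u if all u ≤ 2; if some u = 3, the numbers of bisecants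
-- through the segments of a line class, taken modulo 3, exclude line classes with κ ≥ 2 q + 2.

module Submission where

open import Defs
open import Algebra.Bundles using (AbelianGroup; CommutativeMonoid; CommutativeRing; RawRing; Ring)
import Algebra.Properties.AbelianGroup as AbelianGroupₚ
import Algebra.Properties.CommutativeSemigroup as CommutativeSemigroupₚ
import Algebra.Properties.Ring as Ringₚ
open import Algebra.Structures using (IsCommutativeRing)
open import Data.Fin.Base using (Fin; zero; suc; toℕ)
import Data.Fin.Properties as Finₚ
open import Data.List.Base using (List; []; _∷_; _++_; map; filter; lookup; allFin; length;
    cartesianProduct)
open import Data.List.Membership.Propositional.Properties using (∈-lookup)
open import Data.List.Properties using (map-tabulate; length-tabulate)
open import Data.List.Relation.Unary.All as All using (All; []; _∷_; all?)
open import Data.List.Relation.Unary.AllPairs using (AllPairs; []; _∷_)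
import Data.List.Relation.Unary.AllPairs.Properties as AllPairsₚ
open import Data.List.Relation.Unary.Unique.Propositional using (Unique)
open import Data.Product.Base using (_×_; _,_; proj₁; proj₂; ∃)
open import Data.Sum.Base using (_⊎_; inj₁; inj₂)
open import Function.Base using (_∘_; id)
open import Relation.Binary.Definitions using (DecidableEquality; tri<; tri≈; tri>)
open import Relation.Nullary.Decidable
  using (Dec; yes; no; does; _×-dec_; map′; ¬?; from-no; True; toWitness; fromWitness; decidable-stable)
open import Relation.Nullary.Negation using (¬_; contradiction)

-- Summing κ + q w ≤ u + 3 q over the q + 1 directions gives k ≤ 2 q² + 3 q - (q - 1) u. At u = 4
-- this is the bound for even q, too weak by q for odd q; at u = 5 it misses the odd bound by one.
-- Both gaps close when two points of the class have different w in some direction: the larger of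
-- the two weights still satisfies the inequality, and its sum grows by at least 1, which lowers the
-- bound by q. Otherwise w is constant on the class in each direction, hence divides u, and it is at
-- most 3. For u ≤ 3 the same sum yields at best 2 q² + 3, so one class no longer suffices and the
-- count becomes global. There the total of u - 1 over the nonempty classes enters on both sides and
-- cancels, leaving k ≤ (q + 5)(q² + q + 1)/(q + 1), roughly q² + 5 q. This beats the target for
-- large q, but for q = 5 it gives 51 instead of 44, which is why that order is treated by itself.
-- The ring need not be commutative, so left and right multiples of a generator of the radical are
-- kept apart: linear forms are perturbed by the former, points by the latter.

module FiniteSums where
  open import Data.Bool.Base using (if_then_else_)
  open import Data.Nat.Base using (ℕ; zero; suc; _+_; _*_; _≤_; _<_; z≤n; s≤s)
  open import Data.Nat.ListAction using (sum)
  open import Data.Nat.Properties hiding (_≟_)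
  open import Data.Nat.Tactic.RingSolver using (solve-∀)
  open import Relation.Binary.PropositionalEquality

  -- Finite sums, indicators and enumerations

  infixr 8 ∑
  ∑ : ∀ {a} {A : Set a} → List A → (A → ℕ) → ℕ
  ∑ xs f = sum (map f xs)

  syntax ∑ xs (λ x → e) = ∑[ x ← xs ] e

  ⟦_⟧ : ∀ {p} {P : Set p} → Dec P → ℕ
  ⟦ d ⟧ = if does d then 1 else 0

  module _ {p} {P : Set p} where
    ⟦⟧-yes : (d : Dec P) → P → ⟦ d ⟧ ≡ 1
    ⟦⟧-yes (yes _) _ = refl
    ⟦⟧-yes (no ¬p) p = contradiction p ¬p

    ⟦⟧-no : (d : Dec P) → ¬ P → ⟦ d ⟧ ≡ 0
    ⟦⟧-no (yes p) ¬p = contradiction p ¬p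
    ⟦⟧-no (no _)  _  = refl

    ⟦⟧≤1 : (d : Dec P) → ⟦ d ⟧ ≤ 1
    ⟦⟧≤1 (yes _) = ≤-refl
    ⟦⟧≤1 (no _)  = z≤n

    ⟦⟧*-cong : (d : Dec P) {m n : ℕ} → (P → m ≡ n) → ⟦ d ⟧ * m ≡ ⟦ d ⟧ * n
    ⟦⟧*-cong (yes p) f = cong (1 *_) (f p)
    ⟦⟧*-cong (no _)  f = refl

    ⟦⟧*-mono : (d : Dec P) {m n : ℕ} → (P → m ≤ n) → ⟦ d ⟧ * m ≤ ⟦ d ⟧ * n
    ⟦⟧*-mono (yes p) f = *-monoʳ-≤ 1 (f p)
    ⟦⟧*-mono (no _)  f = z≤n

  ⟦⟧-mono : ∀ {p r} {P : Set p} {R : Set r} (d : Dec P) (e : Dec R) → (P → R) → ⟦ d ⟧ ≤ ⟦ e ⟧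
  ⟦⟧-mono (yes p) e f = ≤-reflexive (sym (⟦⟧-yes e (f p)))
  ⟦⟧-mono (no _)  e f = z≤n

  ⟦⟧-⇔ : ∀ {p r} {P : Set p} {R : Set r} (d : Dec P) (e : Dec R) →
         (P → R) → (R → P) → ⟦ d ⟧ ≡ ⟦ e ⟧
  ⟦⟧-⇔ d e f g = ≤-antisym (⟦⟧-mono d e f) (⟦⟧-mono e d g)

  module _ {a} {A : Set a} where
    ∑-cong : ∀ (xs : List A) {f g : A → ℕ} → (∀ x → f x ≡ g x) → ∑ xs f ≡ ∑ xs g
    ∑-cong []       e = refl
    ∑-cong (x ∷ xs) e = cong₂ _+_ (e x) (∑-cong xs e)

    ∑-mono : ∀ (xs : List A) {f g : A → ℕ} → (∀ x → f x ≤ g x) → ∑ xs f ≤ ∑ xs g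
    ∑-mono []       e = z≤n
    ∑-mono (x ∷ xs) e = +-mono-≤ (e x) (∑-mono xs e)

    ∑-zero : ∀ (xs : List A) → ∑[ _ ← xs ] 0 ≡ 0
    ∑-zero []       = refl
    ∑-zero (_ ∷ xs) = ∑-zero xs

    ∑-const : ∀ (xs : List A) c → ∑[ _ ← xs ] c ≡ length xs * c
    ∑-const []       c = refl
    ∑-const (_ ∷ xs) c = cong (c +_) (∑-const xs c)

    ∑-+ : ∀ (xs : List A) (f g : A → ℕ) → ∑[ x ← xs ] (f x + g x) ≡ ∑ xs f + ∑ xs g
    ∑-+ []       f g = refl
    ∑-+ (x ∷ xs) f g = begin
      f x + g x + ∑[ x ← xs ] (f x + g x)  ≡⟨ cong (f x + g x +_) (∑-+ xs f g) ⟩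
      f x + g x + (∑ xs f + ∑ xs g)        ≡⟨ interchange (f x) (g x) (∑ xs f) (∑ xs g) ⟩
      f x + ∑ xs f + (g x + ∑ xs g)        ∎
      where
      open ≡-Reasoning
      interchange : ∀ a b c d → a + b + (c + d) ≡ a + c + (b + d)
      interchange = solve-∀

    ∑-*ˡ : ∀ (xs : List A) c (f : A → ℕ) → ∑[ x ← xs ] (c * f x) ≡ c * ∑ xs f
    ∑-*ˡ []       c f = sym (*-zeroʳ c)
    ∑-*ˡ (x ∷ xs) c f = trans (cong (c * f x +_) (∑-*ˡ xs c f)) (sym (*-distribˡ-+ c (f x) _))

    ∑-*ʳ : ∀ (xs : List A) c (f : A → ℕ) → ∑[ x ← xs ] (f x * c) ≡ ∑ xs f * c
    ∑-*ʳ xs c f = trans (∑-cong xs (λ x → *-comm (f x) c)) (trans (∑-*ˡ xs c f) (*-comm c _))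

    ∑-++ : ∀ (xs ys : List A) (f : A → ℕ) → ∑ (xs ++ ys) f ≡ ∑ xs f + ∑ ys f
    ∑-++ []       ys f = refl
    ∑-++ (x ∷ xs) ys f = trans (cong (f x +_) (∑-++ xs ys f)) (sym (+-assoc (f x) _ _))

    ∑-map : ∀ {b} {B : Set b} (h : B → A) xs (f : A → ℕ) → ∑ (map h xs) f ≡ ∑ xs (f ∘ h)
    ∑-map h []       f = refl
    ∑-map h (x ∷ xs) f = cong (f (h x) +_) (∑-map h xs f)

  module _ {a b} {A : Set a} {B : Set b} where
    ∑-swap : ∀ (xs : List A) (ys : List B) (f : A → B → ℕ) →
             ∑[ x ← xs ] ∑[ y ← ys ] f x y ≡ ∑[ y ← ys ] ∑[ x ← xs ] f x y
    ∑-swap []       ys f = sym (∑-zero ys)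
    ∑-swap (x ∷ xs) ys f = trans (cong (∑ ys (f x) +_) (∑-swap xs ys f))
                                 (sym (∑-+ ys (f x) (λ y → ∑[ x ← xs ] f x y)))

    ∑-*ˡ-swap : ∀ (xs : List A) (ys : List B) (c : A → ℕ) (f : A → B → ℕ) →
                ∑[ x ← xs ] (c x * ∑ ys (f x)) ≡ ∑[ y ← ys ] ∑[ x ← xs ] (c x * f x y)
    ∑-*ˡ-swap xs ys c f = trans (∑-cong xs (λ x → sym (∑-*ˡ ys (c x) (f x))))
                                (∑-swap xs ys (λ x y → c x * f x y))

    ∑-cartesianProduct : ∀ (xs : List A) (ys : List B) (f : A × B → ℕ) →
      ∑ (cartesianProduct xs ys) f ≡ ∑[ x ← xs ] ∑[ y ← ys ] f (x , y)
    ∑-cartesianProduct []       ys f = refl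
    ∑-cartesianProduct (x ∷ xs) ys f =
      trans (∑-++ (map (x ,_) ys) (cartesianProduct xs ys) f)
            (cong₂ _+_ (∑-map (x ,_) ys f) (∑-cartesianProduct xs ys f))

  -- Completeness and absence of repetition form a single equation between sums, so that it can be
  -- substituted directly into double counts.
  record Enumeration {a} (A : Set a) : Set a where
    field
      elems : List A
      _≟_   : DecidableEquality A
      once  : ∀ y → ∑[ x ← elems ] ⟦ x ≟ y ⟧ ≡ 1

    ∑-δ : ∀ y (f : A → ℕ) → ∑[ x ← elems ] (⟦ x ≟ y ⟧ * f x) ≡ f y
    ∑-δ y f = begin
      ∑[ x ← elems ] (⟦ x ≟ y ⟧ * f x)  ≡⟨ ∑-cong elems (λ x → ⟦⟧*-cong (x ≟ y) (cong f)) ⟩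
      ∑[ x ← elems ] (⟦ x ≟ y ⟧ * f y)  ≡⟨ ∑-*ʳ elems (f y) (λ x → ⟦ x ≟ y ⟧) ⟩
      (∑[ x ← elems ] ⟦ x ≟ y ⟧) * f y  ≡⟨ cong (_* f y) (once y) ⟩
      1 * f y                           ≡⟨ *-identityˡ (f y) ⟩
      f y                               ∎
      where open ≡-Reasoning

    term≤∑ : ∀ y (f : A → ℕ) → f y ≤ ∑ elems f
    term≤∑ y f = subst (_≤ ∑ elems f) (∑-δ y f)
      (∑-mono elems (λ x → ≤-trans (*-monoˡ-≤ (f x) (⟦⟧≤1 (x ≟ y))) (≤-reflexive (*-identityˡ (f x)))))

    two-terms≤∑ : ∀ {y z} (f : A → ℕ) → y ≢ z → f y + f z ≤ ∑ elems f
    two-terms≤∑ {y} {z} f y≢z = begin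
      f y + f z  ≡⟨ cong₂ _+_ (sym (∑-δ y f)) (sym (∑-δ z f)) ⟩
      ∑[ x ← elems ] (⟦ x ≟ y ⟧ * f x) + ∑[ x ← elems ] (⟦ x ≟ z ⟧ * f x)
                 ≡⟨ ∑-+ elems _ _ ⟨
      ∑[ x ← elems ] (⟦ x ≟ y ⟧ * f x + ⟦ x ≟ z ⟧ * f x)
                 ≤⟨ ∑-mono elems pointwise ⟩
      ∑ elems f  ∎
      where
      open ≤-Reasoning
      pointwise : ∀ x → ⟦ x ≟ y ⟧ * f x + ⟦ x ≟ z ⟧ * f x ≤ f x
      pointwise x with x ≟ y | x ≟ z
      ... | yes refl | yes refl = contradiction refl y≢z
      ... | yes refl | no _     = ≤-reflexive (trans (+-identityʳ _) (+-identityʳ _))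
      ... | no _     | yes refl = ≤-reflexive (+-identityʳ _)
      ... | no _     | no _     = z≤n

    ∑-strict : ∀ {f g : A → ℕ} → (∀ x → f x ≤ g x) → ∀ y → f y < g y → ∑ elems f < ∑ elems g
    ∑-strict {f} {g} f≤g y fy<gy = begin
      suc (∑ elems f)                             ≡⟨ cong (_+ ∑ elems f) (once y) ⟨
      ∑[ x ← elems ] ⟦ x ≟ y ⟧ + ∑ elems f        ≡⟨ ∑-+ elems _ _ ⟨
      ∑[ x ← elems ] (⟦ x ≟ y ⟧ + f x)            ≤⟨ ∑-mono elems pointwise ⟩
      ∑ elems g                                   ∎
      where
      open ≤-Reasoning
      pointwise : ∀ x → ⟦ x ≟ y ⟧ + f x ≤ g x
      pointwise x with x ≟ y
      ... | yes refl = fy<gy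
      ... | no _     = f≤g x

    any? : ∀ {p} {P : A → Set p} → (∀ x → Dec (P x)) → Dec (∃ P)
    any? {P = P} P? = search elems refl
      where
      -- The equation records that no element discarded so far satisfies `P`; once the list is used
      -- up, it makes the whole count zero.
      search : ∀ xs → ∑[ x ← elems ] ⟦ P? x ⟧ ≡ ∑[ x ← xs ] ⟦ P? x ⟧ → Dec (∃ P)
      search [] e = no λ (y , py) → n≮0 (begin-strict
        0                          <⟨ s≤s z≤n ⟩
        1                          ≡⟨ ⟦⟧-yes (P? y) py ⟨
        ⟦ P? y ⟧                   ≤⟨ term≤∑ y (λ x → ⟦ P? x ⟧) ⟩
        ∑[ x ← elems ] ⟦ P? x ⟧    ≡⟨ e ⟩
        0                          ∎)
        where open ≤-Reasoning
      search (x ∷ xs) e with P? x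
      ... | yes px = yes (x , px)
      ... | no _   = search xs e

  module _ {a p} {A : Set a} (FA : Enumeration A) {Q : A → Set p} (Q? : ∀ x → Dec (Q x)) where
    open Enumeration FA

    private
      listed : List A → A → ℕ
      listed as x = ∑[ y ← as ] ⟦ x ≟ y ⟧

      ∑-listed : ∀ as → ∑[ x ← elems ] listed as x ≡ length as
      ∑-listed as = begin
        ∑[ x ← elems ] ∑[ y ← as ] ⟦ x ≟ y ⟧  ≡⟨ ∑-swap elems as _ ⟩
        ∑[ y ← as ] ∑[ x ← elems ] ⟦ x ≟ y ⟧  ≡⟨ ∑-cong as once ⟩
        ∑[ y ← as ] 1                         ≡⟨ ∑-const as 1 ⟩
        length as * 1                         ≡⟨ *-identityʳ _ ⟩
        length as                             ∎
        where open ≡-Reasoning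

      listed-0 : ∀ {x as} → All (x ≢_) as → listed as x ≡ 0
      listed-0 []                       = refl
      listed-0 {x} {y ∷ _} (x≢y ∷ x∉as) = cong₂ _+_ (⟦⟧-no (x ≟ y) x≢y) (listed-0 x∉as)

    count-lower : ∀ {as} → Unique as → All Q as → length as ≤ ∑[ x ← elems ] ⟦ Q? x ⟧
    count-lower {as} uniq Qas = subst (_≤ _) (∑-listed as) (∑-mono elems (pointwise uniq Qas))
      where
      pointwise : ∀ {as} → Unique as → All Q as → ∀ x → listed as x ≤ ⟦ Q? x ⟧
      pointwise []           []         x = z≤n
      pointwise {y ∷ as} (y∉as ∷ uniq) (Qy ∷ Qas) x with x ≟ y
      ... | yes refl = ≤-reflexive (trans (cong suc (listed-0 y∉as)) (sym (⟦⟧-yes (Q? x) Qy)))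
      ... | no _     = pointwise uniq Qas x

    -- Pigeonhole in the form that yields a witness: if all elements satisfying `Q` were listed, the
    -- list would be at least as long as the count.
    count-upper : ∀ as → length as < ∑[ x ← elems ] ⟦ Q? x ⟧ → ∃ λ x → Q x × All (x ≢_) as
    count-upper as short with any? (λ x → Q? x ×-dec all? (λ y → ¬? (x ≟ y)) as)
    ... | yes found = found
    ... | no ¬found = contradiction (≤-trans short
        (≤-trans (∑-mono elems pointwise) (≤-reflexive (∑-listed as)))) (<-irrefl refl)
      where
      pointwise : ∀ x → ⟦ Q? x ⟧ ≤ listed as x
      pointwise x with Q? x
      ... | no _   = z≤n
      ... | yes Qx = occurs as λ x∉as → ¬found (x , Qx , x∉as)
        where
        occurs : ∀ as → ¬ All (x ≢_) as → 1 ≤ listed as x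
        occurs []       ¬∉ = contradiction [] ¬∉
        occurs (y ∷ as) ¬∉ with x ≟ y
        ... | yes _   = s≤s z≤n
        ... | no  x≢y = occurs as λ x∉as → ¬∉ (x≢y ∷ x∉as)

  ∑-allFin-suc : ∀ {n} (f : Fin (suc n) → ℕ) → ∑ (allFin (suc n)) f ≡ f zero + ∑ (allFin n) (f ∘ suc)
  ∑-allFin-suc {n} f = cong (f zero +_) (trans
    (cong (λ xs → ∑ xs f) (sym (map-tabulate {n = n} id Fin.suc)))
    (∑-map Fin.suc (allFin n) f))

  allFin-once : ∀ {n} (y : Fin n) → ∑[ x ← allFin n ] ⟦ x Finₚ.≟ y ⟧ ≡ 1
  allFin-once {suc n} zero    = trans (∑-allFin-suc {n} (λ x → ⟦ x Finₚ.≟ zero ⟧))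
                                      (cong suc (∑-zero (allFin n)))
  allFin-once {suc n} (suc y) = trans (∑-allFin-suc {n} (λ x → ⟦ x Finₚ.≟ suc y ⟧))
    (trans (∑-cong (allFin n) (λ x → ⟦⟧-⇔ (suc x Finₚ.≟ suc y) (x Finₚ.≟ y) Finₚ.suc-injective (cong suc)))
           (allFin-once y))

  finFin : ∀ n → Enumeration (Fin n)
  finFin n = record { elems = allFin n ; _≟_ = Finₚ._≟_ ; once = allFin-once }

  ⟦×⟧ : ∀ {p r} {P : Set p} {R : Set r} (d : Dec P) (e : Dec R) → ⟦ d ×-dec e ⟧ ≡ ⟦ d ⟧ * ⟦ e ⟧
  ⟦×⟧ (yes _) (yes _) = refl
  ⟦×⟧ (yes _) (no _)  = refl
  ⟦×⟧ (no _)  e       = refl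

  module _ {a b} {A : Set a} {B : Set b} (FA : Enumeration A) (FB : Enumeration B) where
    private
      module A = Enumeration FA
      module B = Enumeration FB

    ×-≟ : DecidableEquality (A × B)
    ×-≟ (x , y) (x′ , y′) = map′ (λ (e , e′) → cong₂ _,_ e e′) (λ e → cong proj₁ e , cong proj₂ e)
                              ((x A.≟ x′) ×-dec (y B.≟ y′))

    fin× : Enumeration (A × B)
    fin× = record
      { elems = cartesianProduct A.elems B.elems
      ; _≟_   = ×-≟
      ; once  = λ (x , y) → begin
          ∑[ z ← cartesianProduct A.elems B.elems ] ⟦ ×-≟ z (x , y) ⟧
            ≡⟨ ∑-cartesianProduct A.elems B.elems _ ⟩
          ∑[ x′ ← A.elems ] ∑[ y′ ← B.elems ] ⟦ ×-≟ (x′ , y′) (x , y) ⟧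
            ≡⟨ ∑-cong A.elems (λ x′ → trans
                 (∑-cong B.elems (λ y′ → ⟦×⟧ (x′ A.≟ x) (y′ B.≟ y)))
                 (trans (∑-*ˡ B.elems ⟦ x′ A.≟ x ⟧ _)
                   (trans (cong (⟦ x′ A.≟ x ⟧ *_) (B.once y)) (*-identityʳ _)))) ⟩
          ∑[ x′ ← A.elems ] ⟦ x′ A.≟ x ⟧
            ≡⟨ A.once x ⟩
          1 ∎
      }
      where open ≡-Reasoning

  -- Replaces linear arithmetic: e is the slack with which L ≤ R yields l ≤ r, so that a ring solver
  -- can do the rest.
  linear : ∀ {L R l r} e → L ≤ R → l + R + e ≡ r + L → l ≤ r
  linear {L} {R} {l} {r} e L≤R eq = +-cancelʳ-≤ R l r (begin
    l + R      ≤⟨ m≤m+n (l + R) e ⟩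
    l + R + e  ≡⟨ eq ⟩
    r + L      ≤⟨ +-monoʳ-≤ r L≤R ⟩
    r + R      ∎)
    where open ≤-Reasoning

  module _ {a} {A : Set a} where
    ∑-lookup : ∀ (xs : List A) (f : A → ℕ) → ∑[ i ← allFin (length xs) ] f (lookup xs i) ≡ ∑ xs f
    ∑-lookup []       f = refl
    ∑-lookup (x ∷ xs) f = trans (∑-allFin-suc (λ i → f (lookup (x ∷ xs) i))) (cong (f x +_) (∑-lookup xs f))

    lookup-AllPairs : ∀ {r} {R : A → A → Set r} {xs} → (∀ {x y} → R x y → R y x) → AllPairs R xs →
                      ∀ {i j} → i ≢ j → R (lookup xs i) (lookup xs j)
    lookup-AllPairs sym-R (r ∷ rs) {zero}  {zero}  i≢j = contradiction refl i≢j
    lookup-AllPairs sym-R (r ∷ rs) {zero}  {suc j} i≢j = All.lookup r (∈-lookup j)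
    lookup-AllPairs sym-R (r ∷ rs) {suc i} {zero}  i≢j = sym-R (All.lookup r (∈-lookup i))
    lookup-AllPairs sym-R (r ∷ rs) {suc i} {suc j} i≢j = lookup-AllPairs sym-R rs (i≢j ∘ cong suc)

    ∑-filter : ∀ {p} {P : A → Set p} (P? : ∀ x → Dec (P x)) xs (f : A → ℕ) →
               ∑ (filter P? xs) f ≡ ∑[ x ← xs ] (⟦ P? x ⟧ * f x)
    ∑-filter P? []       f = refl
    ∑-filter P? (x ∷ xs) f with P? x
    ... | yes _ = cong₂ _+_ (sym (+-identityʳ (f x))) (∑-filter P? xs f)
    ... | no _  = ∑-filter P? xs f

open FiniteSums

-- The combinatorial model of the plane and its arcs

module Combinatorics where
  open import Data.Nat.Base using (ℕ; zero; suc; _+_; _*_; _∸_; _⊔_; _≤_; _<_; z≤n; s≤s)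
  open import Data.Nat.Divisibility using (_∣_; divides; _∣?_; _∣0; ∣-reflexive; ∣m∣n⇒∣m+n; ∣n⇒∣m*n)
  open import Data.Nat.Properties as ℕₚ hiding (_≟_)
  open import Data.Nat.Tactic.RingSolver using (solve-∀)
  open import Relation.Binary.PropositionalEquality

  -- Pt stands both for the neighbour classes of points and for those of lines, that is, for the points
  -- and lines of PG(2,q).  The lines of a class ℓ are indexed by Tr, and seg ℓ b x is the segment in
  -- which the line b meets the class x.
  record Geometry (q : ℕ) : Set₁ where
    field
      Pt    : Set
      finPt : Enumeration Pt
      _on_  : Pt → Pt → Set
      _on?_ : ∀ x ℓ → Dec (x on ℓ)
      Tr    : Set
      finTr : Enumeration Tr
      seg   : Pt → Tr → Pt → Fin q
    open Enumeration finPt public using () renaming (elems to pts; _≟_ to _≟ᴾ_)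
    open Enumeration finTr public using () renaming (elems to trs; _≟_ to _≟ᵀ_)
    field
      card  : length pts ≡ q * q + q + 1
      join  : ∀ x y → ∑[ ℓ ← pts ] (⟦ x on? ℓ ⟧ * ⟦ y on? ℓ ⟧) ≡ 1 + q * ⟦ x ≟ᴾ y ⟧
      meet  : ∀ ℓ → ∑[ x ← pts ] ⟦ x on? ℓ ⟧ ≡ q + 1
      cross : ∀ {ℓ x y} → x on ℓ → y on ℓ → x ≢ y → ∀ s t →
              ∑[ b ← trs ] (⟦ seg ℓ b x Finₚ.≟ s ⟧ * ⟦ seg ℓ b y Finₚ.≟ t ⟧) ≡ 1

  -- The arc points are indexed by Fin k: cls i is the neighbour class of the i-th point and g i ℓ the
  -- segment in the direction ℓ that contains it.
  record Arc {q : ℕ} (G : Geometry q) (k : ℕ) : Set where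
    open Geometry G
    field
      cls : Fin k → Pt
      g   : Fin k → Pt → Fin q
      ≤3  : ∀ ℓ b → ∑[ i ← allFin k ] (⟦ cls i on? ℓ ⟧ * ⟦ g i ℓ Finₚ.≟ seg ℓ b (cls i) ⟧) ≤ 3
      separated : ∀ {i j} → i ≢ j → cls i ≡ cls j →
                  ∑[ ℓ ← pts ] (⟦ cls i on? ℓ ⟧ * ⟦ g j ℓ Finₚ.≟ g i ℓ ⟧) ≡ 1
      -- The segments of a class are the lines of an affine plane; the hypotheses say ab ∥ cd, ac ∥
      -- bd and ad ∥ bc, each pair on distinct parallels.
      parallelogram : ∀ a b c d {ℓ₂ ℓ₃ ℓ₄} → cls a ≡ cls b → cls a ≡ cls c → cls a ≡ cls d →
        cls a on ℓ₂ → cls a on ℓ₃ → cls a on ℓ₄ →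
        g a ℓ₂ ≡ g b ℓ₂ → g c ℓ₂ ≡ g d ℓ₂ → g a ℓ₂ ≢ g c ℓ₂ →
        g a ℓ₃ ≡ g c ℓ₃ → g b ℓ₃ ≡ g d ℓ₃ → g a ℓ₃ ≢ g b ℓ₃ →
        g a ℓ₄ ≡ g d ℓ₄ → g b ℓ₄ ≡ g c ℓ₄ → g a ℓ₄ ≢ g b ℓ₄ → 2 ∣ q

  -- Counting through a segment and through a neighbour class

  module Counting {q : ℕ} (1≤q : 1 ≤ q) (G : Geometry q) {k : ℕ} (K : Arc G k) where
    open Geometry G
    open Arc K
    module Ptₚ = Enumeration finPt
    module Trₚ = Enumeration finTr
    module Arcₚ = Enumeration (finFin k)

    is : List (Fin k)
    is = allFin k

    infix 4 _≟ᶠ_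
    _≟ᶠ_ : (s t : Fin q) → Dec (s ≡ t)
    _≟ᶠ_ = Finₚ._≟_

    -- u, κ, n, m and w count the arc points in a neighbour class, in a line class, on a segment, on a
    -- line, and on the segment of the i-th point.
    u κ : Pt → ℕ
    u x = ∑[ j ← is ] ⟦ cls j ≟ᴾ x ⟧
    κ ℓ = ∑[ j ← is ] ⟦ cls j on? ℓ ⟧

    n : Pt → Pt → Fin q → ℕ
    n x ℓ s = ∑[ j ← is ] (⟦ cls j ≟ᴾ x ⟧ * ⟦ g j ℓ ≟ᶠ s ⟧)

    w : Fin k → Pt → ℕ
    w i ℓ = n (cls i) ℓ (g i ℓ)

    m : Pt → Tr → ℕ
    m ℓ b = ∑[ i ← is ] (⟦ cls i on? ℓ ⟧ * ⟦ g i ℓ ≟ᶠ seg ℓ b (cls i) ⟧)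

    another : ∀ {x ℓ} → x on ℓ → ∃ λ y → y on ℓ × y ≢ x
    another {x} {ℓ} x∈ℓ with Ptₚ.any? (λ y → (y on? ℓ) ×-dec ¬? (y ≟ᴾ x))
    ... | yes p = p
    ... | no ¬p = contradiction (begin
        1 + 1                     ≤⟨ +-monoˡ-≤ 1 1≤q ⟩
        q + 1                     ≡⟨ meet ℓ ⟨
        ∑[ y ← pts ] ⟦ y on? ℓ ⟧  ≤⟨ ∑-mono pts (λ y → ⟦⟧-mono (y on? ℓ) (y ≟ᴾ x) (only y)) ⟩
        ∑[ y ← pts ] ⟦ y ≟ᴾ x ⟧   ≡⟨ Ptₚ.once x ⟩
        1                         ∎) λ { (s≤s ()) }
      where
      open ≤-Reasoning
      only : ∀ y → y on ℓ → y ≡ x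
      only y y∈ℓ with y ≟ᴾ x
      ... | yes e = e
      ... | no y≢x = contradiction (y , y∈ℓ , y≢x) ¬p

    -- Fix a second class `y` on `ℓ`: by `cross`, each of its q segments is joined to `s` by exactly
    -- one line.
    through : ∀ {x ℓ} → x on ℓ → ∀ s → ∑[ b ← trs ] ⟦ seg ℓ b x ≟ᶠ s ⟧ ≡ q
    through {x} {ℓ} x∈ℓ s with another x∈ℓ
    ... | y , y∈ℓ , y≢x = begin
        ∑[ b ← trs ] ⟦ seg ℓ b x ≟ᶠ s ⟧
          ≡⟨ ∑-cong trs (λ b → sym (expand b)) ⟩
        ∑[ b ← trs ] ∑[ t ← allFin q ] (⟦ seg ℓ b x ≟ᶠ s ⟧ * ⟦ seg ℓ b y ≟ᶠ t ⟧)
          ≡⟨ ∑-swap trs (allFin q) _ ⟩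
        ∑[ t ← allFin q ] ∑[ b ← trs ] (⟦ seg ℓ b x ≟ᶠ s ⟧ * ⟦ seg ℓ b y ≟ᶠ t ⟧)
          ≡⟨ ∑-cong (allFin q) (λ t → cross x∈ℓ y∈ℓ (λ e → y≢x (sym e)) s t) ⟩
        ∑[ t ← allFin q ] 1
          ≡⟨ ∑-const (allFin q) 1 ⟩
        length (allFin q) * 1
          ≡⟨ trans (*-identityʳ _) (length-tabulate {n = q} id) ⟩
        q ∎
      where
      open ≡-Reasoning
      flip≟ : ∀ (s t : Fin q) → ⟦ s ≟ᶠ t ⟧ ≡ ⟦ t ≟ᶠ s ⟧
      flip≟ s t = ⟦⟧-⇔ (s ≟ᶠ t) (t ≟ᶠ s) sym sym
      expand : ∀ b → ∑[ t ← allFin q ] (⟦ seg ℓ b x ≟ᶠ s ⟧ * ⟦ seg ℓ b y ≟ᶠ t ⟧) ≡ ⟦ seg ℓ b x ≟ᶠ s ⟧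
      expand b = trans (∑-*ˡ (allFin q) ⟦ seg ℓ b x ≟ᶠ s ⟧ _)
        (trans (cong (⟦ seg ℓ b x ≟ᶠ s ⟧ *_)
          (trans (∑-cong (allFin q) (λ t → flip≟ (seg ℓ b y) t)) (allFin-once (seg ℓ b y))))
        (*-identityʳ _))

    -- Of the q lines through `s`, a point of `x` on `s` lies on all, a point of `x` off `s` on
    -- none, and a point of another class of `ℓ` on exactly one.
    pencil : ∀ {x ℓ} → x on ℓ → ∀ s →
             ∑[ b ← trs ] (⟦ seg ℓ b x ≟ᶠ s ⟧ * m ℓ b) + u x ≡ κ ℓ + q * n x ℓ s
    pencil {x} {ℓ} x∈ℓ s = begin
      ∑[ b ← trs ] (⟦ seg ℓ b x ≟ᶠ s ⟧ * m ℓ b) + u x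
        ≡⟨ cong (_+ u x) (∑-*ˡ-swap trs is (λ b → ⟦ seg ℓ b x ≟ᶠ s ⟧) _) ⟩
      ∑[ j ← is ] ∑[ b ← trs ] term b j + u x
        ≡⟨ ∑-+ is _ _ ⟨
      ∑[ j ← is ] (∑[ b ← trs ] term b j + ⟦ cls j ≟ᴾ x ⟧)
        ≡⟨ ∑-cong is pointwise ⟩
      ∑[ j ← is ] (⟦ cls j on? ℓ ⟧ + q * (⟦ cls j ≟ᴾ x ⟧ * ⟦ g j ℓ ≟ᶠ s ⟧))
        ≡⟨ ∑-+ is _ _ ⟩
      κ ℓ + ∑[ j ← is ] (q * (⟦ cls j ≟ᴾ x ⟧ * ⟦ g j ℓ ≟ᶠ s ⟧))
        ≡⟨ cong (κ ℓ +_) (∑-*ˡ is q _) ⟩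
      κ ℓ + q * n x ℓ s ∎
      where
      open ≡-Reasoning
      term : Tr → Fin k → ℕ
      term b j = ⟦ seg ℓ b x ≟ᶠ s ⟧ * (⟦ cls j on? ℓ ⟧ * ⟦ g j ℓ ≟ᶠ seg ℓ b (cls j) ⟧)
      pointwise : ∀ j → ∑[ b ← trs ] term b j + ⟦ cls j ≟ᴾ x ⟧ ≡
                        ⟦ cls j on? ℓ ⟧ + q * (⟦ cls j ≟ᴾ x ⟧ * ⟦ g j ℓ ≟ᶠ s ⟧)
      pointwise j with cls j ≟ᴾ x
      ... | yes refl = trans (+-comm _ 1) (trans (cong suc (begin
              ∑[ b ← trs ] term b j
                ≡⟨ ∑-cong trs (λ b → ⟦⟧*-cong (seg ℓ b (cls j) ≟ᶠ s) (λ e →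
                     trans (cong (_* ⟦ g j ℓ ≟ᶠ seg ℓ b (cls j) ⟧) (⟦⟧-yes (cls j on? ℓ) x∈ℓ))
                     (trans (*-identityˡ _) (cong (λ t → ⟦ g j ℓ ≟ᶠ t ⟧) e)))) ⟩
              ∑[ b ← trs ] (⟦ seg ℓ b (cls j) ≟ᶠ s ⟧ * ⟦ g j ℓ ≟ᶠ s ⟧)
                ≡⟨ ∑-*ʳ trs _ _ ⟩
              (∑[ b ← trs ] ⟦ seg ℓ b (cls j) ≟ᶠ s ⟧) * ⟦ g j ℓ ≟ᶠ s ⟧
                ≡⟨ cong₂ _*_ (through x∈ℓ s) (sym (+-identityʳ _)) ⟩
              q * (1 * ⟦ g j ℓ ≟ᶠ s ⟧) ∎))
            (cong (_+ q * (1 * ⟦ g j ℓ ≟ᶠ s ⟧)) (sym (⟦⟧-yes (cls j on? ℓ) x∈ℓ))))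
      ... | no ≢x with cls j on? ℓ
      ...   | yes j∈ℓ = trans (+-identityʳ _) (trans
                (trans (∑-cong trs (λ b → cong (⟦ seg ℓ b x ≟ᶠ s ⟧ *_) (trans (*-identityˡ _)
                          (⟦⟧-⇔ (g j ℓ ≟ᶠ seg ℓ b (cls j)) (seg ℓ b (cls j) ≟ᶠ g j ℓ) sym sym))))
                       (cross x∈ℓ j∈ℓ (λ e → ≢x (sym e)) s (g j ℓ)))
                (cong suc (sym (*-zeroʳ q))))
      ...   | no _   = trans (+-identityʳ _) (trans
                (trans (∑-cong trs (λ b → *-zeroʳ ⟦ seg ℓ b x ≟ᶠ s ⟧)) (∑-zero trs))
                (sym (*-zeroʳ q)))

    lineclass-bound : ∀ i {ℓ} → cls i on ℓ → κ ℓ + q * w i ℓ ≤ u (cls i) + 3 * q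
    lineclass-bound i {ℓ} i∈ℓ = begin
      κ ℓ + q * w i ℓ
        ≡⟨ pencil i∈ℓ (g i ℓ) ⟨
      ∑[ b ← trs ] (⟦ seg ℓ b (cls i) ≟ᶠ g i ℓ ⟧ * m ℓ b) + u (cls i)
        ≤⟨ +-monoˡ-≤ _ (∑-mono trs (λ b → *-monoʳ-≤ ⟦ seg ℓ b (cls i) ≟ᶠ g i ℓ ⟧ (≤3 ℓ b))) ⟩
      ∑[ b ← trs ] (⟦ seg ℓ b (cls i) ≟ᶠ g i ℓ ⟧ * 3) + u (cls i)
        ≡⟨ cong (_+ u (cls i)) (trans (∑-*ʳ trs 3 _) (cong (_* 3) (through i∈ℓ (g i ℓ)))) ⟩
      q * 3 + u (cls i)
        ≡⟨ trans (+-comm _ (u (cls i))) (cong (u (cls i) +_) (*-comm q 3)) ⟩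
      u (cls i) + 3 * q ∎
      where open ≤-Reasoning

    ∑-on : ∀ x → ∑[ ℓ ← pts ] ⟦ x on? ℓ ⟧ ≡ q + 1
    ∑-on x = begin
      ∑[ ℓ ← pts ] ⟦ x on? ℓ ⟧                   ≡⟨ ∑-cong pts (λ ℓ → idem (x on? ℓ)) ⟩
      ∑[ ℓ ← pts ] (⟦ x on? ℓ ⟧ * ⟦ x on? ℓ ⟧)   ≡⟨ join x x ⟩
      1 + q * ⟦ x ≟ᴾ x ⟧                         ≡⟨ cong (λ e → 1 + q * e) (⟦⟧-yes (x ≟ᴾ x) refl) ⟩
      1 + q * 1                                  ≡⟨ trans (cong suc (*-identityʳ q)) (+-comm 1 q) ⟩
      q + 1                                      ∎
      where
      open ≡-Reasoning
      idem : ∀ {p} {P : Set p} (d : Dec P) → ⟦ d ⟧ ≡ ⟦ d ⟧ * ⟦ d ⟧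
      idem (yes _) = refl
      idem (no _)  = refl

    -- A point in the class `x` is counted by all q + 1 directions, any other point only by the one
    -- joining its class to `x`.
    ∑-κ : ∀ x → ∑[ ℓ ← pts ] (⟦ x on? ℓ ⟧ * κ ℓ) ≡ k + q * u x
    ∑-κ x = begin
      ∑[ ℓ ← pts ] (⟦ x on? ℓ ⟧ * κ ℓ)
        ≡⟨ ∑-*ˡ-swap pts is (λ ℓ → ⟦ x on? ℓ ⟧) _ ⟩
      ∑[ j ← is ] ∑[ ℓ ← pts ] (⟦ x on? ℓ ⟧ * ⟦ cls j on? ℓ ⟧)
        ≡⟨ ∑-cong is (λ j → trans (join x (cls j)) (cong (λ e → 1 + q * e)
             (⟦⟧-⇔ (x ≟ᴾ cls j) (cls j ≟ᴾ x) sym sym))) ⟩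
      ∑[ j ← is ] (1 + q * ⟦ cls j ≟ᴾ x ⟧)
        ≡⟨ ∑-+ is _ _ ⟩
      ∑[ j ← is ] 1 + ∑[ j ← is ] (q * ⟦ cls j ≟ᴾ x ⟧)
        ≡⟨ cong₂ _+_ (trans (∑-const is 1) (trans (*-identityʳ _) (length-tabulate {n = k} id))) (∑-*ˡ is q _) ⟩
      k + q * u x ∎
      where open ≡-Reasoning

    -- The i-th point counts itself in all q + 1 directions, and by `separated` every other point of
    -- its class in exactly one.
    ∑-w : ∀ i → ∑[ ℓ ← pts ] (⟦ cls i on? ℓ ⟧ * w i ℓ) ≡ q + u (cls i)
    ∑-w i = begin
      ∑[ ℓ ← pts ] (⟦ cls i on? ℓ ⟧ * w i ℓ)
        ≡⟨ ∑-*ˡ-swap pts is (λ ℓ → ⟦ cls i on? ℓ ⟧) _ ⟩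
      ∑[ j ← is ] ∑[ ℓ ← pts ] (⟦ cls i on? ℓ ⟧ * (⟦ cls j ≟ᴾ cls i ⟧ * ⟦ g j ℓ ≟ᶠ g i ℓ ⟧))
        ≡⟨ ∑-cong is pointwise ⟩
      ∑[ j ← is ] (q * ⟦ j Finₚ.≟ i ⟧ + ⟦ cls j ≟ᴾ cls i ⟧)
        ≡⟨ ∑-+ is _ _ ⟩
      ∑[ j ← is ] (q * ⟦ j Finₚ.≟ i ⟧) + u (cls i)
        ≡⟨ cong (_+ u (cls i)) (trans (∑-*ˡ is q _) (trans (cong (q *_) (allFin-once i)) (*-identityʳ q))) ⟩
      q + u (cls i) ∎
      where
      open ≡-Reasoning
      pointwise : ∀ j → ∑[ ℓ ← pts ] (⟦ cls i on? ℓ ⟧ * (⟦ cls j ≟ᴾ cls i ⟧ * ⟦ g j ℓ ≟ᶠ g i ℓ ⟧)) ≡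
                        q * ⟦ j Finₚ.≟ i ⟧ + ⟦ cls j ≟ᴾ cls i ⟧
      pointwise j with cls j ≟ᴾ cls i | j Finₚ.≟ i
      ... | no ≢ | yes refl = contradiction refl ≢
      ... | no ≢ | no _ = trans (∑-cong pts (λ ℓ → *-zeroʳ ⟦ cls i on? ℓ ⟧))
            (trans (∑-zero pts) (sym (trans (+-identityʳ _) (*-zeroʳ q))))
      ... | yes e | no j≢i = trans
            (∑-cong pts (λ ℓ → cong (⟦ cls i on? ℓ ⟧ *_) (*-identityˡ _)))
            (trans (separated (λ i≡j → j≢i (sym i≡j)) (sym e)) (sym (cong (_+ 1) (*-zeroʳ q))))
      ... | yes e | yes refl = trans
            (∑-cong pts (λ ℓ → trans (cong (⟦ cls i on? ℓ ⟧ *_)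
               (trans (*-identityˡ _) (⟦⟧-yes (g i ℓ ≟ᶠ g i ℓ) refl))) (*-identityʳ _)))
            (trans (∑-on (cls i)) (cong (_+ 1) (sym (*-identityʳ q))))

    1≤w : ∀ i ℓ → 1 ≤ w i ℓ
    1≤w i ℓ = begin
      1 ≡⟨ cong₂ _*_ (⟦⟧-yes (cls i ≟ᴾ cls i) refl) (⟦⟧-yes (g i ℓ ≟ᶠ g i ℓ) refl) ⟨
      ⟦ cls i ≟ᴾ cls i ⟧ * ⟦ g i ℓ ≟ᶠ g i ℓ ⟧ ≤⟨ Arcₚ.term≤∑ i _ ⟩
      w i ℓ ∎
      where open ≤-Reasoning

    ∑-through : ∀ x c {f : Pt → ℕ} → (∀ ℓ → x on ℓ → f ℓ ≤ c) →
                ∑[ ℓ ← pts ] (⟦ x on? ℓ ⟧ * f ℓ) ≤ (q + 1) * c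
    ∑-through x c {f} f≤c = begin
      ∑[ ℓ ← pts ] (⟦ x on? ℓ ⟧ * f ℓ)  ≤⟨ ∑-mono pts (λ ℓ → ⟦⟧*-mono (x on? ℓ) (f≤c ℓ)) ⟩
      ∑[ ℓ ← pts ] (⟦ x on? ℓ ⟧ * c)    ≡⟨ ∑-*ʳ pts c _ ⟩
      (∑[ ℓ ← pts ] ⟦ x on? ℓ ⟧) * c    ≡⟨ cong (_* c) (∑-on x) ⟩
      (q + 1) * c                       ∎
      where open ≤-Reasoning

    -- The common form of all averaging over directions: a trade between κ and a weight `W` at rate
    -- `d`, valid for each line class through `x`, becomes a bound on `k`.
    weighted-bound : ∀ x c d (W : Pt → ℕ) → (∀ ℓ → x on ℓ → κ ℓ + d * W ℓ ≤ c) →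
                     k + q * u x + d * ∑[ ℓ ← pts ] (⟦ x on? ℓ ⟧ * W ℓ) ≤ (q + 1) * c
    weighted-bound x c d W bound = begin
      k + q * u x + d * ∑[ ℓ ← pts ] (⟦ x on? ℓ ⟧ * W ℓ)
        ≡⟨ cong₂ _+_ (sym (∑-κ x)) (sym (∑-*ˡ pts d _)) ⟩
      ∑[ ℓ ← pts ] (⟦ x on? ℓ ⟧ * κ ℓ) + ∑[ ℓ ← pts ] (d * (⟦ x on? ℓ ⟧ * W ℓ))
        ≡⟨ ∑-+ pts _ _ ⟨
      ∑[ ℓ ← pts ] (⟦ x on? ℓ ⟧ * κ ℓ + d * (⟦ x on? ℓ ⟧ * W ℓ))
        ≡⟨ ∑-cong pts (λ ℓ → factor ⟦ x on? ℓ ⟧ (κ ℓ) d (W ℓ)) ⟩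
      ∑[ ℓ ← pts ] (⟦ x on? ℓ ⟧ * (κ ℓ + d * W ℓ))
        ≤⟨ ∑-through x c bound ⟩
      (q + 1) * c ∎
      where
      open ≤-Reasoning
      factor : ∀ o a d W → o * a + d * (o * W) ≡ o * (a + d * W)
      factor = solve-∀

  ∑-∣ : ∀ {a} {A : Set a} (xs : List A) {d} {f : A → ℕ} → (∀ x → d ∣ f x) → d ∣ ∑ xs f
  ∑-∣ []       d∣f = _ ∣0
  ∑-∣ (x ∷ xs) d∣f = ∣m∣n⇒∣m+n (d∣f x) (∑-∣ xs d∣f)

  -- Neighbour classes with at least four points

  module LargeClass {q : ℕ} (1≤q : 1 ≤ q) (G : Geometry q) {k : ℕ} (K : Arc G k) where
    open Geometry G
    open Arc K
    open Counting 1≤q G K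

    onSeg? : ∀ x ℓ s j → Dec (cls j ≡ x × g j ℓ ≡ s)
    onSeg? x ℓ s j = (cls j ≟ᴾ x) ×-dec (g j ℓ ≟ᶠ s)

    n-count : ∀ x ℓ s → n x ℓ s ≡ ∑[ j ← is ] ⟦ onSeg? x ℓ s j ⟧
    n-count x ℓ s = ∑-cong is (λ j → sym (⟦×⟧ (cls j ≟ᴾ x) (g j ℓ ≟ᶠ s)))

    class-bound : ∀ i → k + q * u (cls i) ≤ 2 * (q * q) + 3 * q + u (cls i)
    class-bound i = linear 0
      (subst (λ W → k + q * u (cls i) + q * W ≤ (q + 1) * (u (cls i) + 3 * q)) (∑-w i)
        (weighted-bound (cls i) (u (cls i) + 3 * q) q (w i) (λ ℓ → lineclass-bound i)))
      (identity k q (u (cls i)))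
      where
      identity : ∀ k q u → k + q * u + (q + 1) * (u + 3 * q) + 0 ≡
                           2 * (q * q) + 3 * q + u + (k + q * u + q * (q + u))
      identity = solve-∀

    Unbalanced : Fin k → Fin k → Pt → Set
    Unbalanced i j ℓ = cls j ≡ cls i × cls i on ℓ × w i ℓ < w j ℓ

    module _ {i j ℓ₀} (unb : Unbalanced i j ℓ₀) where
      -- Both points satisfy `lineclass-bound`, so the larger weight does too, while its sum over
      -- the directions strictly exceeds that of `w i`.
      W : Pt → ℕ
      W ℓ = w i ℓ ⊔ w j ℓ

      ∑-W : q + u (cls i) + 1 ≤ ∑[ ℓ ← pts ] (⟦ cls i on? ℓ ⟧ * W ℓ)
      ∑-W = let (_ , i∈ℓ₀ , w<w) = unb in begin
        q + u (cls i) + 1                              ≡⟨ +-comm _ 1 ⟩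
        suc (q + u (cls i))                            ≡⟨ cong suc (∑-w i) ⟨
        suc (∑[ ℓ ← pts ] (⟦ cls i on? ℓ ⟧ * w i ℓ))
          ≤⟨ Ptₚ.∑-strict (λ ℓ → *-monoʳ-≤ ⟦ cls i on? ℓ ⟧ (m≤m⊔n (w i ℓ) (w j ℓ))) ℓ₀
               (subst (λ o → o * w i ℓ₀ < o * W ℓ₀) (sym (⟦⟧-yes (cls i on? ℓ₀) i∈ℓ₀))
                 (*-monoʳ-< 1 (<-≤-trans w<w (m≤n⊔m (w i ℓ₀) (w j ℓ₀))))) ⟩
        ∑[ ℓ ← pts ] (⟦ cls i on? ℓ ⟧ * W ℓ)           ∎
        where open ≤-Reasoning

      W-cases : ∀ {p} (P : ℕ → Set p) ℓ → P (w i ℓ) → P (w j ℓ) → P (W ℓ)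
      W-cases P ℓ pi pj with ⊔-sel (w i ℓ) (w j ℓ)
      ... | inj₁ e = subst P (sym e) pi
      ... | inj₂ e = subst P (sym e) pj

      lineclass-bound-W : ∀ ℓ → cls i on ℓ → κ ℓ + q * W ℓ ≤ u (cls i) + 3 * q
      lineclass-bound-W ℓ i∈ℓ = W-cases (λ v → κ ℓ + q * v ≤ u (cls i) + 3 * q) ℓ
        (lineclass-bound i i∈ℓ)
        (subst (λ x → κ ℓ + q * w j ℓ ≤ u x + 3 * q) (proj₁ unb)
          (lineclass-bound j (subst (_on ℓ) (sym (proj₁ unb)) i∈ℓ)))

      unbalanced-bound : k + q * u (cls i) + q ≤ 2 * (q * q) + 3 * q + u (cls i)
      unbalanced-bound = linear 0 (≤-trans
        (+-monoʳ-≤ (k + q * u (cls i)) (*-monoʳ-≤ q ∑-W))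
        (weighted-bound (cls i) (u (cls i) + 3 * q) q W lineclass-bound-W))
        (identity k q (u (cls i)))
        where
        identity : ∀ k q u → k + q * u + q + (q + 1) * (u + 3 * q) + 0 ≡
                             2 * (q * q) + 3 * q + u + (k + q * u + q * (q + u + 1))
        identity = solve-∀

    unbalanced? : ∀ i → Dec (∃ λ i′ → cls i′ ≡ cls i × ∃ λ j → ∃ λ ℓ → Unbalanced i′ j ℓ)
    unbalanced? i = Arcₚ.any? λ i′ → (cls i′ ≟ᴾ cls i) ×-dec (Arcₚ.any? λ j → Ptₚ.any? λ ℓ →
      (cls j ≟ᴾ cls i′) ×-dec ((cls i′ on? ℓ) ×-dec (w i′ ℓ <? w j ℓ)))

    Balanced : Pt → Set
    Balanced x = ∀ {i j ℓ} → cls i ≡ x → cls j ≡ x → x on ℓ → w i ℓ ≡ w j ℓ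

    balanced : ∀ {i} → ¬ (∃ λ i′ → cls i′ ≡ cls i × ∃ λ j → ∃ λ ℓ → Unbalanced i′ j ℓ) → Balanced (cls i)
    balanced ¬unb {i} {j} {ℓ} i∈x j∈x x∈ℓ = ≤-antisym
      (≮⇒≥ λ w<w → ¬unb (j , j∈x , i , ℓ , trans i∈x (sym j∈x) , subst (_on ℓ) (sym j∈x) x∈ℓ , w<w))
      (≮⇒≥ λ w<w → ¬unb (i , i∈x , j , ℓ , trans j∈x (sym i∈x) , subst (_on ℓ) (sym i∈x) x∈ℓ , w<w))

    ∑-n : ∀ x ℓ → ∑[ s ← allFin q ] n x ℓ s ≡ u x
    ∑-n x ℓ = trans (∑-swap (allFin q) is _) (∑-cong is λ j →
      trans (∑-*ˡ (allFin q) ⟦ cls j ≟ᴾ x ⟧ _) (trans (cong (⟦ cls j ≟ᴾ x ⟧ *_)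
        (trans (∑-cong (allFin q) λ s → ⟦⟧-⇔ (g j ℓ ≟ᶠ s) (s ≟ᶠ g j ℓ) sym sym) (allFin-once (g j ℓ))))
        (*-identityʳ _)))

    n-empty : ∀ {x ℓ s} → (∀ j → cls j ≡ x → g j ℓ ≢ s) → n x ℓ s ≡ 0
    n-empty {x} {ℓ} {s} empty = trans (n-count x ℓ s) (trans
      (∑-cong is λ j → ⟦⟧-no (onSeg? x ℓ s j) (λ (e , e′) → empty j e e′)) (∑-zero is))

    -- The segments in direction `ℓ` partition the class into blocks of size 0 or `w i ℓ`.
    balanced-∣ : ∀ {i ℓ} → Balanced (cls i) → cls i on ℓ → w i ℓ ∣ u (cls i)
    balanced-∣ {i} {ℓ} bal i∈ℓ = subst (w i ℓ ∣_) (∑-n (cls i) ℓ) (∑-∣ (allFin q) divides-n)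
      where
      divides-n : ∀ s → w i ℓ ∣ n (cls i) ℓ s
      divides-n s with Arcₚ.any? (onSeg? (cls i) ℓ s)
      ... | yes (j , e , refl) = ∣-reflexive (trans (bal refl e i∈ℓ) (cong (λ x → n x ℓ (g j ℓ)) e))
      ... | no ¬found          = subst (w i ℓ ∣_) (sym (n-empty λ j e e′ → ¬found (j , e , e′))) (w i ℓ ∣0)

    -- Two segments in distinct neighbour classes of ℓ lie on a common line.
    two-segments : ∀ {x y ℓ} → x on ℓ → y on ℓ → x ≢ y → ∀ s t → n x ℓ s + n y ℓ t ≤ 3
    two-segments {x} {y} {ℓ} x∈ℓ y∈ℓ x≢y s t with Trₚ.any? (λ b → (seg ℓ b x ≟ᶠ s) ×-dec (seg ℓ b y ≟ᶠ t))
    ... | no none = contradiction (begin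
        1 ≡⟨ cross x∈ℓ y∈ℓ x≢y s t ⟨
        ∑[ b ← trs ] (⟦ seg ℓ b x ≟ᶠ s ⟧ * ⟦ seg ℓ b y ≟ᶠ t ⟧)
          ≡⟨ ∑-cong trs (λ b → trans (sym (⟦×⟧ (seg ℓ b x ≟ᶠ s) (seg ℓ b y ≟ᶠ t)))
               (⟦⟧-no ((seg ℓ b x ≟ᶠ s) ×-dec (seg ℓ b y ≟ᶠ t)) (λ e → none (b , e)))) ⟩
        ∑[ b ← trs ] 0 ≡⟨ ∑-zero trs ⟩
        0 ∎) λ ()
      where open ≤-Reasoning
    ... | yes (b , refl , refl) = ≤-trans (≤-trans (≤-reflexive (sym (∑-+ is _ _))) (∑-mono is pointwise))
        (≤3 ℓ b)
      where
      pointwise : ∀ j → ⟦ cls j ≟ᴾ x ⟧ * ⟦ g j ℓ ≟ᶠ seg ℓ b x ⟧ + ⟦ cls j ≟ᴾ y ⟧ * ⟦ g j ℓ ≟ᶠ seg ℓ b y ⟧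
                        ≤ ⟦ cls j on? ℓ ⟧ * ⟦ g j ℓ ≟ᶠ seg ℓ b (cls j) ⟧
      pointwise j with cls j ≟ᴾ x | cls j ≟ᴾ y
      ... | yes refl | yes e = contradiction e x≢y
      ... | yes refl | no _ = ≤-reflexive (trans (+-identityʳ _)
          (cong (_* ⟦ g j ℓ ≟ᶠ seg ℓ b (cls j) ⟧) (sym (⟦⟧-yes (cls j on? ℓ) x∈ℓ))))
      ... | no _ | yes refl = ≤-reflexive (cong (_* ⟦ g j ℓ ≟ᶠ seg ℓ b (cls j) ⟧)
          (sym (⟦⟧-yes (cls j on? ℓ) y∈ℓ)))
      ... | no _ | no _ = z≤n

    w≤3 : ∀ i {ℓ} → cls i on ℓ → w i ℓ ≤ 3
    w≤3 i {ℓ} i∈ℓ = let (y , y∈ℓ , y≢x) = another i∈ℓ in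
      -- Any segment of `y` would do; `g i ℓ` merely supplies an element of `Fin q`.
      ≤-trans (m≤m+n _ (n y ℓ (g i ℓ))) (two-segments i∈ℓ y∈ℓ (λ e → y≢x (sym e)) (g i ℓ) (g i ℓ))

    joining : ∀ {i j} → i ≢ j → cls i ≡ cls j → ∃ λ ℓ → cls i on ℓ × g j ℓ ≡ g i ℓ
    joining {i} {j} i≢j e with Ptₚ.any? (λ ℓ → (cls i on? ℓ) ×-dec (g j ℓ ≟ᶠ g i ℓ))
    ... | yes found = found
    ... | no none = contradiction (begin
        1 ≡⟨ separated i≢j e ⟨
        ∑[ ℓ ← pts ] (⟦ cls i on? ℓ ⟧ * ⟦ g j ℓ ≟ᶠ g i ℓ ⟧)
          ≡⟨ ∑-cong pts (λ ℓ → trans (sym (⟦×⟧ (cls i on? ℓ) (g j ℓ ≟ᶠ g i ℓ)))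
               (⟦⟧-no ((cls i on? ℓ) ×-dec (g j ℓ ≟ᶠ g i ℓ)) (λ p → none (ℓ , p)))) ⟩
        ∑[ ℓ ← pts ] 0 ≡⟨ ∑-zero pts ⟩
        0 ∎) λ ()
      where open ≤-Reasoning

    another-in-class : ∀ as x → length as < u x → ∃ λ j → cls j ≡ x × All (j ≢_) as
    another-in-class as x = count-upper (finFin k) (λ j → cls j ≟ᴾ x) as

    w≥2 : ∀ {i j ℓ} → i ≢ j → cls j ≡ cls i → g j ℓ ≡ g i ℓ → 2 ≤ w i ℓ
    w≥2 {i} {j} {ℓ} i≢j e e′ = subst (2 ≤_) (sym (n-count (cls i) ℓ (g i ℓ)))
      (count-lower (finFin k) (onSeg? (cls i) ℓ (g i ℓ)) ((i≢j ∷ []) ∷ [] ∷ [])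
        ((refl , refl) ∷ (e , e′) ∷ []))

    collinear-pair : ∀ i → 2 ≤ u (cls i) → ∃ λ ℓ → cls i on ℓ × 2 ≤ w i ℓ
    collinear-pair i 2≤u with another-in-class (i ∷ []) (cls i) 2≤u
    ... | j , e , j≢i ∷ [] = let (ℓ , i∈ℓ , e′) = joining (λ i≡j → j≢i (sym i≡j)) (sym e) in
      ℓ , i∈ℓ , w≥2 (λ i≡j → j≢i (sym i≡j)) e e′

    two-or-three : ∀ {v} → 2 ≤ v → v ≤ 3 → v ≡ 2 ⊎ v ≡ 3
    two-or-three (s≤s (s≤s z≤n)) (s≤s (s≤s z≤n))       = inj₁ refl
    two-or-three (s≤s (s≤s z≤n)) (s≤s (s≤s (s≤s z≤n))) = inj₂ refl

    -- Some direction joins two points of the class and so has weight 2 or 3, but neither divides 5.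
    balanced-u≢5 : ∀ {i} → Balanced (cls i) → u (cls i) ≢ 5
    balanced-u≢5 {i} bal u≡5 = let (ℓ , i∈ℓ , 2≤w) = collinear-pair i (subst (2 ≤_) (sym u≡5) (s≤s (s≤s z≤n)))
                                   w∣5 = subst (w i ℓ ∣_) u≡5 (balanced-∣ bal i∈ℓ)
                               in absurd w∣5 (two-or-three 2≤w (w≤3 i i∈ℓ))
      where
      absurd : ∀ {v} → v ∣ 5 → ¬ (v ≡ 2 ⊎ v ≡ 3)
      absurd v∣5 (inj₁ refl) = from-no (2 ∣? 5) v∣5
      absurd v∣5 (inj₂ refl) = from-no (3 ∣? 5) v∣5

    module _ {x} (bal : Balanced x) (u≡4 : u x ≡ 4) where
      -- In the direction joining a and b the weight is 2 or 3 and divides 4, so it is 2. Hence c is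
      -- off their segment, and balance gives c a partner, for which only d is left.
      pairing : ∀ a b c d → a ≢ b → a ≢ c → a ≢ d → b ≢ c → b ≢ d → c ≢ d →
        cls a ≡ x → cls b ≡ x → cls c ≡ x → cls d ≡ x →
        ∃ λ ℓ → x on ℓ × g a ℓ ≡ g b ℓ × g c ℓ ≡ g d ℓ × g a ℓ ≢ g c ℓ
      pairing a b c d a≢b a≢c a≢d b≢c b≢d c≢d refl b∈x c∈x d∈x with joining a≢b (sym b∈x)
      ... | ℓ , a∈ℓ , gb≡ga = ℓ , a∈ℓ , sym gb≡ga , gc≡gd , ga≢gc
        where
        w≡2 : w a ℓ ≡ 2
        w≡2 with two-or-three (w≥2 a≢b b∈x gb≡ga) (w≤3 a a∈ℓ)
        ... | inj₁ e = e
        ... | inj₂ e = contradiction (subst (_∣ 4) e (subst (w a ℓ ∣_) u≡4 (balanced-∣ bal a∈ℓ)))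
            (from-no (3 ∣? 4))
        ga≢gc : g a ℓ ≢ g c ℓ
        ga≢gc ga≡gc = contradiction (subst (3 ≤_) (trans (sym (n-count x ℓ (g a ℓ))) w≡2)
          (count-lower (finFin k) (onSeg? x ℓ (g a ℓ)) ((a≢b ∷ a≢c ∷ []) ∷ (b≢c ∷ []) ∷ [] ∷ [])
            ((refl , refl) ∷ (b∈x , gb≡ga) ∷ (c∈x , sym ga≡gc) ∷ []))) λ { (s≤s (s≤s ())) }
        gc≡gd : g c ℓ ≡ g d ℓ
        gc≡gd with count-upper (finFin k) (onSeg? (cls c) ℓ (g c ℓ)) (c ∷ [])
          (≤-reflexive (sym (trans (sym (n-count (cls c) ℓ (g c ℓ))) (trans (bal c∈x refl a∈ℓ) w≡2))))
        ... | j , (j∈x , gj≡gc) , j≢c ∷ [] with j Finₚ.≟ d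
        ...   | yes refl = sym gj≡gc
        -- Here a, b, c, d and j would be five points of a class that has four.
        ...   | no j≢d = contradiction (subst (5 ≤_) u≡4
          (count-lower (finFin k) (λ j → cls j ≟ᴾ x)
            ((a≢b ∷ a≢c ∷ a≢d ∷ a≢j ∷ []) ∷ (b≢c ∷ b≢d ∷ b≢j ∷ []) ∷ (c≢d ∷ (λ e → j≢c (sym e)) ∷ []) ∷
             ((λ e → j≢d (sym e)) ∷ []) ∷ [] ∷ [])
            (refl ∷ b∈x ∷ c∈x ∷ d∈x ∷ trans j∈x c∈x ∷ []))) λ { (s≤s (s≤s (s≤s (s≤s ())))) }
          where
          a≢j : a ≢ j
          a≢j refl = ga≢gc gj≡gc
          b≢j : b ≢ j
          b≢j refl = ga≢gc (trans (sym gb≡ga) gj≡gc)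

      balanced-quadrangle : 2 ∣ q
      balanced-quadrangle
        with a , a∈x , _                    ← another-in-class [] x (subst (0 <_) (sym u≡4) (s≤s z≤n))
        with b , b∈x , b≢a ∷ []             ← another-in-class (a ∷ []) x
            (subst (1 <_) (sym u≡4) (s≤s (s≤s z≤n)))
        with c , c∈x , c≢a ∷ c≢b ∷ []       ← another-in-class (a ∷ b ∷ []) x
            (subst (2 <_) (sym u≡4) (s≤s (s≤s (s≤s z≤n))))
        with d , d∈x , d≢a ∷ d≢b ∷ d≢c ∷ [] ← another-in-class (a ∷ b ∷ c ∷ []) x
            (subst (3 <_) (sym u≡4) ≤-refl) =
        let (ℓ₂ , x∈ℓ₂ , e₂ , f₂ , n₂) = pairing a b c d (≢-sym b≢a) (≢-sym c≢a) (≢-sym d≢a) (≢-sym c≢b) (≢-sym d≢b) (≢-sym d≢c) a∈x b∈x c∈x d∈x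
            (ℓ₃ , x∈ℓ₃ , e₃ , f₃ , n₃) = pairing a c b d (≢-sym c≢a) (≢-sym b≢a) (≢-sym d≢a) c≢b (≢-sym d≢c)
                (≢-sym d≢b) a∈x c∈x b∈x d∈x
            (ℓ₄ , x∈ℓ₄ , e₄ , f₄ , n₄) = pairing a d b c (≢-sym d≢a) (≢-sym b≢a) (≢-sym c≢a) d≢b d≢c
                (≢-sym c≢b) a∈x d∈x b∈x c∈x
            onₐ : ∀ {ℓ} → x on ℓ → cls a on ℓ
            onₐ {ℓ} = subst (_on ℓ) (sym a∈x)
        in parallelogram a b c d (trans a∈x (sym b∈x)) (trans a∈x (sym c∈x)) (trans a∈x (sym d∈x))
             (onₐ x∈ℓ₂) (onₐ x∈ℓ₃) (onₐ x∈ℓ₄) e₂ f₂ n₂ e₃ f₃ n₃ e₄ f₄ n₄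

    large-even : ∀ i → 4 ≤ u (cls i) → k + q ≤ 2 * (q * q) + 4
    large-even i 4≤u with m≤n⇒∃[o]m+o≡n 4≤u | m≤n⇒∃[o]m+o≡n 1≤q
    ... | v , u≡4+v | p , refl = linear (p * v)
        (subst (λ u → k + q * u ≤ 2 * (q * q) + 3 * q + u) (sym u≡4+v) (class-bound i))
      (identity k p v)
      where
      identity : ∀ k p v → k + (1 + p) + (2 * ((1 + p) * (1 + p)) + 3 * (1 + p) + (4 + v)) + p * v ≡
                           2 * ((1 + p) * (1 + p)) + 4 + (k + (1 + p) * (4 + v))
      identity = solve-∀

    large-odd : ¬ (2 ∣ q) → 2 ≤ q → ∀ i → 4 ≤ u (cls i) → k + 2 * q ≤ 2 * (q * q) + 4
    large-odd odd 2≤q i 4≤u with unbalanced? i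
    ... | yes (i′ , e , j , ℓ , unb) with m≤n⇒∃[o]m+o≡n 4≤u | m≤n⇒∃[o]m+o≡n 1≤q
    ...   | v , u≡4+v | p , refl = linear (p * v)
      (subst (λ u → k + q * u + q ≤ 2 * (q * q) + 3 * q + u) (trans (cong u e) (sym u≡4+v))
          (unbalanced-bound unb))
      (identity k p v)
      where
      identity : ∀ k p v → k + 2 * (1 + p) + (2 * ((1 + p) * (1 + p)) + 3 * (1 + p) + (4 + v)) + p * v ≡
                           2 * ((1 + p) * (1 + p)) + 4 + (k + (1 + p) * (4 + v) + (1 + p))
      identity = solve-∀
    large-odd odd 2≤q i 4≤u | no ¬unb with m≤n⇒∃[o]m+o≡n 4≤u | m≤n⇒∃[o]m+o≡n 2≤q
    ... | 0 , u≡4 | _ = contradiction (balanced-quadrangle (balanced ¬unb) (sym u≡4)) odd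
    ... | 1 , u≡5 | _ = contradiction (sym u≡5) (balanced-u≢5 (balanced ¬unb))
    -- From u = 6 on, `class-bound` alone is enough: 2 q² + 3 q - 6 (q - 1) ≤ 2 q² - 2 q + 4 because
    -- q ≥ 2.
    ... | suc (suc v) , u≡6+v | p , refl = linear (p + (1 + p) * v)
      (subst (λ u → k + q * u ≤ 2 * (q * q) + 3 * q + u) (sym u≡6+v) (class-bound i)) (identity k p v)
      where
      identity : ∀ k p v → k + 2 * (2 + p) + (2 * ((2 + p) * (2 + p)) + 3 * (2 + p) + (6 + v)) +
          (p + (1 + p) * v) ≡
                           2 * ((2 + p) * (2 + p)) + 4 + (k + (2 + p) * (6 + v))
      identity = solve-∀

  -- The refuting counterpart of `linear`: `suc e` is the amount by which L exceeds R after the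
  -- assumed inequalities have been added up.
  linear-⊥ : ∀ {L R} e → L ≤ R → R + suc e ≡ L → ∀ {a} {A : Set a} → A
  linear-⊥ {L} {R} e L≤R eq = contradiction (<-≤-trans (m<m+n R (s≤s z≤n)) (≤-trans (≤-reflexive eq) L≤R))
      (<-irrefl refl)

  -- Neighbour classes with at most three points

  module SmallClasses {q : ℕ} (1≤q : 1 ≤ q) (G : Geometry q) {k : ℕ} (K : Arc G k) where
    open Geometry G
    open Arc K
    open Counting 1≤q G K
    open LargeClass 1≤q G K

    represented? : ∀ x → Dec (∃ λ i → cls i ≡ x)
    represented? x = Arcₚ.any? (λ i → cls i ≟ᴾ x)

    u-empty : ∀ {x} → ¬ (∃ λ i → cls i ≡ x) → u x ≡ 0
    u-empty {x} empty = trans (∑-cong is λ j → ⟦⟧-no (cls j ≟ᴾ x) (λ e → empty (j , e))) (∑-zero is)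

    u-nonempty : ∀ i → 1 ≤ u (cls i)
    u-nonempty i = count-lower (finFin k) (λ j → cls j ≟ᴾ cls i) ([] ∷ []) (refl ∷ [])

    -- All points of x give the same sum over ℓ, so any representative serves.
    excess : Pt → Pt → ℕ
    excess x ℓ with represented? x
    ... | yes (i , _) = w i ℓ ∸ 1
    ... | no _        = 0

    ∑-excess : ∀ x → ∑[ ℓ ← pts ] (⟦ x on? ℓ ⟧ * excess x ℓ) ≡ u x ∸ 1
    ∑-excess x with represented? x
    ... | no empty       = trans (∑-cong pts λ ℓ → *-zeroʳ ⟦ x on? ℓ ⟧)
                             (trans (∑-zero pts) (cong (_∸ 1) (sym (u-empty empty))))
    ... | yes (i , refl) = +-cancelʳ-≡ (q + 1) _ _ (begin
        ∑[ ℓ ← pts ] (⟦ x on? ℓ ⟧ * (w i ℓ ∸ 1)) + (q + 1)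
          ≡⟨ cong (∑[ ℓ ← pts ] (⟦ x on? ℓ ⟧ * (w i ℓ ∸ 1)) +_) (∑-on x) ⟨
        ∑[ ℓ ← pts ] (⟦ x on? ℓ ⟧ * (w i ℓ ∸ 1)) + ∑[ ℓ ← pts ] ⟦ x on? ℓ ⟧
          ≡⟨ ∑-+ pts _ _ ⟨
        ∑[ ℓ ← pts ] (⟦ x on? ℓ ⟧ * (w i ℓ ∸ 1) + ⟦ x on? ℓ ⟧)
          ≡⟨ ∑-cong pts (λ ℓ → trans (factor ⟦ x on? ℓ ⟧ (w i ℓ ∸ 1))
               (cong (⟦ x on? ℓ ⟧ *_) (m∸n+n≡m (1≤w i ℓ)))) ⟩
        ∑[ ℓ ← pts ] (⟦ x on? ℓ ⟧ * w i ℓ)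
          ≡⟨ ∑-w i ⟩
        q + u x
          ≡⟨ cong (q +_) (m∸n+n≡m (u-nonempty i)) ⟨
        q + (u x ∸ 1 + 1)
          ≡⟨ shuffle q (u x ∸ 1) ⟩
        u x ∸ 1 + (q + 1) ∎)
      where
      open ≡-Reasoning
      factor : ∀ o v → o * v + o ≡ o * (v + 1)
      factor = solve-∀
      shuffle : ∀ q v → q + (v + 1) ≡ v + (q + 1)
      shuffle = solve-∀

    excess-unique : ∀ {x y ℓ} → x on ℓ → y on ℓ → x ≢ y → 1 ≤ excess x ℓ → excess y ℓ ≡ 0
    excess-unique {x} {y} {ℓ} x∈ℓ y∈ℓ x≢y 1≤ex with represented? x | represented? y
    ... | no _ | _ = contradiction 1≤ex λ ()
    ... | yes _ | no _ = refl
    ... | yes (i , refl) | yes (j , refl) = m≤n⇒m∸n≡0 (+-cancelˡ-≤ 2 (w j ℓ) 1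
      (≤-trans (+-monoˡ-≤ (w j ℓ) (+-cancelʳ-≤ 0 2 (w i ℓ) (2≤ (w i ℓ) 1≤ex)))
               (two-segments x∈ℓ y∈ℓ x≢y (g i ℓ) (g j ℓ))))
      where
      2≤ : ∀ v → 1 ≤ v ∸ 1 → 2 + 0 ≤ v + 0
      2≤ (suc v) 1≤v = s≤s (≤-trans 1≤v (≤-reflexive (sym (+-identityʳ v))))

    B : Pt → ℕ
    B ℓ = ∑[ x ← pts ] (⟦ x on? ℓ ⟧ * excess x ℓ)

    owner : ∀ ℓ → (B ℓ ≡ 0) ⊎ (∃ λ i → cls i on ℓ × B ℓ + 1 ≡ w i ℓ)
    owner ℓ with Ptₚ.any? (λ x → (x on? ℓ) ×-dec (1 ≤? excess x ℓ))
    ... | no none = inj₁ (trans (∑-cong pts λ x → trans (⟦⟧*-cong (x on? ℓ) (zero-excess x))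
        (*-zeroʳ ⟦ x on? ℓ ⟧)) (∑-zero pts))
      where
      zero-excess : ∀ x → x on ℓ → excess x ℓ ≡ 0
      zero-excess x x∈ℓ = n<1⇒n≡0 (≰⇒> λ 1≤ → none (x , x∈ℓ , 1≤))
    ... | yes (x , x∈ℓ , 1≤ex) = inj₂ (representative B≡)
      where
      pointwise : ∀ y → ⟦ y on? ℓ ⟧ * excess y ℓ ≡ ⟦ y ≟ᴾ x ⟧ * excess y ℓ
      pointwise y with y ≟ᴾ x
      ... | yes refl = cong (_* excess x ℓ) (⟦⟧-yes (x on? ℓ) x∈ℓ)
      ... | no y≢x   = trans (⟦⟧*-cong (y on? ℓ) (λ y∈ℓ → excess-unique x∈ℓ y∈ℓ (λ e → y≢x (sym e)) 1≤ex))
                             (*-zeroʳ ⟦ y on? ℓ ⟧)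
      B≡ : B ℓ ≡ excess x ℓ
      B≡ = trans (∑-cong pts pointwise) (Ptₚ.∑-δ x (λ y → excess y ℓ))
      representative : B ℓ ≡ excess x ℓ → ∃ λ i → cls i on ℓ × B ℓ + 1 ≡ w i ℓ
      representative e with represented? x
      ... | no _           = contradiction 1≤ex λ ()
      ... | yes (i , refl) = i , x∈ℓ , trans (cong (_+ 1) e) (m∸n+n≡m (1≤w i ℓ))

    -- The excess passing through `x`. It adds up to q + 1 times the total excess, yet is small at
    -- each class, since every unit of `B ℓ` lowers the bound on `κ ℓ` by q.
    j : Pt → ℕ
    j x = ∑[ ℓ ← pts ] (⟦ x on? ℓ ⟧ * B ℓ)

    ∑-u : ∑[ x ← pts ] u x ≡ k
    ∑-u = trans (∑-swap pts is _) (trans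
      (∑-cong is λ i → trans (∑-cong pts λ x → ⟦⟧-⇔ (cls i ≟ᴾ x) (x ≟ᴾ cls i) sym sym) (Ptₚ.once (cls i)))
      (trans (∑-const is 1) (trans (*-identityʳ _) (length-tabulate {n = k} id))))

    ∑-B : ∑[ ℓ ← pts ] B ℓ ≡ ∑[ x ← pts ] (u x ∸ 1)
    ∑-B = trans (∑-swap pts pts _) (∑-cong pts ∑-excess)

    ∑-on-weighted : ∀ (f : Pt → ℕ) → ∑[ x ← pts ] (f x * j x) ≡
                    ∑[ ℓ ← pts ] (B ℓ * ∑[ x ← pts ] (⟦ x on? ℓ ⟧ * f x))
    ∑-on-weighted f = begin
      ∑[ x ← pts ] (f x * j x)
        ≡⟨ ∑-cong pts (λ x → sym (∑-*ˡ pts (f x) _)) ⟩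
      ∑[ x ← pts ] ∑[ ℓ ← pts ] (f x * (⟦ x on? ℓ ⟧ * B ℓ))
        ≡⟨ ∑-swap pts pts _ ⟩
      ∑[ ℓ ← pts ] ∑[ x ← pts ] (f x * (⟦ x on? ℓ ⟧ * B ℓ))
        ≡⟨ ∑-cong pts (λ ℓ → trans (∑-cong pts λ x → shuffle (f x) ⟦ x on? ℓ ⟧ (B ℓ)) (∑-*ˡ pts (B ℓ) _)) ⟩
      ∑[ ℓ ← pts ] (B ℓ * ∑[ x ← pts ] (⟦ x on? ℓ ⟧ * f x)) ∎
      where
      open ≡-Reasoning
      shuffle : ∀ a o b → a * (o * b) ≡ b * (o * a)
      shuffle = solve-∀

    ∑-j : ∑[ x ← pts ] j x ≡ (q + 1) * ∑[ x ← pts ] (u x ∸ 1)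
    ∑-j = begin
      ∑[ x ← pts ] j x         ≡⟨ ∑-cong pts (λ x → sym (*-identityˡ (j x))) ⟩
      ∑[ x ← pts ] (1 * j x)   ≡⟨ ∑-on-weighted (λ _ → 1) ⟩
      ∑[ ℓ ← pts ] (B ℓ * ∑[ x ← pts ] (⟦ x on? ℓ ⟧ * 1))
        ≡⟨ ∑-cong pts (λ ℓ → trans (cong (B ℓ *_)
            (trans (∑-cong pts λ x → *-identityʳ ⟦ x on? ℓ ⟧) (meet ℓ))) (*-comm (B ℓ) (q + 1))) ⟩
      ∑[ ℓ ← pts ] ((q + 1) * B ℓ) ≡⟨ ∑-*ˡ pts (q + 1) B ⟩
      (q + 1) * ∑[ ℓ ← pts ] B ℓ   ≡⟨ cong ((q + 1) *_) ∑-B ⟩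
      (q + 1) * ∑[ x ← pts ] (u x ∸ 1) ∎
      where open ≡-Reasoning

    κ-bound : ∀ i {ℓ} → cls i on ℓ → κ ℓ ≤ 2 * q + u (cls i)
    κ-bound i {ℓ} i∈ℓ = linear 0
      (≤-trans (+-monoʳ-≤ (κ ℓ) (≤-trans (≤-reflexive (sym (*-identityʳ q))) (*-monoʳ-≤ q (1≤w i ℓ))))
          (lineclass-bound i i∈ℓ))
      (identity (κ ℓ) q (u (cls i)))
      where
      identity : ∀ c q u → c + (u + 3 * q) + 0 ≡ 2 * q + u + (c + q)
      identity = solve-∀

    module _ {c} (small : ∀ x → u x ≤ c) where

      -- An owner has weight B + 1 on `ℓ`, which is inserted into `lineclass-bound`. Without an
      -- owner any arc point on `ℓ` gives the bound, and without arc points κ is 0.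
      κ-bound-B : ∀ ℓ → κ ℓ + q * B ℓ ≤ 2 * q + c
      κ-bound-B ℓ with owner ℓ
      ... | inj₂ (i , i∈ℓ , e) = linear 0
        (≤-trans (subst (λ v → κ ℓ + q * v ≤ u (cls i) + 3 * q) (sym e) (lineclass-bound i i∈ℓ))
            (+-monoˡ-≤ (3 * q) (small (cls i))))
        (identity (κ ℓ) q (B ℓ) c)
        where
        identity : ∀ k q b c → k + q * b + (c + 3 * q) + 0 ≡ 2 * q + c + (k + q * (b + 1))
        identity = solve-∀
      ... | inj₁ B≡0 with Arcₚ.any? (λ i → cls i on? ℓ)
      ...   | yes (i , i∈ℓ) = ≤-trans (≤-reflexive
          (trans (cong (λ b → κ ℓ + q * b) B≡0) (trans (cong (κ ℓ +_) (*-zeroʳ q)) (+-identityʳ _))))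
                (≤-trans (κ-bound i i∈ℓ) (+-monoʳ-≤ (2 * q) (small (cls i))))
      ...   | no none = ≤-trans (≤-reflexive (cong₂ _+_
                (trans (∑-cong is λ i → ⟦⟧-no (cls i on? ℓ) λ i∈ℓ → none (i , i∈ℓ)) (∑-zero is))
                (trans (cong (q *_) B≡0) (*-zeroʳ q)))) z≤n

      -- Replaces the uniform `c` by the actual u = c - d, at the cost of lowering the rate from q
      -- to q - d: when B ≥ 1 the surplus d is at most d B, and when B = 0 `κ-bound` has no surplus.
      κ-bound-u : ∀ i {ℓ d e} → cls i on ℓ → u (cls i) + d ≡ c → d + e ≡ q → κ ℓ + e * B ℓ ≤ 2 * q + u (cls i)
      κ-bound-u i {ℓ} {d} {e} i∈ℓ refl d+e≡q with B ℓ | κ-bound-B ℓ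
      ... | zero  | _ = ≤-trans (≤-reflexive (trans (cong (κ ℓ +_) (*-zeroʳ e)) (+-identityʳ _)))
          (κ-bound i i∈ℓ)
      ... | suc b | bound = linear (d * b)
        (subst (λ r → κ ℓ + r * suc b ≤ 2 * q + (u (cls i) + d)) (sym d+e≡q) bound)
        (identity (κ ℓ) d e b q (u (cls i)))
        where
        identity : ∀ c d e b q u → c + e * (1 + b) + (2 * q + (u + d)) + d * b ≡ 2 * q + u +
            (c + (d + e) * (1 + b))
        identity = solve-∀

      j-bound : ∀ x → k + q * u x + q * j x ≤ (q + 1) * (2 * q + c)
      j-bound x = weighted-bound x (2 * q + c) q B (λ ℓ _ → κ-bound-B ℓ)

      j-bound-u : ∀ i {d e} → u (cls i) + d ≡ c → d + e ≡ q →
                  k + q * u (cls i) + e * j (cls i) ≤ (q + 1) * (2 * q + u (cls i))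
      j-bound-u i {d} {e} u+d≡c d+e≡q =
        weighted-bound (cls i) (2 * q + u (cls i)) e B (λ ℓ i∈ℓ → κ-bound-u i i∈ℓ u+d≡c d+e≡q)

    module _ (small : ∀ x → u x ≤ 3) (3≤q : 3 ≤ q) (big : 2 * (q * q) + 12 ≤ k + 3 * q) where

      -- The rate is e = q - 3 + u, and j ≥ 5 would give 4 u ≤ 3. The 12 in `big` is the smallest
      -- constant for which this still excludes u = 1.
      j≤4 : ∀ i → j (cls i) ≤ 4
      j≤4 i with m≤n⇒∃[o]m+o≡n 3≤q | m≤n⇒∃[o]m+o≡n (small (cls i)) | m≤n⇒∃[o]m+o≡n (u-nonempty i)
      ... | p , refl | d , u+d≡3 | v , 1+v≡u = ≮⇒≥ λ 5≤j →
        linear-⊥ (4 * v) (+-mono-≤ (≤-trans (+-monoʳ-≤ (k + q * u (cls i)) (*-monoʳ-≤ (u (cls i) + p) 5≤j))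
                     (j-bound-u small i {d} {u (cls i) + p} u+d≡3
                       (trans (sym (+-assoc d _ p)) (cong (_+ p) (trans (+-comm d _) u+d≡3))))) big)
          (subst (λ u → (q + 1) * (2 * q + u) + (k + 3 * q) + suc (4 * v) ≡ k + q * u + (u + p) * 5 +
              (2 * (q * q) + 12))
            1+v≡u (identity k p v))
        where
        identity : ∀ k p v → (3 + p + 1) * (2 * (3 + p) + (1 + v)) + (k + 3 * (3 + p)) + (1 + 4 * v) ≡
                   k + (3 + p) * (1 + v) + (1 + v + p) * 5 + (2 * ((3 + p) * (3 + p)) + 12)
        identity = solve-∀

      -- The value is 4 + (q + 1), the most that `pointwise-j` allows at an empty class: there
      -- `u ∸ 1` is 0 rather than -1, which leaves q + 1 more than at the other classes.
      j≤q+5 : ∀ x → j x ≤ q + 5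
      j≤q+5 x with m≤n⇒∃[o]m+o≡n 3≤q
      ... | p , refl = ≮⇒≥ λ q+6≤j →
        linear-⊥ (11 + 4 * p + p * p) (+-mono-≤
            (≤-trans (+-mono-≤ (m≤m+n k (q * u x)) (*-monoʳ-≤ q q+6≤j)) (j-bound small x)) big)
          (identity k p)
        where
        identity : ∀ k p → (3 + p + 1) * (2 * (3 + p) + 3) + (k + 3 * (3 + p)) + (1 + (11 + 4 * p + p * p)) ≡
                   k + (3 + p) * (1 + (3 + p + 5)) + (2 * ((3 + p) * (3 + p)) + 12)
        identity = solve-∀

      pointwise-j : ∀ x → j x + (q + 1) * u x ≤ q + 5 + (q + 1) * (u x ∸ 1)
      pointwise-j x with represented? x
      ... | no empty rewrite u-empty empty = +-monoˡ-≤ ((q + 1) * 0) (j≤q+5 x)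
      ... | yes (i , refl) with u (cls i) | u-nonempty i
      ...   | suc v | _ = linear 0 (j≤4 i) (identity (j (cls i)) q v)
        where
        identity : ∀ j q v → j + (q + 1) * (1 + v) + 4 + 0 ≡ q + 5 + (q + 1) * v + j
        identity = solve-∀

      -- The total S of `u x ∸ 1` arises on the left from `∑-j` and on the right from `pointwise-j`,
      -- with the same factor q + 1, and cancels.
      count : (q + 1) * k ≤ (q + 5) * (q * q + q + 1)
      count = +-cancelˡ-≤ ((q + 1) * S) _ _ (begin
        (q + 1) * S + (q + 1) * k
          ≡⟨ cong₂ _+_ (sym ∑-j) (trans (cong ((q + 1) *_) (sym ∑-u)) (sym (∑-*ˡ pts (q + 1) u))) ⟩
        ∑[ x ← pts ] j x + ∑[ x ← pts ] ((q + 1) * u x)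
          ≡⟨ ∑-+ pts _ _ ⟨
        ∑[ x ← pts ] (j x + (q + 1) * u x)
          ≤⟨ ∑-mono pts pointwise-j ⟩
        ∑[ x ← pts ] (q + 5 + (q + 1) * (u x ∸ 1))
          ≡⟨ ∑-+ pts _ _ ⟩
        ∑[ x ← pts ] (q + 5) + ∑[ x ← pts ] ((q + 1) * (u x ∸ 1))
          ≡⟨ cong₂ _+_ (trans (∑-const pts (q + 5)) (trans (*-comm _ (q + 5)) (cong ((q + 5) *_) card)))
              (∑-*ˡ pts (q + 1) _) ⟩
        (q + 5) * (q * q + q + 1) + (q + 1) * S
          ≡⟨ +-comm _ ((q + 1) * S) ⟩
        (q + 1) * S + (q + 5) * (q * q + q + 1) ∎)
        where
        open ≤-Reasoning
        S : ℕ
        S = ∑[ x ← pts ] (u x ∸ 1)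

    small-odd : (∀ x → u x ≤ 3) → 7 ≤ q → k + 2 * q ≤ 2 * (q * q) + 4
    small-odd small 7≤q with m≤n⇒∃[o]m+o≡n 7≤q
    ... | p , refl = ≮⇒≥ λ lt →
      linear-⊥ (27 + 60 * p + 15 * (p * p) + p * (p * p))
        (+-mono-≤ (*-monoʳ-≤ (q + 1) lt)
          (count small (s≤s (s≤s (s≤s z≤n))) (linear p lt (identity₁ k p))))
        (identity₂ k p)
      where
      identity₁ : ∀ k p → 2 * ((7 + p) * (7 + p)) + 12 + (k + 2 * (7 + p)) + p ≡
                          k + 3 * (7 + p) + (1 + (2 * ((7 + p) * (7 + p)) + 4))
      identity₁ = solve-∀
      identity₂ : ∀ k p → (7 + p + 1) * (k + 2 * (7 + p)) + (7 + p + 5) * ((7 + p) * (7 + p) + (7 + p) + 1) +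
                          (1 + (27 + 60 * p + 15 * (p * p) + p * (p * p))) ≡
                          (7 + p + 1) * (1 + (2 * ((7 + p) * (7 + p)) + 4)) + (7 + p + 1) * k
      identity₂ = solve-∀

    small-even : (∀ x → u x ≤ 3) → 6 ≤ q → k + q ≤ 2 * (q * q) + 4
    small-even small 6≤q with m≤n⇒∃[o]m+o≡n 6≤q
    ... | p , refl = ≮⇒≥ λ lt →
      linear-⊥ (23 + 46 * p + 13 * (p * p) + p * (p * p))
        (+-mono-≤ (*-monoʳ-≤ (q + 1) lt)
          (count small (s≤s (s≤s (s≤s z≤n))) (linear (5 + 2 * p) lt (identity₁ k p))))
        (identity₂ k p)
      where
      identity₁ : ∀ k p → 2 * ((6 + p) * (6 + p)) + 12 + (k + (6 + p)) + (5 + 2 * p) ≡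
                          k + 3 * (6 + p) + (1 + (2 * ((6 + p) * (6 + p)) + 4))
      identity₁ = solve-∀
      identity₂ : ∀ k p → (6 + p + 1) * (k + (6 + p)) + (6 + p + 5) * ((6 + p) * (6 + p) + (6 + p) + 1) +
                          (1 + (23 + 46 * p + 13 * (p * p) + p * (p * p))) ≡
                          (6 + p + 1) * (1 + (2 * ((6 + p) * (6 + p)) + 4)) + (6 + p + 1) * k
      identity₂ = solve-∀

  -- Order five

  module OrderFive (G : Geometry 5) {k : ℕ} (K : Arc G k) where
    open Geometry G
    open Arc K

    private
      1≤5 : 1 ≤ 5
      1≤5 = s≤s z≤n

    open Counting 1≤5 G K
    open LargeClass 1≤5 G K
    open SmallClasses 1≤5 G K

    ∑-cls : ∀ (f : Pt → ℕ) → ∑[ i ← is ] f (cls i) ≡ ∑[ x ← pts ] (u x * f x)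
    ∑-cls f = sym (begin
      ∑[ x ← pts ] (u x * f x)
        ≡⟨ ∑-cong pts (λ x → sym (∑-*ʳ is (f x) _)) ⟩
      ∑[ x ← pts ] ∑[ i ← is ] (⟦ cls i ≟ᴾ x ⟧ * f x)
        ≡⟨ ∑-swap pts is _ ⟩
      ∑[ i ← is ] ∑[ x ← pts ] (⟦ cls i ≟ᴾ x ⟧ * f x)
        ≡⟨ ∑-cong is (λ i → trans (∑-cong pts λ x → cong (_* f x) (⟦⟧-⇔ (cls i ≟ᴾ x) (x ≟ᴾ cls i) sym sym))
            (Ptₚ.∑-δ (cls i) f)) ⟩
      ∑[ i ← is ] f (cls i) ∎)
      where open ≡-Reasoning

    κ-∑ : ∀ ℓ → κ ℓ ≡ ∑[ x ← pts ] (⟦ x on? ℓ ⟧ * u x)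
    κ-∑ ℓ = trans (∑-cls (λ x → ⟦ x on? ℓ ⟧)) (∑-cong pts λ x → *-comm (u x) _)

    module _ (small : ∀ x → u x ≤ 2) (45≤k : 45 ≤ k) where
      deficit : Pt → ℕ
      deficit x = 2 ∸ u x

      ∑-deficit : ∀ ℓ → κ ℓ + ∑[ x ← pts ] (⟦ x on? ℓ ⟧ * deficit x) ≡ 12
      ∑-deficit ℓ = begin
        κ ℓ + ∑[ x ← pts ] (⟦ x on? ℓ ⟧ * deficit x)
          ≡⟨ cong (_+ ∑[ x ← pts ] (⟦ x on? ℓ ⟧ * deficit x)) (κ-∑ ℓ) ⟩
        ∑[ x ← pts ] (⟦ x on? ℓ ⟧ * u x) + ∑[ x ← pts ] (⟦ x on? ℓ ⟧ * deficit x)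
          ≡⟨ ∑-+ pts _ _ ⟨
        ∑[ x ← pts ] (⟦ x on? ℓ ⟧ * u x + ⟦ x on? ℓ ⟧ * deficit x)
          ≡⟨ ∑-cong pts (λ x → trans (sym (*-distribˡ-+ ⟦ x on? ℓ ⟧ (u x) (deficit x)))
               (cong (⟦ x on? ℓ ⟧ *_) (m+[n∸m]≡n (small x)))) ⟩
        ∑[ x ← pts ] (⟦ x on? ℓ ⟧ * 2)
          ≡⟨ ∑-*ʳ pts 2 _ ⟩
        (∑[ x ← pts ] ⟦ x on? ℓ ⟧) * 2
          ≡⟨ cong (_* 2) (meet ℓ) ⟩
        12 ∎
        where open ≡-Reasoning

      -- A line class with B ≥ 1 has κ ≤ 7, so its classes lack at least 5 of 12 points. Weighting
      -- this by `B ℓ` and exchanging the sums moves the excess onto the classes with deficit.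
      deficit-bound : 5 * ∑[ x ← pts ] (u x ∸ 1) ≤ ∑[ x ← pts ] (deficit x * j x)
      deficit-bound = begin
        5 * ∑[ x ← pts ] (u x ∸ 1)   ≡⟨ cong (5 *_) ∑-B ⟨
        5 * ∑[ ℓ ← pts ] B ℓ         ≡⟨ ∑-*ˡ pts 5 B ⟨
        ∑[ ℓ ← pts ] (5 * B ℓ)       ≤⟨ ∑-mono pts (λ ℓ → pointwise ℓ (B ℓ) (κ-bound-B small ℓ)) ⟩
        ∑[ ℓ ← pts ] (B ℓ * ∑[ x ← pts ] (⟦ x on? ℓ ⟧ * deficit x)) ≡⟨ ∑-on-weighted deficit ⟨
        ∑[ x ← pts ] (deficit x * j x) ∎
        where
        open ≤-Reasoning
        pointwise : ∀ ℓ b → κ ℓ + 5 * b ≤ 12 → 5 * b ≤ b * ∑[ x ← pts ] (⟦ x on? ℓ ⟧ * deficit x)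
        pointwise ℓ zero    _     = z≤n
        pointwise ℓ (suc b) bound = ≤-trans (≤-reflexive (*-comm 5 (suc b))) (*-monoʳ-≤ (suc b)
          (+-cancelˡ-≤ (κ ℓ) 5 _ (≤-trans (+-monoʳ-≤ (κ ℓ) (*-monoʳ-≤ 5 (s≤s (z≤n {b}))))
            (≤-trans bound (≤-reflexive (sym (∑-deficit ℓ)))))))

      -- The coefficients 9 and 13 are those for which equality holds both at u = 2 and at u = 1
      -- with j = 4, the largest j possible there when k ≥ 45; at u = 0 they leave room for j ≤ 6.
      pointwise-deficit : ∀ x → deficit x * j x + 9 * u x ≤ 13 + 5 * (u x ∸ 1)
      pointwise-deficit x with represented? x
      ... | no empty = goal (u-empty empty) (≮⇒≥ λ 7≤j → linear-⊥ 7
               (+-mono-≤ 45≤k (≤-trans (+-mono-≤ (m≤m+n k (5 * u x)) (*-monoʳ-≤ 5 7≤j)) (j-bound small x)))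
               (identity k))
        where
        goal : u x ≡ 0 → j x ≤ 6 → deficit x * j x + 9 * u x ≤ 13 + 5 * (u x ∸ 1)
        goal e j≤6 rewrite e = linear 1 (*-monoʳ-≤ 2 j≤6) (identity₂ (j x))
          where
          identity₂ : ∀ j → 2 * j + 9 * 0 + 12 + 1 ≡ 13 + 5 * 0 + 2 * j
          identity₂ = solve-∀
        identity : ∀ k → k + 72 + 8 ≡ 45 + (k + 5 * 7)
        identity = solve-∀
      ... | yes (i , refl) = cases (u x) refl (small x) (u-nonempty i)
        where
        cases : ∀ v → u (cls i) ≡ v → v ≤ 2 → 1 ≤ v → (2 ∸ u (cls i)) * j (cls i) + 9 * u (cls i) ≤ 13 + 5 *
            (u (cls i) ∸ 1)
        cases 1 e _ _ = subst (λ v → (2 ∸ v) * j (cls i) + 9 * v ≤ 13 + 5 * (v ∸ 1)) (sym e)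
          (linear 0 j≤four (identity₂ (j (cls i))))
          where
          identity : ∀ k → k + 66 + 4 ≡ 45 + (k + 5 * 1 + 4 * 5)
          identity = solve-∀
          identity₂ : ∀ j → 1 * j + 9 + 4 + 0 ≡ 13 + j
          identity₂ = solve-∀
          bound : k + 5 * 1 + 4 * j (cls i) ≤ 66
          bound = subst (λ v → k + 5 * v + 4 * j (cls i) ≤ 6 * (10 + v)) e
            (j-bound-u small i {1} {4} (cong (_+ 1) e) refl)
          j≤four : j (cls i) ≤ 4
          j≤four = ≮⇒≥ λ 5≤j → linear-⊥ 3 (+-mono-≤ 45≤k
              (≤-trans (+-monoʳ-≤ (k + 5 * 1) (*-monoʳ-≤ 4 5≤j)) bound)) (identity k)
        cases 2 e _ _ rewrite e = ≤-refl
        cases (suc (suc (suc _))) _ (s≤s (s≤s ())) _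

      tiny-⊥ : 9 * k ≤ 403
      tiny-⊥ = +-cancelˡ-≤ (5 * S) _ _ (begin
        5 * S + 9 * k
          ≤⟨ +-mono-≤ deficit-bound (≤-reflexive (trans (cong (9 *_) (sym ∑-u)) (sym (∑-*ˡ pts 9 u)))) ⟩
        ∑[ x ← pts ] (deficit x * j x) + ∑[ x ← pts ] (9 * u x)
          ≡⟨ ∑-+ pts _ _ ⟨
        ∑[ x ← pts ] (deficit x * j x + 9 * u x)
          ≤⟨ ∑-mono pts pointwise-deficit ⟩
        ∑[ x ← pts ] (13 + 5 * (u x ∸ 1))
          ≡⟨ ∑-+ pts _ _ ⟩
        ∑[ x ← pts ] 13 + ∑[ x ← pts ] (5 * (u x ∸ 1))
          ≡⟨ cong₂ _+_ (trans (∑-const pts 13) (cong (_* 13) card)) (∑-*ˡ pts 5 _) ⟩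
        403 + 5 * S
          ≡⟨ +-comm 403 (5 * S) ⟩
        5 * S + 403 ∎)
        where
        open ≤-Reasoning
        S : ℕ
        S = ∑[ x ← pts ] (u x ∸ 1)

    tiny : (∀ x → u x ≤ 2) → k ≤ 44
    tiny small = ≮⇒≥ λ 45≤k → contradiction (≤-trans (*-monoʳ-≤ 9 45≤k) (tiny-⊥ small 45≤k))
        (<⇒≱ (toWitness {a? = 403 <? 405} _))

    -- Order five: a line class with κ ≥ 12 and no two arc points on a segment

    module Good (small : ∀ x → u x ≤ 3) {ℓ} (good : ∀ i → cls i on ℓ → w i ℓ ≡ 1) (12≤κ : 12 ≤ κ ℓ) where

      u≥2 : ∀ i → cls i on ℓ → 2 ≤ u (cls i)
      u≥2 i i∈ℓ = +-cancelʳ-≤ 15 2 _ (≤-trans (+-monoˡ-≤ 5 12≤κ)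
        (subst (λ v → κ ℓ + 5 * v ≤ u (cls i) + 15) (good i i∈ℓ) (lineclass-bound i i∈ℓ)))

      u-values : ∀ x → x on ℓ → u x ≡ 0 ⊎ u x ≡ 2 ⊎ u x ≡ 3
      u-values x x∈ℓ with represented? x
      ... | no empty       = inj₁ (u-empty empty)
      ... | yes (i , refl) = inj₂ (two-or-three (u≥2 i x∈ℓ) (small x))

      -- With 13 points `lineclass-bound` forces u = 3 at every nonempty class on `ℓ`, so κ would be
      -- a multiple of 3.
      κ≢13 : κ ℓ ≢ 13
      κ≢13 κ≡13 = from-no (3 ∣? 13) (subst (3 ∣_) (trans (sym (κ-∑ ℓ)) κ≡13) (∑-∣ pts divides-u))
        where
        divides-u : ∀ x → 3 ∣ ⟦ x on? ℓ ⟧ * u x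
        divides-u x with x on? ℓ
        ... | no _ = 3 ∣0
        ... | yes x∈ℓ with represented? x
        ...   | no empty = ∣n⇒∣m*n 1 (subst (3 ∣_) (sym (u-empty empty)) (3 ∣0))
        ...   | yes (i , refl) = ∣n⇒∣m*n 1 (∣-reflexive (≤-antisym
                  (+-cancelʳ-≤ 15 3 _ (≤-trans (≤-reflexive (cong (_+ 5) (sym κ≡13)))
                    (subst (λ v → κ ℓ + 5 * v ≤ u (cls i) + 15) (good i x∈ℓ) (lineclass-bound i x∈ℓ))))
                  (small x)))

      κ≡12 : κ ℓ ≡ 12
      κ≡12 = ≤-antisym (≤-pred (≤∧≢⇒< (≤-trans (m≤m+n (κ ℓ) (5 * B ℓ)) (κ-bound-B small ℓ)) κ≢13)) 12≤κ

      pencil₁₂ : ∀ {x} → x on ℓ → ∀ s → ∑[ b ← trs ] (⟦ seg ℓ b x ≟ᶠ s ⟧ * m ℓ b) + u x ≡ 12 + 5 * n x ℓ s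
      pencil₁₂ {x} x∈ℓ s = trans (pencil x∈ℓ s) (cong (_+ 5 * n x ℓ s) κ≡12)

      defects : ∀ {x} → x on ℓ → ∀ s →
        ∑[ b ← trs ] (⟦ seg ℓ b x ≟ᶠ s ⟧ * (3 ∸ m ℓ b)) + (12 + 5 * n x ℓ s) ≡ 15 + u x
      defects {x} x∈ℓ s = begin
        D + (12 + 5 * n x ℓ s)      ≡⟨ cong (D +_) (pencil₁₂ x∈ℓ s) ⟨
        D + (M + u x)               ≡⟨ +-assoc D M (u x) ⟨
        D + M + u x                 ≡⟨ cong (_+ u x) (∑-+ trs _ _) ⟨
        ∑[ b ← trs ] (⟦ seg ℓ b x ≟ᶠ s ⟧ * (3 ∸ m ℓ b) + ⟦ seg ℓ b x ≟ᶠ s ⟧ * m ℓ b) + u x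
          ≡⟨ cong (_+ u x) (∑-cong trs λ b → trans (sym (*-distribˡ-+ ⟦ seg ℓ b x ≟ᶠ s ⟧ (3 ∸ m ℓ b) (m ℓ b)))
               (cong (⟦ seg ℓ b x ≟ᶠ s ⟧ *_) (m∸n+n≡m (≤3 ℓ b)))) ⟩
        ∑[ b ← trs ] (⟦ seg ℓ b x ≟ᶠ s ⟧ * 3) + u x
          ≡⟨ cong (_+ u x) (trans (∑-*ʳ trs 3 _) (cong (_* 3) (through x∈ℓ s))) ⟩
        15 + u x                    ∎
        where
        open ≡-Reasoning
        D M : ℕ
        D = ∑[ b ← trs ] (⟦ seg ℓ b x ≟ᶠ s ⟧ * (3 ∸ m ℓ b))
        M = ∑[ b ← trs ] (⟦ seg ℓ b x ≟ᶠ s ⟧ * m ℓ b)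

      -- The five lines through the segment of an arc point together fall short of 15 points by u -
      -- 2, hence by at most one.
      defects-at : ∀ i → cls i on ℓ →
        ∑[ b ← trs ] (⟦ seg ℓ b (cls i) ≟ᶠ g i ℓ ⟧ * (3 ∸ m ℓ b)) ≡ u (cls i) ∸ 2
      defects-at i i∈ℓ = +-cancelʳ-≡ 17 D (u (cls i) ∸ 2) (begin
        D + 17                       ≡⟨ cong (λ v → D + (12 + 5 * v)) (good i i∈ℓ) ⟨
        D + (12 + 5 * w i ℓ)         ≡⟨ defects i∈ℓ (g i ℓ) ⟩
        15 + u (cls i)               ≡⟨ cong (15 +_) (m∸n+n≡m (u≥2 i i∈ℓ)) ⟨
        15 + (u (cls i) ∸ 2 + 2)     ≡⟨ shuffle (u (cls i) ∸ 2) ⟩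
        u (cls i) ∸ 2 + 17           ∎)
        where
        open ≡-Reasoning
        D : ℕ
        D = ∑[ b ← trs ] (⟦ seg ℓ b (cls i) ≟ᶠ g i ℓ ⟧ * (3 ∸ m ℓ b))
        shuffle : ∀ v → 15 + (v + 2) ≡ v + 17
        shuffle = solve-∀

      lies? : ∀ b i → Dec (cls i on ℓ × g i ℓ ≡ seg ℓ b (cls i))
      lies? b i = (cls i on? ℓ) ×-dec (g i ℓ ≟ᶠ seg ℓ b (cls i))

      m-count : ∀ b → m ℓ b ≡ ∑[ i ← is ] ⟦ lies? b i ⟧
      m-count b = ∑-cong is λ i → sym (⟦×⟧ (cls i on? ℓ) (g i ℓ ≟ᶠ seg ℓ b (cls i)))

      -- A line with a single arc point would by itself contribute 2 to the defect at that point.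
      m≢1 : ∀ b → m ℓ b ≢ 1
      m≢1 b m≡1 with count-upper (finFin k) (lies? b) []
          (subst (0 <_) (m-count b) (subst (0 <_) (sym m≡1) (s≤s z≤n)))
      ... | i , (i∈ℓ , e) , _ = contradiction (begin
        2                      ≡⟨ cong (3 ∸_) m≡1 ⟨
        3 ∸ m ℓ b              ≡⟨ trans (cong (_* (3 ∸ m ℓ b)) (⟦⟧-yes (seg ℓ b (cls i) ≟ᶠ g i ℓ) (sym e)))
            (*-identityˡ _) ⟨
        ⟦ seg ℓ b (cls i) ≟ᶠ g i ℓ ⟧ * (3 ∸ m ℓ b) ≤⟨ Trₚ.term≤∑ b
            (λ b → ⟦ seg ℓ b (cls i) ≟ᶠ g i ℓ ⟧ * (3 ∸ m ℓ b)) ⟩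
        ∑[ b ← trs ] (⟦ seg ℓ b (cls i) ≟ᶠ g i ℓ ⟧ * (3 ∸ m ℓ b)) ≡⟨ defects-at i i∈ℓ ⟩
        u (cls i) ∸ 2          ≤⟨ ∸-monoˡ-≤ 2 (small (cls i)) ⟩
        1                      ∎) λ { (s≤s ()) }
        where open ≤-Reasoning

      τ : Tr → ℕ
      τ b = ⟦ m ℓ b ℕₚ.≟ 2 ⟧

      σ : Tr → ℕ
      σ b = ⟦ m ℓ b ℕₚ.≟ 3 ⟧

      m≡τσ : ∀ b → m ℓ b ≡ 2 * τ b + 3 * σ b
      m≡τσ b = cases (m ℓ b) (≤3 ℓ b) (m≢1 b)
        where
        cases : ∀ v → v ≤ 3 → v ≢ 1 → v ≡ 2 * ⟦ v ℕₚ.≟ 2 ⟧ + 3 * ⟦ v ℕₚ.≟ 3 ⟧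
        cases 0 _ _ = refl
        cases 1 _ v≢1 = contradiction refl v≢1
        cases 2 _ _ = refl
        cases 3 _ _ = refl
        cases (suc (suc (suc (suc _)))) (s≤s (s≤s (s≤s ()))) _

      -- Every line through an arc point of `ℓ` now has two or three points, so its defect is 1 if
      -- it is a bisecant and 0 otherwise.
      bisecants-at : ∀ i → cls i on ℓ → ∑[ b ← trs ] (⟦ seg ℓ b (cls i) ≟ᶠ g i ℓ ⟧ * τ b) ≡ u (cls i) ∸ 2
      bisecants-at i i∈ℓ = trans (∑-cong trs λ b → ⟦⟧*-cong (seg ℓ b (cls i) ≟ᶠ g i ℓ) λ e →
          cases (m ℓ b) (≤3 ℓ b) (m≢1 b) (subst (1 ≤_) (sym (m-count b))
            (count-lower (finFin k) (lies? b) ([] ∷ []) ((i∈ℓ , sym e) ∷ [])))) (defects-at i i∈ℓ)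
        where
        cases : ∀ v → v ≤ 3 → v ≢ 1 → 1 ≤ v → ⟦ v ℕₚ.≟ 2 ⟧ ≡ 3 ∸ v
        cases 1 _ v≢1 _ = contradiction refl v≢1
        cases 2 _ _ _ = refl
        cases 3 _ _ _ = refl
        cases (suc (suc (suc (suc _)))) (s≤s (s≤s (s≤s ()))) _ _

      pairs : ℕ
      pairs = ∑[ x ← pts ] (⟦ x on? ℓ ⟧ * ⟦ u x ℕₚ.≟ 2 ⟧)

      -- Incidences of arc points with bisecants, counted from both sides: each of the u points of a
      -- class lies on u - 2 bisecants.
      2τ≡ : 2 * ∑ trs τ ≡ ∑[ x ← pts ] (⟦ x on? ℓ ⟧ * (u x * (u x ∸ 2)))
      2τ≡ = begin
        2 * ∑ trs τ
          ≡⟨ ∑-*ˡ trs 2 τ ⟨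
        ∑[ b ← trs ] (2 * τ b)
          ≡⟨ ∑-cong trs (λ b → trans (*-comm 2 (τ b)) (⟦⟧*-cong (m ℓ b ℕₚ.≟ 2) sym)) ⟩
        ∑[ b ← trs ] (τ b * m ℓ b)
          ≡⟨ ∑-*ˡ-swap trs is (λ b → (τ b)) _ ⟩
        ∑[ i ← is ] ∑[ b ← trs ] (τ b * (⟦ cls i on? ℓ ⟧ * ⟦ g i ℓ ≟ᶠ seg ℓ b (cls i) ⟧))
          ≡⟨ ∑-cong is (λ i → trans (∑-cong trs λ b → trans (shuffle (τ b) ⟦ cls i on? ℓ ⟧ _)
               (cong (λ t → ⟦ cls i on? ℓ ⟧ * (t * τ b))
                   (⟦⟧-⇔ (g i ℓ ≟ᶠ seg ℓ b (cls i)) (seg ℓ b (cls i) ≟ᶠ g i ℓ) sym sym)))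
               (trans (∑-*ˡ trs ⟦ cls i on? ℓ ⟧ _) (⟦⟧*-cong (cls i on? ℓ) (bisecants-at i)))) ⟩
        ∑[ i ← is ] (⟦ cls i on? ℓ ⟧ * (u (cls i) ∸ 2))
          ≡⟨ ∑-cls (λ x → ⟦ x on? ℓ ⟧ * (u x ∸ 2)) ⟩
        ∑[ x ← pts ] (u x * (⟦ x on? ℓ ⟧ * (u x ∸ 2)))
          ≡⟨ ∑-cong pts (λ x → swap (u x) ⟦ x on? ℓ ⟧ (u x ∸ 2)) ⟩
        ∑[ x ← pts ] (⟦ x on? ℓ ⟧ * (u x * (u x ∸ 2))) ∎
        where
        open ≡-Reasoning
        shuffle : ∀ t o v → t * (o * v) ≡ o * (v * t)
        shuffle = solve-∀
        swap : ∀ a o b → a * (o * b) ≡ o * (a * b)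
        swap = solve-∀

      -- For v among 0, 2 and 3 one has v (v - 2) + 2 [v = 2] = v, so twice the left side adds up to
      -- κ = 12.
      τ+pairs : ∑ trs τ + pairs ≡ 6
      τ+pairs = *-cancelˡ-≡ _ _ 2 (begin
        2 * (∑ trs τ + pairs)         ≡⟨ *-distribˡ-+ 2 (∑ trs τ) pairs ⟩
        2 * ∑ trs τ + 2 * pairs       ≡⟨ cong₂ _+_ 2τ≡ (sym (∑-*ˡ pts 2 _)) ⟩
        ∑[ x ← pts ] (⟦ x on? ℓ ⟧ * (u x * (u x ∸ 2))) + ∑[ x ← pts ] (2 * (⟦ x on? ℓ ⟧ * ⟦ u x ℕₚ.≟ 2 ⟧))
          ≡⟨ ∑-+ pts _ _ ⟨
        ∑[ x ← pts ] (⟦ x on? ℓ ⟧ * (u x * (u x ∸ 2)) + 2 * (⟦ x on? ℓ ⟧ * ⟦ u x ℕₚ.≟ 2 ⟧))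
          ≡⟨ ∑-cong pts (λ x → trans (factor ⟦ x on? ℓ ⟧ (u x * (u x ∸ 2)) _)
               (⟦⟧*-cong (x on? ℓ) (λ x∈ℓ → cases (u-values x x∈ℓ)))) ⟩
        ∑[ x ← pts ] (⟦ x on? ℓ ⟧ * u x) ≡⟨ κ-∑ ℓ ⟨
        κ ℓ                           ≡⟨ κ≡12 ⟩
        12                            ∎)
        where
        open ≡-Reasoning
        factor : ∀ o a b → o * a + 2 * (o * b) ≡ o * (a + 2 * b)
        factor = solve-∀
        cases : ∀ {v} → v ≡ 0 ⊎ v ≡ 2 ⊎ v ≡ 3 → v * (v ∸ 2) + 2 * ⟦ v ℕₚ.≟ 2 ⟧ ≡ v
        cases (inj₁ refl)        = refl
        cases (inj₂ (inj₁ refl)) = refl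
        cases (inj₂ (inj₂ refl)) = refl

      agree≤1 : ∀ {b c} → b ≢ c → ∑[ y ← pts ] (⟦ y on? ℓ ⟧ * ⟦ seg ℓ b y ≟ᶠ seg ℓ c y ⟧) ≤ 1
      agree≤1 {b} {c} b≢c = ≮⇒≥ twice
        where
        agree? : ∀ y → Dec (y on ℓ × seg ℓ b y ≡ seg ℓ c y)
        agree? y = (y on? ℓ) ×-dec (seg ℓ b y ≟ᶠ seg ℓ c y)
        twice : ¬ (1 < ∑[ y ← pts ] (⟦ y on? ℓ ⟧ * ⟦ seg ℓ b y ≟ᶠ seg ℓ c y ⟧))
        twice lt with 1<count ← subst (1 <_) (∑-cong pts
            (λ y → sym (⟦×⟧ (y on? ℓ) (seg ℓ b y ≟ᶠ seg ℓ c y)))) lt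
          with count-upper finPt agree? [] (≤-trans (s≤s z≤n) 1<count)
        ... | y , (y∈ℓ , e) , _ with count-upper finPt agree? (y ∷ []) 1<count
        ...   | z , (z∈ℓ , e′) , z≢y ∷ [] = contradiction (begin
            2               ≡⟨ cong₂ _+_ (sym (one b refl refl)) (sym (one c (sym e) (sym e′))) ⟩
            f b + f c       ≤⟨ Trₚ.two-terms≤∑ f b≢c ⟩
            ∑ trs f         ≡⟨ cross y∈ℓ z∈ℓ (λ y≡z → z≢y (sym y≡z)) (seg ℓ b y) (seg ℓ b z) ⟩
            1               ∎) λ { (s≤s ()) }
          where
          open ≤-Reasoning
          f : Tr → ℕ
          f b′ = ⟦ seg ℓ b′ y ≟ᶠ seg ℓ b y ⟧ * ⟦ seg ℓ b′ z ≟ᶠ seg ℓ b z ⟧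
          one : ∀ b′ → seg ℓ b′ y ≡ seg ℓ b y → seg ℓ b′ z ≡ seg ℓ b z → f b′ ≡ 1
          one b′ p p′ = cong₂ _*_ (⟦⟧-yes (seg ℓ b′ y ≟ᶠ seg ℓ b y) p) (⟦⟧-yes (seg ℓ b′ z ≟ᶠ seg ℓ b z) p′)

      module _ {c} (mc≡2 : m ℓ c ≡ 2) where
        -- The number of bisecants, `c` included, that meet the class `y` in the same segment as
        -- `c`.
        β : Pt → ℕ
        β y = ∑[ b ← trs ] (⟦ seg ℓ b y ≟ᶠ seg ℓ c y ⟧ * τ b)

        τc≡1 : τ c ≡ 1
        τc≡1 = ⟦⟧-yes (m ℓ c ℕₚ.≟ 2) mc≡2

        -- The bisecant `c` agrees with itself on all six classes of `ℓ`, any other bisecant agrees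
        -- with it on at most one.
        β-upper : ∑[ y ← pts ] (⟦ y on? ℓ ⟧ * β y) ≤ ∑ trs τ + 5
        β-upper = begin
          ∑[ y ← pts ] (⟦ y on? ℓ ⟧ * β y)
            ≡⟨ ∑-*ˡ-swap pts trs (λ y → ⟦ y on? ℓ ⟧) _ ⟩
          ∑[ b ← trs ] ∑[ y ← pts ] (⟦ y on? ℓ ⟧ * (⟦ seg ℓ b y ≟ᶠ seg ℓ c y ⟧ * τ b))
            ≡⟨ ∑-cong trs (λ b → trans (∑-cong pts λ y → sym (*-assoc ⟦ y on? ℓ ⟧ _ (τ b)))
                (∑-*ʳ pts (τ b) _)) ⟩
          ∑[ b ← trs ] (meets b * τ b)
            ≤⟨ ∑-mono trs pointwise ⟩
          ∑[ b ← trs ] (τ b + ⟦ b ≟ᵀ c ⟧ * 5)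
            ≡⟨ ∑-+ trs _ _ ⟩
          ∑ trs τ + ∑[ b ← trs ] (⟦ b ≟ᵀ c ⟧ * 5)
            ≡⟨ cong (∑ trs τ +_) (Trₚ.∑-δ c (λ _ → 5)) ⟩
          ∑ trs τ + 5 ∎
          where
          open ≤-Reasoning
          meets : Tr → ℕ
          meets b = ∑[ y ← pts ] (⟦ y on? ℓ ⟧ * ⟦ seg ℓ b y ≟ᶠ seg ℓ c y ⟧)
          pointwise : ∀ b → meets b * τ b ≤ τ b + ⟦ b ≟ᵀ c ⟧ * 5
          pointwise b with b ≟ᵀ c
          ... | no b≢c   = ≤-trans (*-monoˡ-≤ (τ b) (agree≤1 b≢c))
              (≤-reflexive (trans (*-identityˡ (τ b)) (sym (+-identityʳ (τ b)))))
          ... | yes refl = begin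
            meets b * τ b       ≡⟨ trans (cong (meets b *_) τc≡1) (*-identityʳ _) ⟩
            meets b             ≤⟨ ∑-mono pts (λ y → ≤-trans
                (*-monoʳ-≤ ⟦ y on? ℓ ⟧ (⟦⟧≤1 (seg ℓ b y ≟ᶠ seg ℓ b y))) (≤-reflexive (*-identityʳ _))) ⟩
            ∑[ y ← pts ] ⟦ y on? ℓ ⟧ ≡⟨ meet ℓ ⟩
            6                   ≡⟨ cong (_+ 5) τc≡1 ⟨
            τ b + 5             ∎

        1≤β : ∀ y → 1 ≤ β y
        1≤β y = subst (_≤ β y) (cong₂ _*_ (⟦⟧-yes (seg ℓ c y ≟ᶠ seg ℓ c y) refl) τc≡1)
          (Trₚ.term≤∑ c (λ b → ⟦ seg ℓ b y ≟ᶠ seg ℓ c y ⟧ * τ b))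

        -- Off the arc, 2 β + 3 σ is the number of arc points outside the class y.
        β-congruence : ∀ y → y on ℓ → n y ℓ (seg ℓ c y) ≡ 0 → ∃ λ t → 2 * β y + 3 * t + u y ≡ 12
        β-congruence y y∈ℓ n≡0 = t , (begin
          2 * β y + 3 * t + u y
            ≡⟨ cong (_+ u y) (cong₂ _+_ (sym (∑-*ˡ trs 2 _)) (sym (∑-*ˡ trs 3 _))) ⟩
          ∑[ b ← trs ] (2 * (hit b * τ b)) + ∑[ b ← trs ] (3 * (hit b * σ b)) + u y
            ≡⟨ cong (_+ u y) (∑-+ trs _ _) ⟨
          ∑[ b ← trs ] (2 * (hit b * τ b) + 3 * (hit b * σ b)) + u y
            ≡⟨ cong (_+ u y) (∑-cong trs λ b → trans (factor (hit b) (τ b) (σ b))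
                (cong (hit b *_) (sym (m≡τσ b)))) ⟩
          ∑[ b ← trs ] (hit b * m ℓ b) + u y
            ≡⟨ pencil₁₂ y∈ℓ (seg ℓ c y) ⟩
          12 + 5 * n y ℓ (seg ℓ c y)
            ≡⟨ cong (λ v → 12 + 5 * v) n≡0 ⟩
          12 ∎)
          where
          open ≡-Reasoning
          hit : Tr → ℕ
          hit b = ⟦ seg ℓ b y ≟ᶠ seg ℓ c y ⟧
          t : ℕ
          t = ∑[ b ← trs ] (hit b * σ b)
          factor : ∀ o a b → 2 * (o * a) + 3 * (o * b) ≡ o * (2 * a + 3 * b)
          factor = solve-∀

        -- On a segment without arc points `β-congruence` says β ≡ u modulo 3. As β ≥ 1, this gives
        -- β ≥ 3 for u = 0 or 3, and β ≥ 2 for u = 2. If the segment has arc points, `2 * n` makes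
        -- up for knowing only β ≥ 1.
        β-lower : ∀ y → y on ℓ → 3 ≤ β y + ⟦ u y ℕₚ.≟ 2 ⟧ + 2 * n y ℓ (seg ℓ c y)
        β-lower y y∈ℓ with n y ℓ (seg ℓ c y) in n≡
        ... | suc v = linear (⟦ u y ℕₚ.≟ 2 ⟧ + 2 * v) (1≤β y) (identity (β y) ⟦ u y ℕₚ.≟ 2 ⟧ v)
          where
          identity : ∀ b p v → 3 + b + (p + 2 * v) ≡ b + p + 2 * (1 + v) + 1
          identity = solve-∀
        ... | zero = ≤-trans (cases (β y) (1≤β y) (u-values y y∈ℓ) (β-congruence y y∈ℓ n≡))
            (≤-reflexive (sym (+-identityʳ _)))
          where
          impossible : ∀ {t v} → 3 * t ≡ v → ¬ (3 ∣ v) → ∀ {a} {A : Set a} → A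
          impossible {t} e ∤ = contradiction (divides t (trans (sym e) (*-comm 3 t))) ∤
          cases : ∀ b → 1 ≤ b → u y ≡ 0 ⊎ u y ≡ 2 ⊎ u y ≡ 3 →
              (∃ λ t → 2 * b + 3 * t + u y ≡ 12) → 3 ≤ b + ⟦ u y ℕₚ.≟ 2 ⟧
          cases (suc (suc (suc b))) _ _ _ = s≤s (s≤s (s≤s z≤n))
          cases 1 _ (inj₁ e) (t , f) rewrite e = impossible {t}
              (trans (sym (+-identityʳ _)) (suc-injective (suc-injective f))) (from-no (3 ∣? 10))
          cases 2 _ (inj₁ e) (t , f) rewrite e = impossible {t}
              (trans (sym (+-identityʳ _)) (suc-injective
              (suc-injective (suc-injective (suc-injective f))))) (from-no (3 ∣? 8))
          cases 1 _ (inj₂ (inj₁ e)) (t , f) rewrite e = impossible {t}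
              (+-cancelʳ-≡ 2 (3 * t) 8 (suc-injective (suc-injective f))) (from-no (3 ∣? 8))
          cases 2 _ (inj₂ (inj₁ e)) (t , f) rewrite e = ≤-refl
          cases 1 _ (inj₂ (inj₂ e)) (t , f) rewrite e = impossible {t}
              (+-cancelʳ-≡ 3 (3 * t) 7 (suc-injective (suc-injective f))) (from-no (3 ∣? 7))
          cases 2 _ (inj₂ (inj₂ e)) (t , f) rewrite e = impossible {t}
              (+-cancelʳ-≡ 3 (3 * t) 5 (suc-injective (suc-injective (suc-injective (suc-injective f)))))
              (from-no (3 ∣? 5))

        ∑-n-on : ∑[ y ← pts ] (⟦ y on? ℓ ⟧ * n y ℓ (seg ℓ c y)) ≡ 2
        ∑-n-on = trans (begin
          ∑[ y ← pts ] (⟦ y on? ℓ ⟧ * n y ℓ (seg ℓ c y))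
            ≡⟨ ∑-*ˡ-swap pts is (λ y → ⟦ y on? ℓ ⟧) _ ⟩
          ∑[ i ← is ] ∑[ y ← pts ] (⟦ y on? ℓ ⟧ * (⟦ cls i ≟ᴾ y ⟧ * ⟦ g i ℓ ≟ᶠ seg ℓ c y ⟧))
            ≡⟨ ∑-cong is (λ i → trans (∑-cong pts λ y → trans (shuffle ⟦ y on? ℓ ⟧ ⟦ cls i ≟ᴾ y ⟧ _)
                 (cong (_* (⟦ y on? ℓ ⟧ * ⟦ g i ℓ ≟ᶠ seg ℓ c y ⟧)) (⟦⟧-⇔ (cls i ≟ᴾ y) (y ≟ᴾ cls i) sym sym)))
                 (Ptₚ.∑-δ (cls i) (λ y → ⟦ y on? ℓ ⟧ * ⟦ g i ℓ ≟ᶠ seg ℓ c y ⟧))) ⟩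
          m ℓ c ∎) mc≡2
          where
          open ≡-Reasoning
          shuffle : ∀ o e v → o * (e * v) ≡ e * (o * v)
          shuffle = solve-∀

        -- Over the six classes `β-lower` demands 18, whereas the available terms are at most τ + 5,
        -- pairs and 4, which is 15 in all by `τ+pairs`.
        bisecant-⊥ : ∀ {a} {A : Set a} → A
        bisecant-⊥ = linear-⊥ 2 (+-mono-≤ lower β-upper)
            (identity (∑[ y ← pts ] (⟦ y on? ℓ ⟧ * β y)) (∑ trs τ) pairs τ+pairs)
          where
          identity : ∀ b t p → t + p ≡ 6 → b + p + 4 + (t + 5) + 3 ≡ 18 + b
          identity b t p e = trans (shuffle b t p) (trans (cong (λ v → 12 + b + v) e) (+-comm (12 + b) 6))
            where
            shuffle : ∀ b t p → b + p + 4 + (t + 5) + 3 ≡ 12 + b + (t + p)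
            shuffle = solve-∀
          lower : 18 ≤ ∑[ y ← pts ] (⟦ y on? ℓ ⟧ * β y) + pairs + 4
          lower = begin
            18 ≡⟨ cong (_* 3) (meet ℓ) ⟨
            (∑[ y ← pts ] ⟦ y on? ℓ ⟧) * 3 ≡⟨ ∑-*ʳ pts 3 _ ⟨
            ∑[ y ← pts ] (⟦ y on? ℓ ⟧ * 3)
              ≤⟨ ∑-mono pts (λ y → ⟦⟧*-mono (y on? ℓ) (β-lower y)) ⟩
            ∑[ y ← pts ] (⟦ y on? ℓ ⟧ * (β y + ⟦ u y ℕₚ.≟ 2 ⟧ + 2 * n y ℓ (seg ℓ c y)))
              ≡⟨ ∑-cong pts (λ y → expand ⟦ y on? ℓ ⟧ (β y) ⟦ u y ℕₚ.≟ 2 ⟧ (n y ℓ (seg ℓ c y))) ⟩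
            ∑[ y ← pts ] (⟦ y on? ℓ ⟧ * β y + ⟦ y on? ℓ ⟧ * ⟦ u y ℕₚ.≟ 2 ⟧ + 2 *
                (⟦ y on? ℓ ⟧ * n y ℓ (seg ℓ c y)))
              ≡⟨ trans (∑-+ pts _ _) (cong₂ _+_ (∑-+ pts _ _) (∑-*ˡ pts 2 _)) ⟩
            ∑[ y ← pts ] (⟦ y on? ℓ ⟧ * β y) + pairs + 2 * ∑[ y ← pts ] (⟦ y on? ℓ ⟧ * n y ℓ (seg ℓ c y))
              ≡⟨ cong (λ v → ∑[ y ← pts ] (⟦ y on? ℓ ⟧ * β y) + pairs + 2 * v) ∑-n-on ⟩
            ∑[ y ← pts ] (⟦ y on? ℓ ⟧ * β y) + pairs + 4 ∎
            where
            open ≤-Reasoning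
            expand : ∀ o a p v → o * (a + p + 2 * v) ≡ o * a + o * p + 2 * (o * v)
            expand = solve-∀

      good-⊥ : ∀ i → cls i on ℓ → u (cls i) ≡ 3 → ∀ {a} {A : Set a} → A
      good-⊥ i i∈ℓ u≡3 with Trₚ.any? (λ b → m ℓ b ℕₚ.≟ 2)
      ... | yes (c , mc≡2) = bisecant-⊥ mc≡2
      ... | no none = contradiction (begin
        1 ≡⟨ cong (_∸ 2) u≡3 ⟨
        u (cls i) ∸ 2 ≡⟨ bisecants-at i i∈ℓ ⟨
        ∑[ b ← trs ] (⟦ seg ℓ b (cls i) ≟ᶠ g i ℓ ⟧ * τ b)
          ≡⟨ ∑-cong trs (λ b → trans (cong (⟦ seg ℓ b (cls i) ≟ᶠ g i ℓ ⟧ *_)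
              (⟦⟧-no (m ℓ b ℕₚ.≟ 2) (λ e → none (b , e)))) (*-zeroʳ ⟦ seg ℓ b (cls i) ≟ᶠ g i ℓ ⟧)) ⟩
        ∑[ b ← trs ] 0 ≡⟨ ∑-zero trs ⟩
        0 ∎) λ ()
        where open ≡-Reasoning

    module _ (small : ∀ x → u x ≤ 3) (i : Fin k) (u≡3 : u (cls i) ≡ 3) where
      κ≤18∸5w : ∀ i′ {ℓ} → cls i′ on ℓ → κ ℓ + 5 * w i′ ℓ ≤ 18
      κ≤18∸5w i′ i′∈ℓ = ≤-trans (lineclass-bound i′ i′∈ℓ) (+-monoˡ-≤ 15 (small (cls i′)))

      -- A segment with two arc points already forces κ ≤ 8. If `ℓ` has none, then a class with u =
      -- 3 on `ℓ` supplies the bisecant that is refuted above.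
      κ≤11 : ∀ {ℓ} → cls i on ℓ → κ ℓ ≤ 11
      κ≤11 {ℓ} i∈ℓ with Arcₚ.any? (λ i′ → (cls i′ on? ℓ) ×-dec (2 ≤? w i′ ℓ))
      ... | yes (i′ , i′∈ℓ , 2≤w) = ≤-trans (+-cancelʳ-≤ 10 (κ ℓ) 8
          (≤-trans (+-monoʳ-≤ (κ ℓ) (*-monoʳ-≤ 5 2≤w)) (κ≤18∸5w i′ i′∈ℓ)))
                                     (toWitness {a? = 8 ≤? 11} _)
      ... | no none = ≮⇒≥ λ 12≤κ → Good.good-⊥ small
        (λ i′ i′∈ℓ → ≤-antisym (≮⇒≥ λ 2≤w → none (i′ , i′∈ℓ , 2≤w)) (1≤w i′ ℓ)) 12≤κ i i∈ℓ u≡3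

      -- The rate 3 is the slope between the extreme cases w = 1, κ = 11 and w = 2, κ = 8. In a
      -- balanced class this rate would only give k ≤ 45; but there w = 2 cannot occur, which
      -- permits the rate 4 between (1, 11) and (3, 3).
      unbalanced-18 : ∀ κ v → κ ≤ 11 → κ + 5 * v ≤ 18 → 1 ≤ v → v ≤ 3 → κ + 3 * v ≤ 14
      unbalanced-18 κ 1 κ≤11 _ _ _ = +-monoˡ-≤ 3 κ≤11
      unbalanced-18 κ 2 _ le _ _ = linear 0 le (identity κ)
        where
        identity : ∀ κ → κ + 6 + 18 + 0 ≡ 14 + (κ + 10)
        identity = solve-∀
      unbalanced-18 κ 3 _ le _ _ = linear 2 le (identity κ)
        where
        identity : ∀ κ → κ + 9 + 18 + 2 ≡ 14 + (κ + 15)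
        identity = solve-∀
      unbalanced-18 κ (suc (suc (suc (suc _)))) _ _ _ (s≤s (s≤s (s≤s ())))

      balanced-18 : ∀ κ v → κ ≤ 11 → κ + 5 * v ≤ 18 → 1 ≤ v → v ≤ 3 → v ∣ 3 → κ + 4 * v ≤ 15
      balanced-18 κ 1 κ≤11 _ _ _ _ = +-monoˡ-≤ 4 κ≤11
      balanced-18 κ 2 _ _ _ _ 2∣3 = contradiction 2∣3 (from-no (2 ∣? 3))
      balanced-18 κ 3 _ le _ _ _ = linear 0 le (identity κ)
        where
        identity : ∀ κ → κ + 12 + 18 + 0 ≡ 15 + (κ + 15)
        identity = solve-∀
      balanced-18 κ (suc (suc (suc (suc _)))) _ _ _ (s≤s (s≤s (s≤s ()))) _

      triple-bound : k ≤ 44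
      triple-bound with unbalanced? i
      ... | yes (i′ , e , i″ , ℓ₀ , unb) = linear 2
        (≤-trans (+-monoʳ-≤ (k + 5 * u (cls i′)) (*-monoʳ-≤ 3 (∑-W unb)))
          (weighted-bound (cls i′) 14 3 (W unb) λ ℓ i′∈ℓ → W-cases unb (λ v → κ ℓ + 3 * v ≤ 14) ℓ
            (bound i′ e i′∈ℓ) (bound i″ (trans (proj₁ unb) e) (subst (_on ℓ) (sym (proj₁ unb)) i′∈ℓ))))
        (subst (λ v → k + 84 + 2 ≡ 44 + (k + 5 * v + 3 * (5 + v + 1))) (sym (trans (cong u e) u≡3))
            (identity k))
        where
        bound : ∀ i′ {ℓ} → cls i′ ≡ cls i → cls i′ on ℓ → κ ℓ + 3 * w i′ ℓ ≤ 14
        bound i′ {ℓ} e i′∈ℓ = unbalanced-18 (κ ℓ) (w i′ ℓ) (κ≤11 (subst (_on ℓ) e i′∈ℓ)) (κ≤18∸5w i′ i′∈ℓ)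
            (1≤w i′ ℓ) (w≤3 i′ i′∈ℓ)
        identity : ∀ k → k + 84 + 2 ≡ 44 + (k + 5 * 3 + 3 * 9)
        identity = solve-∀
      ... | no ¬unb = linear 1
        (subst (λ W → k + 5 * u (cls i) + 4 * W ≤ 90) (∑-w i)
          (weighted-bound (cls i) 15 4 (w i) λ ℓ i∈ℓ → balanced-18 (κ ℓ) (w i ℓ) (κ≤11 i∈ℓ) (κ≤18∸5w i i∈ℓ)
              (1≤w i ℓ) (w≤3 i i∈ℓ)
            (subst (w i ℓ ∣_) u≡3 (balanced-∣ (balanced ¬unb) i∈ℓ))))
        (subst (λ v → k + 90 + 1 ≡ 44 + (k + 5 * v + 4 * (5 + v))) (sym u≡3) (identity k))
        where
        identity : ∀ k → k + 90 + 1 ≡ 44 + (k + 5 * 3 + 4 * 8)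
        identity = solve-∀

    small-five : (∀ x → u x ≤ 3) → k ≤ 44
    small-five small with Arcₚ.any? (λ i → u (cls i) ℕₚ.≟ 3)
    ... | yes (i , u≡3) = triple-bound small i u≡3
    ... | no none = tiny λ x → bound x (represented? x)
      where
      bound : ∀ x → Dec (∃ λ i → cls i ≡ x) → u x ≤ 2
      bound x (no empty)       = ≤-trans (≤-reflexive (u-empty empty)) z≤n
      bound x (yes (i , refl)) = ≤-pred (≤∧≢⇒< (small x) λ u≡3 → none (i , u≡3))

  -- The bounds for all orders

  module ArcBounds {q} (5≤q : 5 ≤ q) (G : Geometry q) {k} (K : Arc G k) where
    open Arc K

    private
      1≤q : 1 ≤ q
      1≤q = ≤-trans (s≤s z≤n) 5≤q

    open Counting 1≤q G K using (u; module Arcₚ)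
    open LargeClass 1≤q G K using (large-odd; large-even)
    open SmallClasses 1≤q G K using (represented?; u-empty; small-odd; small-even)

    small-classes : ¬ (∃ λ i → 4 ≤ u (cls i)) → ∀ x → u x ≤ 3
    small-classes ¬large x with represented? x
    ... | no empty       = subst (_≤ 3) (sym (u-empty empty)) z≤n
    ... | yes (i , refl) = ≮⇒≥ λ 4≤u → ¬large (i , 4≤u)

    odd-bound : ¬ (2 ∣ q) → k + 2 * q ≤ 2 * (q * q) + 4
    odd-bound odd with Arcₚ.any? (λ i → 4 ℕₚ.≤? u (cls i))
    ... | yes (i , 4≤u) = large-odd odd (≤-trans (s≤s (s≤s z≤n)) 5≤q) i 4≤u
    ... | no ¬large with q ℕₚ.≟ 5
    ...   | yes refl = +-monoˡ-≤ 10 (OrderFive.small-five G K (small-classes ¬large))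
    ...   | no q≢5   = small-odd (small-classes ¬large)
      (≤∧≢⇒< (≤∧≢⇒< 5≤q (λ e → q≢5 (sym e))) (λ { refl → odd (divides 3 refl) }))

    even-bound : 2 ∣ q → k + q ≤ 2 * (q * q) + 4
    even-bound 2∣q with Arcₚ.any? (λ i → 4 ℕₚ.≤? u (cls i))
    ... | yes (i , 4≤u) = large-even i 4≤u
    ... | no ¬large = small-even (small-classes ¬large) (≤∧≢⇒< 5≤q (odd 2∣q))
      where
      odd : ∀ {q} → 2 ∣ q → 5 ≢ q
      odd (divides (ℕ.suc (ℕ.suc (ℕ.suc _))) ()) refl
      odd (divides 0 ()) refl
      odd (divides 1 ()) refl
      odd (divides 2 ()) refl

open Combinatorics using (Geometry; Arc; module ArcBounds)

-- A ring solver with integer coefficients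

module IntegerCoefficients {c ℓ} (R : CommutativeRing c ℓ) where
  import Algebra.Properties.Semiring.Mult.TCOptimised as Mult
  import Algebra.Solver.Ring as RingSolver
  open import Algebra.Solver.Ring.AlmostCommutativeRing using (fromCommutativeRing; _-Raw-AlmostCommutative⟶_)
  open import Data.Integer.Base as ℤ using (ℤ; +_; -[1+_]; _⊖_)
  import Data.Integer.Properties as ℤₚ
  open import Data.Maybe.Base using (Maybe; just; nothing)
  open import Data.Nat.Base as ℕ using (ℕ; zero; suc)
  import Data.Nat.Properties as ℕₚ
  open import Relation.Binary.PropositionalEquality as ≡ using (_≡_)

  open CommutativeRing R
  open AbelianGroupₚ +-abelianGroup
    renaming (ε⁻¹≈ε to -0≈0; ⁻¹-∙-comm to -‿+-comm; ⁻¹-involutive to -‿involutive; ⁻¹-anti-homo‿- to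
        -‿anti-homo)
  open CommutativeSemigroupₚ (CommutativeMonoid.commutativeSemigroup +-commutativeMonoid) using (interchange)
  open Ringₚ ring using (-‿distribˡ-*; -‿distribʳ-*)
  open Mult semiring renaming (_×_ to _·_) using (1+×; ×-homo-+; ×1-homo-*; ×-cong)
  open import Relation.Binary.Reasoning.Setoid setoid

  -- With the optimised multiple, `con (+ 0)` and `con (+ 1)` evaluate to `0#` and `1#` by
  -- computation, so solver identities match goals that contain these constants.
  ⟦_⟧ℤ : ℤ → Carrier
  ⟦ + n ⟧ℤ      = n · 1#
  ⟦ -[1+ n ] ⟧ℤ = - (suc n · 1#)

  ⊖-homo : ∀ m n → ⟦ m ⊖ n ⟧ℤ ≈ m · 1# - n · 1#
  ⊖-homo zero    zero    = sym (-‿inverseʳ 0#)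
  ⊖-homo zero    (suc n) = sym (+-identityˡ _)
  ⊖-homo (suc m) zero    = sym (trans (+-congˡ -0≈0) (+-identityʳ _))
  ⊖-homo (suc m) (suc n) = begin
    ⟦ suc m ⊖ suc n ⟧ℤ                    ≡⟨ ≡.cong ⟦_⟧ℤ (ℤₚ.[1+m]⊖[1+n]≡m⊖n m n) ⟩
    ⟦ m ⊖ n ⟧ℤ                            ≈⟨ ⊖-homo m n ⟩
    m · 1# - n · 1#                       ≈⟨ +-identityˡ _ ⟨
    0# + (m · 1# - n · 1#)                ≈⟨ +-congʳ (-‿inverseʳ 1#) ⟨
    (1# - 1#) + (m · 1# - n · 1#)         ≈⟨ interchange 1# (- 1#) (m · 1#) _ ⟩
    (1# + m · 1#) + (- 1# - n · 1#)       ≈⟨ +-congˡ (-‿+-comm 1# (n · 1#)) ⟩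
    (1# + m · 1#) - (1# + n · 1#)         ≈⟨ +-cong (1+× m 1#) (-‿cong (1+× n 1#)) ⟨
    suc m · 1# - suc n · 1#               ∎

  +-homo : ∀ i j → ⟦ i ℤ.+ j ⟧ℤ ≈ ⟦ i ⟧ℤ + ⟦ j ⟧ℤ
  +-homo (+ m)    (+ n)    = ×-homo-+ 1# m n
  +-homo (+ m)    -[1+ n ] = ⊖-homo m (suc n)
  +-homo -[1+ m ] (+ n)    = trans (⊖-homo n (suc m)) (+-comm _ _)
  +-homo -[1+ m ] -[1+ n ] = begin
    - (suc (suc (m ℕ.+ n)) · 1#)          ≈⟨ -‿cong (×-cong (≡.cong suc (ℕₚ.+-suc m n)) refl) ⟨
    - ((suc m ℕ.+ suc n) · 1#)            ≈⟨ -‿cong (×-homo-+ 1# (suc m) (suc n)) ⟩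
    - (suc m · 1# + suc n · 1#)           ≈⟨ -‿+-comm _ _ ⟨
    - (suc m · 1#) - suc n · 1#           ∎

  -‿homo : ∀ i → ⟦ ℤ.- i ⟧ℤ ≈ - ⟦ i ⟧ℤ
  -‿homo (+ zero)  = sym -0≈0
  -‿homo (+ suc n) = refl
  -‿homo -[1+ n ]  = sym (-‿involutive _)

  *-homo : ∀ i j → ⟦ i ℤ.* j ⟧ℤ ≈ ⟦ i ⟧ℤ * ⟦ j ⟧ℤ
  *-homo (+ m) (+ n) = trans (reflexive (≡.cong ⟦_⟧ℤ (≡.sym (ℤₚ.pos-* m n)))) (×1-homo-* m n)
  *-homo (+ m) -[1+ n ] = begin
    ⟦ + m ℤ.* -[1+ n ] ⟧ℤ                 ≡⟨ ≡.cong ⟦_⟧ℤ (ℤₚ.neg-distribʳ-* (+ m) (+ suc n)) ⟨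
    ⟦ ℤ.- (+ m ℤ.* + suc n) ⟧ℤ            ≈⟨ -‿homo (+ m ℤ.* + suc n) ⟩
    - ⟦ + m ℤ.* + suc n ⟧ℤ                ≈⟨ -‿cong (*-homo (+ m) (+ suc n)) ⟩
    - (m · 1# * (suc n · 1#))             ≈⟨ -‿distribʳ-* _ _ ⟩
    m · 1# * - (suc n · 1#)               ∎
  *-homo -[1+ m ] (+ n) = begin
    ⟦ -[1+ m ] ℤ.* + n ⟧ℤ                 ≡⟨ ≡.cong ⟦_⟧ℤ (ℤₚ.neg-distribˡ-* (+ suc m) (+ n)) ⟨
    ⟦ ℤ.- (+ suc m ℤ.* + n) ⟧ℤ            ≈⟨ -‿homo (+ suc m ℤ.* + n) ⟩
    - ⟦ + suc m ℤ.* + n ⟧ℤ                ≈⟨ -‿cong (*-homo (+ suc m) (+ n)) ⟩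
    - (suc m · 1# * (n · 1#))             ≈⟨ -‿distribˡ-* _ _ ⟩
    - (suc m · 1#) * (n · 1#)             ∎
  *-homo -[1+ m ] -[1+ n ] = begin
    (suc m ℕ.* suc n) · 1#                ≈⟨ ×1-homo-* (suc m) (suc n) ⟩
    suc m · 1# * (suc n · 1#)             ≈⟨ -‿involutive _ ⟨
    - - (suc m · 1# * (suc n · 1#))       ≈⟨ -‿cong (-‿distribˡ-* _ _) ⟩
    - (- (suc m · 1#) * (suc n · 1#))     ≈⟨ -‿distribʳ-* _ _ ⟩
    - (suc m · 1#) * - (suc n · 1#)       ∎

  ℤ-morphism : ℤ.+-*-rawRing -Raw-AlmostCommutative⟶ fromCommutativeRing R
  ℤ-morphism = record
    { ⟦_⟧    = ⟦_⟧ℤ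
    ; +-homo = +-homo
    ; *-homo = *-homo
    ; -‿homo = -‿homo
    ; 0-homo = refl
    ; 1-homo = refl
    }

  private
    coeff≟ : ∀ i j → Maybe (⟦ i ⟧ℤ ≈ ⟦ j ⟧ℤ)
    coeff≟ i j with i ℤₚ.≟ j
    ... | yes i≡j = just (reflexive (≡.cong ⟦_⟧ℤ i≡j))
    ... | no _    = nothing

  open RingSolver ℤ.+-*-rawRing (fromCommutativeRing R) ℤ-morphism coeff≟ public
    using (solve; _:=_; _:+_; _:*_; _:-_; :-_; con)

-- The projective plane over a finite field

module Planes where
  import Data.Integer.Base as ℤ
  open import Data.Nat.Base as ℕ using (ℕ; suc)
  open import Data.Nat.Divisibility using (_∣_; divides)
  import Data.Nat.Properties as ℕₚ
  open import Data.Nat.Tactic.RingSolver using (solve-∀)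
  open import Level using (0ℓ)
  open import Relation.Binary.PropositionalEquality

  -- The carrier is `Fin q`, so that equality is propositional and decidable and sums over the field
  -- are sums over `allFin q`.
  record FiniteField (q : ℕ) : Set where
    infixl 6 _+_
    infixl 7 _*_
    infix  8 -_
    field
      _+_ _*_ : Fin q → Fin q → Fin q
      -_      : Fin q → Fin q
      0# 1#   : Fin q
      isCommutativeRing : IsCommutativeRing _≡_ _+_ _*_ -_ 0# 1#
      0≢1     : 0# ≢ 1#
      inverse : ∀ x → x ≢ 0# → ∃ λ y → x * y ≡ 1#

    commutativeRing : CommutativeRing 0ℓ 0ℓ
    commutativeRing = record { isCommutativeRing = isCommutativeRing }

  ∑-reindex : ∀ {a} {A : Set a} (FA : Enumeration A) (σ τ : A → A) → (∀ x → τ (σ x) ≡ x) → (∀ x → σ (τ x) ≡ x) →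
              ∀ f → ∑[ x ← Enumeration.elems FA ] f (σ x) ≡ ∑ (Enumeration.elems FA) f
  ∑-reindex FA σ τ τσ στ f = begin
    ∑[ x ← elems ] f (σ x)
      ≡⟨ ∑-cong elems (λ x → sym (∑-δ (σ x) f)) ⟩
    ∑[ x ← elems ] ∑[ y ← elems ] (⟦ y ≟ σ x ⟧ ℕ.* f y)
      ≡⟨ ∑-swap elems elems _ ⟩
    ∑[ y ← elems ] ∑[ x ← elems ] (⟦ y ≟ σ x ⟧ ℕ.* f y)
      ≡⟨ ∑-cong elems (λ y → trans (∑-*ʳ elems (f y) _) (trans (cong (ℕ._* f y)
           (trans (∑-cong elems λ x → ⟦⟧-⇔ (y ≟ σ x) (x ≟ τ y) (λ e → trans (sym (τσ x)) (cong τ (sym e)))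
               (λ e → trans (sym (στ y)) (cong σ (sym e)))) (once (τ y))))
           (ℕₚ.*-identityˡ (f y)))) ⟩
    ∑ elems f ∎
    where
    open Enumeration FA
    open ≡-Reasoning

  module FieldPlane {q : ℕ} (𝔽 : FiniteField q) where
    open FiniteField 𝔽 using (0≢1; inverse; commutativeRing)
    open CommutativeRing commutativeRing
      using (_+_; _*_; -_; _-_; 0#; 1#; zeroˡ; zeroʳ; *-comm; *-assoc; *-identityˡ; *-identityʳ;
             +-identityˡ; +-identityʳ; +-abelianGroup; +-assoc)
    open AbelianGroupₚ +-abelianGroup using () renaming (x∙y⁻¹≈ε⇒x≈y to x-y≡0⇒x≡y; x≈y⇒x∙y⁻¹≈ε to x≡y⇒x-y≡0)
    open IntegerCoefficients commutativeRing using (solve; _:=_; _:+_; _:*_; _:-_; :-_; con)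

    F : Set
    F = Fin q

    infix 4 _≟ᶠ_
    _≟ᶠ_ : DecidableEquality F
    _≟ᶠ_ = Finₚ._≟_

    x*y≡0⇒y≡0 : ∀ {x y} → x ≢ 0# → x * y ≡ 0# → y ≡ 0#
    x*y≡0⇒y≡0 {x} {y} x≢0 xy≡0 with inverse x x≢0
    ... | x⁻¹ , xx⁻¹≡1 = begin
      y               ≡⟨ *-identityˡ y ⟨
      1# * y          ≡⟨ cong (_* y) xx⁻¹≡1 ⟨
      x * x⁻¹ * y     ≡⟨ solve 3 (λ x i y → x :* i :* y := i :* (x :* y)) refl x x⁻¹ y ⟩
      x⁻¹ * (x * y)   ≡⟨ cong (x⁻¹ *_) xy≡0 ⟩
      x⁻¹ * 0#        ≡⟨ zeroʳ x⁻¹ ⟩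
      0#              ∎
      where open ≡-Reasoning

    record V : Set where
      constructor ⟨_,_,_⟩
      field
        x₁ x₂ x₃ : F

    open V public

    𝟎 : V
    𝟎 = ⟨ 0# , 0# , 0# ⟩

    V-≡ : ∀ {a b c a′ b′ c′} → a ≡ a′ → b ≡ b′ → c ≡ c′ → ⟨ a , b , c ⟩ ≡ ⟨ a′ , b′ , c′ ⟩
    V-≡ refl refl refl = refl

    infixl 7 _∙_ _⨯_
    infixr 7 _•_
    infixl 6 _⊞_ _⊟_

    _∙_ : V → V → F
    a ∙ x = x₁ a * x₁ x + (x₂ a * x₂ x + x₃ a * x₃ x)

    _⨯_ : V → V → V
    x ⨯ y = ⟨ x₂ x * x₃ y - x₃ x * x₂ y , x₃ x * x₁ y - x₁ x * x₃ y , x₁ x * x₂ y - x₂ x * x₁ y ⟩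

    _•_ : F → V → V
    r • x = ⟨ r * x₁ x , r * x₂ x , r * x₃ x ⟩

    _⊞_ : V → V → V
    x ⊞ y = ⟨ x₁ x + x₁ y , x₂ x + x₂ y , x₃ x + x₃ y ⟩

    _⊟_ : V → V → V
    x ⊟ y = ⟨ x₁ x - x₁ y , x₂ x - x₂ y , x₃ x - x₃ y ⟩

    ∙-comm : ∀ a x → a ∙ x ≡ x ∙ a
    ∙-comm ⟨ a , b , c ⟩ ⟨ x , y , z ⟩ =
      solve 6 (λ a b c x y z → a :* x :+ (b :* y :+ c :* z) := x :* a :+ (y :* b :+ z :* c)) refl a b c x y z

    ∙-⊟ : ∀ a x y → a ∙ (x ⊟ y) ≡ a ∙ x - a ∙ y
    ∙-⊟ ⟨ a , b , c ⟩ ⟨ x , y , z ⟩ ⟨ x′ , y′ , z′ ⟩ =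
      solve 9 (λ a b c x y z x′ y′ z′ → a :* (x :- x′) :+ (b :* (y :- y′) :+ c :* (z :- z′)) :=
        (a :* x :+ (b :* y :+ c :* z)) :- (a :* x′ :+ (b :* y′ :+ c :* z′))) refl a b c x y z x′ y′ z′

    ⊞-∙ : ∀ a b x → (a ⊞ b) ∙ x ≡ a ∙ x + b ∙ x
    ⊞-∙ ⟨ a , b , c ⟩ ⟨ a′ , b′ , c′ ⟩ ⟨ x , y , z ⟩ =
      solve 9 (λ a b c a′ b′ c′ x y z → (a :+ a′) :* x :+ ((b :+ b′) :* y :+ (c :+ c′) :* z) :=
        (a :* x :+ (b :* y :+ c :* z)) :+ (a′ :* x :+ (b′ :* y :+ c′ :* z))) refl a b c a′ b′ c′ x y z

    •-∙ : ∀ r a x → (r • a) ∙ x ≡ r * (a ∙ x)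
    •-∙ r ⟨ a , b , c ⟩ ⟨ x , y , z ⟩ =
      solve 7 (λ r a b c x y z → r :* a :* x :+ (r :* b :* y :+ r :* c :* z) := r :*
          (a :* x :+ (b :* y :+ c :* z)))
        refl r a b c x y z

    ⨯-∙ˡ : ∀ x y → (x ⨯ y) ∙ x ≡ 0#
    ⨯-∙ˡ ⟨ a , b , c ⟩ ⟨ x , y , z ⟩ =
      solve 6 (λ a b c x y z → (b :* z :- c :* y) :* a :+ ((c :* x :- a :* z) :* b :+ (a :* y :- b :* x) :* c)
        := con (ℤ.+ 0)) refl a b c x y z

    ⨯-∙ʳ : ∀ x y → (x ⨯ y) ∙ y ≡ 0#
    ⨯-∙ʳ ⟨ a , b , c ⟩ ⟨ x , y , z ⟩ =
      solve 6 (λ a b c x y z → (b :* z :- c :* y) :* x :+ ((c :* x :- a :* z) :* y :+ (a :* y :- b :* x) :* z)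
        := con (ℤ.+ 0)) refl a b c x y z

    triple-product : ∀ a x y → a ⨯ (x ⨯ y) ≡ ((a ∙ y) • x) ⊟ ((a ∙ x) • y)
    triple-product ⟨ a , b , c ⟩ ⟨ x , y , z ⟩ ⟨ x′ , y′ , z′ ⟩ = V-≡
      (component a b c x y z x′ y′ z′)
      -- The other two coordinates are cyclic shifts of the first, up to the order of the summands
      -- in the dot products.
      (trans (component b c a y z x y′ z′ x′) (cong₂ _-_ (cong (_* y) (rotate b c a y′ z′ x′))
          (cong (_* y′) (rotate b c a y z x))))
      (trans (component c a b z x y z′ x′ y′) (cong₂ _-_ (cong (_* z) (rotate′ c a b z′ x′ y′))
          (cong (_* z′) (rotate′ c a b z x y))))
      where
      component : ∀ a b c x y z x′ y′ z′ →
        b * (x * y′ - y * x′) - c * (z * x′ - x * z′) ≡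
        (a * x′ + (b * y′ + c * z′)) * x - (a * x + (b * y + c * z)) * x′
      component = solve 9 (λ a b c x y z x′ y′ z′ →
        b :* (x :* y′ :- y :* x′) :- c :* (z :* x′ :- x :* z′) :=
        (a :* x′ :+ (b :* y′ :+ c :* z′)) :* x :- (a :* x :+ (b :* y :+ c :* z)) :* x′) refl
      rotate : ∀ b c a y z x → b * y + (c * z + a * x) ≡ a * x + (b * y + c * z)
      rotate = solve 6 (λ b c a y z x → b :* y :+ (c :* z :+ a :* x) := a :* x :+ (b :* y :+ c :* z)) refl
      rotate′ : ∀ c a b z x y → c * z + (a * x + b * y) ≡ a * x + (b * y + c * z)
      rotate′ = solve 6 (λ c a b z x y → c :* z :+ (a :* x :+ b :* y) := a :* x :+ (b :* y :+ c :* z)) refl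

    ⨯-• : ∀ a r z → a ⨯ (r • z) ≡ r • (a ⨯ z)
    ⨯-• ⟨ a , b , c ⟩ r ⟨ x , y , z ⟩ = V-≡ (component b c y z) (component c a z x) (component a b x y)
      where
      component : ∀ b c y z → b * (r * z) - c * (r * y) ≡ r * (b * z - c * y)
      component = λ b c y z → solve 5 (λ r b c y z → b :* (r :* z) :- c :* (r :* y) := r :*
          (b :* z :- c :* y)) refl r b c y z

    •-𝟎 : ∀ {r z} → z ≡ 𝟎 → r • z ≡ 𝟎
    •-𝟎 {r} refl = V-≡ (zeroʳ r) (zeroʳ r) (zeroʳ r)

    ⊥⊥⇒∥ : ∀ {a x y} → a ∙ x ≡ 0# → a ∙ y ≡ 0# → a ⨯ (x ⨯ y) ≡ 𝟎
    ⊥⊥⇒∥ {a} {x} {y} ax≡0 ay≡0 = trans (triple-product a x y)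
      (trans (cong₂ (λ s t → (s • x) ⊟ (t • y)) ay≡0 ax≡0)
          (V-≡ (component (x₁ x) (x₁ y)) (component (x₂ x) (x₂ y)) (component (x₃ x) (x₃ y))))
      where
      component : ∀ x y → 0# * x - 0# * y ≡ 0#
      component x y = trans (cong₂ _-_ (zeroˡ x) (trans (zeroˡ y) refl)) (x≡y⇒x-y≡0 refl)

    -- Points of PG(2,q), and dually its lines, normalised so that the first nonzero coordinate is 1.
    data Pt : Set where
      p₁ : F → F → Pt
      p₂ : F → Pt
      p₃ : Pt

    vec : Pt → V
    vec (p₁ b c) = ⟨ 1# , b , c ⟩
    vec (p₂ c)   = ⟨ 0# , 1# , c ⟩
    vec p₃       = ⟨ 0# , 0# , 1# ⟩

    -- The coordinate in which the normalised representative of the point has its leading 1.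
    pivot : Pt → V → F
    pivot (p₁ _ _) = x₁
    pivot (p₂ _)   = x₂
    pivot p₃       = x₃

    pivot-vec : ∀ x → pivot x (vec x) ≡ 1#
    pivot-vec (p₁ _ _) = refl
    pivot-vec (p₂ _)   = refl
    pivot-vec p₃       = refl

    pivot-𝟎 : ∀ x → pivot x 𝟎 ≡ 0#
    pivot-𝟎 (p₁ _ _) = refl
    pivot-𝟎 (p₂ _)   = refl
    pivot-𝟎 p₃       = refl

    private
      1*-*0 : ∀ y → 1# * 1# - y * 0# ≡ 1#
      1*-*0 y = solve 1 (λ y → con (ℤ.+ 1) :* con (ℤ.+ 1) :- y :* con (ℤ.+ 0) := con (ℤ.+ 1)) refl y
      *0-1* : ∀ y → y * 0# - 1# * 1# ≡ - 1#
      *0-1* y = solve 1 (λ y → y :* con (ℤ.+ 0) :- con (ℤ.+ 1) :* con (ℤ.+ 1) := :- con (ℤ.+ 1)) refl y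
      0*-1* : ∀ y → 0# * y - 1# * 1# ≡ - 1#
      0*-1* y = trans (cong (_- 1# * 1#) (*-comm 0# y)) (*0-1* y)
      1*-0* : ∀ y → 1# * 1# - 0# * y ≡ 1#
      1*-0* y = trans (cong (λ t → 1# * 1# - t) (*-comm 0# y)) (1*-*0 y)
      1≢0 : 1# ≢ 0#
      1≢0 e = 0≢1 (sym e)
      -1≢0 : - 1# ≢ 0#
      -1≢0 e = 1≢0 (trans (solve 0 (con (ℤ.+ 1) := :- (:- con (ℤ.+ 1))) refl)
        (trans (cong -_ e) (solve 0 (:- con (ℤ.+ 0) := con (ℤ.+ 0)) refl)))
      y*1-1*y′ : ∀ {y y′} → y * 1# - 1# * y′ ≡ 0# → y ≡ y′
      y*1-1*y′ {y} {y′} e = x-y≡0⇒x≡y y y′ (trans (cong₂ _-_ (sym (*-identityʳ y)) (sym (*-identityˡ y′))) e)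
      1*y-y′*1 : ∀ {y y′} → 1# * y - y′ * 1# ≡ 0# → y ≡ y′
      1*y-y′*1 {y} {y′} e = x-y≡0⇒x≡y y y′ (trans (cong₂ _-_ (sym (*-identityˡ y)) (sym (*-identityʳ y′))) e)

    -- For different pivots the cross product has an entry 1 or -1; for equal pivots the differences
    -- of the free coordinates are among its entries, up to sign.
    vec-∥ : ∀ x y → vec x ⨯ vec y ≡ 𝟎 → x ≡ y
    vec-∥ (p₁ b c) (p₁ b′ c′) e = cong₂ p₁ (sym (1*y-y′*1 (cong x₃ e))) (y*1-1*y′ (cong x₂ e))
    vec-∥ (p₁ b c) (p₂ c′)    e = contradiction (trans (sym (1*-*0 b)) (cong x₃ e)) 1≢0
    vec-∥ (p₁ b c) p₃         e = contradiction (trans (sym (*0-1* c)) (cong x₂ e)) -1≢0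
    vec-∥ (p₂ c)   (p₁ b′ c′) e = contradiction (trans (sym (0*-1* b′)) (cong x₃ e)) -1≢0
    vec-∥ (p₂ c)   (p₂ c′)    e = cong p₂ (sym (1*y-y′*1 (cong x₁ e)))
    vec-∥ (p₂ c)   p₃         e = contradiction (trans (sym (1*-*0 c)) (cong x₁ e)) 1≢0
    vec-∥ p₃       (p₁ b′ c′) e = contradiction (trans (sym (1*-0* c′)) (cong x₂ e)) 1≢0
    vec-∥ p₃       (p₂ c′)    e = contradiction (trans (sym (0*-1* c′)) (cong x₁ e)) -1≢0
    vec-∥ p₃       p₃         e = refl

    normalise : ∀ z → z ≢ 𝟎 → ∃ λ x → ∃ λ r → vec x ≡ r • z
    normalise z z≢𝟎 with x₁ z ≟ᶠ 0#
    ... | no z₁≢0 = let (r , z₁r≡1) = inverse (x₁ z) z₁≢0 in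
      p₁ (r * x₂ z) (r * x₃ z) , r , V-≡ (trans (sym z₁r≡1) (*-comm _ r)) refl refl
    ... | yes z₁≡0 with x₂ z ≟ᶠ 0#
    ...   | no z₂≢0 = let (r , z₂r≡1) = inverse (x₂ z) z₂≢0 in
      p₂ (r * x₃ z) , r , V-≡ (sym (trans (cong (r *_) z₁≡0) (zeroʳ r))) (trans (sym z₂r≡1) (*-comm _ r)) refl
    ...   | yes z₂≡0 with x₃ z ≟ᶠ 0#
    ...     | no z₃≢0 = let (r , z₃r≡1) = inverse (x₃ z) z₃≢0 in
      p₃ , r , V-≡ (sym (trans (cong (r *_) z₁≡0) (zeroʳ r))) (sym (trans (cong (r *_) z₂≡0) (zeroʳ r)))
                   (trans (sym z₃r≡1) (*-comm _ r))
    ...     | yes z₃≡0 = contradiction (V-≡ z₁≡0 z₂≡0 z₃≡0) z≢𝟎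

    _≟ᴾ_ : DecidableEquality Pt
    p₁ b c ≟ᴾ p₁ b′ c′ = map′ (λ (e , e′) → cong₂ p₁ e e′) (λ { refl → refl , refl })
        ((b ≟ᶠ b′) ×-dec (c ≟ᶠ c′))
    p₁ _ _ ≟ᴾ p₂ _     = no λ ()
    p₁ _ _ ≟ᴾ p₃       = no λ ()
    p₂ _   ≟ᴾ p₁ _ _   = no λ ()
    p₂ c   ≟ᴾ p₂ c′    = map′ (cong p₂) (λ { refl → refl }) (c ≟ᶠ c′)
    p₂ _   ≟ᴾ p₃       = no λ ()
    p₃     ≟ᴾ p₁ _ _   = no λ ()
    p₃     ≟ᴾ p₂ _     = no λ ()
    p₃     ≟ᴾ p₃       = yes refl

    fs : List F
    fs = allFin q

    affine : List Pt
    affine = map (λ (b , c) → p₁ b c) (cartesianProduct fs fs)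

    points : List Pt
    points = affine ++ (map p₂ fs ++ p₃ ∷ [])

    ∑-points : ∀ f → ∑ points f ≡ (∑[ b ← fs ] ∑[ c ← fs ] f (p₁ b c)) ℕ.+ ((∑[ c ← fs ] f (p₂ c)) ℕ.+ f p₃)
    ∑-points f = trans (∑-++ affine _ f) (cong₂ ℕ._+_
      (trans (∑-map (λ (b , c) → p₁ b c) (cartesianProduct fs fs) f)
          (∑-cartesianProduct fs fs (λ (b , c) → f (p₁ b c))))
      (trans (∑-++ (map p₂ fs) (p₃ ∷ []) f) (cong₂ ℕ._+_ (∑-map p₂ fs f) (ℕₚ.+-identityʳ (f p₃)))))

    private
      ∑∑-zero : ∑[ b ← fs ] ∑[ c ← fs ] 0 ≡ 0
      ∑∑-zero = trans (∑-cong fs λ _ → ∑-zero fs) (∑-zero fs)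

      ∑-fs : ∀ c → ∑[ _ ← fs ] c ≡ q ℕ.* c
      ∑-fs c = trans (∑-const fs c) (cong (ℕ._* c) (length-tabulate {n = q} id))

      points-once : ∀ y → ∑[ x ← points ] ⟦ x ≟ᴾ y ⟧ ≡ 1
      points-once (p₁ b c) = trans (∑-points _) (trans (cong₂ ℕ._+_ (trans (∑-cong fs λ b′ → trans
          (trans (∑-cong fs λ c′ → ⟦×⟧ (b′ ≟ᶠ b) (c′ ≟ᶠ c)) (∑-*ˡ fs ⟦ b′ ≟ᶠ b ⟧ _))
          (trans (cong (⟦ b′ ≟ᶠ b ⟧ ℕ.*_) (allFin-once c)) (ℕₚ.*-identityʳ _))) (allFin-once b))
        (cong (ℕ._+ 0) (∑-zero fs))) refl)
      points-once (p₂ c) = trans (∑-points _) (cong₂ ℕ._+_ ∑∑-zero (cong (ℕ._+ 0) (allFin-once c)))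
      points-once p₃     = trans (∑-points _) (cong₂ ℕ._+_ ∑∑-zero (cong (ℕ._+ 1) (∑-zero fs)))

    finPt : Enumeration Pt
    finPt = record { elems = points ; _≟_ = _≟ᴾ_ ; once = points-once }

    length-points : length points ≡ q ℕ.* q ℕ.+ q ℕ.+ 1
    length-points = begin
      length points                  ≡⟨ trans (∑-const points 1) (ℕₚ.*-identityʳ _) ⟨
      ∑[ _ ← points ] 1              ≡⟨ ∑-points (λ _ → 1) ⟩
      (∑[ _ ← fs ] ∑[ _ ← fs ] 1) ℕ.+ ((∑[ _ ← fs ] 1) ℕ.+ 1)
        ≡⟨ cong₂ (λ m n → m ℕ.+ (n ℕ.+ 1)) (trans (∑-cong fs λ _ → ∑-fs 1) (∑-fs (q ℕ.* 1))) (∑-fs 1) ⟩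
      q ℕ.* (q ℕ.* 1) ℕ.+ (q ℕ.* 1 ℕ.+ 1)  ≡⟨ simplify q ⟩
      q ℕ.* q ℕ.+ q ℕ.+ 1            ∎
      where
      open ≡-Reasoning
      simplify : ∀ q → q ℕ.* (q ℕ.* 1) ℕ.+ (q ℕ.* 1 ℕ.+ 1) ≡ q ℕ.* q ℕ.+ q ℕ.+ 1
      simplify = solve-∀

    ⊥? : ∀ a x → Dec (a ∙ x ≡ 0#)
    ⊥? a x = a ∙ x ≟ᶠ 0#

    -- The unique normalised vector orthogonal to x and y is proportional to x ⨯ y.
    ∑-orthogonal : ∀ {x y} → x ⨯ y ≢ 𝟎 → ∑[ a ← points ] (⟦ ⊥? (vec a) x ⟧ ℕ.* ⟦ ⊥? (vec a) y ⟧) ≡ 1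
    ∑-orthogonal {x} {y} x⨯y≢𝟎 with normalise (x ⨯ y) x⨯y≢𝟎
    ... | z , r , vz≡r•x⨯y = trans (∑-cong points λ a → trans (sym (⟦×⟧ (⊥? (vec a) x) (⊥? (vec a) y)))
      (⟦⟧-⇔ (⊥? (vec a) x ×-dec ⊥? (vec a) y) (a ≟ᴾ z)
        (λ (ax≡0 , ay≡0) → vec-∥ a z (trans (cong (vec a ⨯_) vz≡r•x⨯y)
          (trans (⨯-• (vec a) r (x ⨯ y)) (•-𝟎 (⊥⊥⇒∥ ax≡0 ay≡0)))))
        (λ { refl → ⊥-z x (⨯-∙ˡ x y) , ⊥-z y (⨯-∙ʳ x y) }))) (points-once z)
      where
      ⊥-z : ∀ v → (x ⨯ y) ∙ v ≡ 0# → vec z ∙ v ≡ 0#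
      ⊥-z v e = trans (cong (_∙ v) vz≡r•x⨯y) (trans (•-∙ r (x ⨯ y) v) (trans (cong (r *_) e) (zeroʳ r)))

    -- Being orthogonal to `u` and `v`, `vec x` is parallel to `u ⨯ v`, and a multiple of `vec x` is
    -- determined by its pivot coordinate.
    pivot-⨯ : ∀ x {u v} → vec x ∙ u ≡ 0# → vec x ∙ v ≡ 0# → pivot x (u ⨯ v) ≡ 0# → u ⨯ v ≡ 𝟎
    pivot-⨯ x {u} {v} xu xv = cases x (u ⨯ v) (⊥⊥⇒∥ xu xv)
      where
      cases : ∀ x z → vec x ⨯ z ≡ 𝟎 → pivot x z ≡ 0# → z ≡ 𝟎
      cases (p₁ b c) z e z₁≡0 = V-≡ z₁≡0
        (trans (solve 3 (λ b x y → y := con (ℤ.+ 1) :* y :- b :* x :+ b :* x) refl b (x₁ z) (x₂ z))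
          (trans (cong₂ _+_ (cong x₃ e) (trans (cong (b *_) z₁≡0) (zeroʳ b))) (+-identityˡ 0#)))
        (trans (solve 3 (λ c x y → y := c :* x :- (c :* x :- con (ℤ.+ 1) :* y)) refl c (x₁ z) (x₃ z))
          (trans (cong₂ _-_ (trans (cong (c *_) z₁≡0) (zeroʳ c)) (cong x₂ e)) (x≡y⇒x-y≡0 refl)))
      cases (p₂ c) z e z₂≡0 = V-≡
        (trans (solve 2 (λ x y → x := con (ℤ.+ 0) :* y :- (con (ℤ.+ 0) :* y :- con (ℤ.+ 1) :* x)) refl
            (x₁ z) (x₂ z))
          (trans (cong₂ _-_ (zeroˡ _) (cong x₃ e)) (x≡y⇒x-y≡0 refl)))
        z₂≡0
        (trans (solve 3 (λ c x y → y := con (ℤ.+ 1) :* y :- c :* x :+ c :* x) refl c (x₂ z) (x₃ z))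
          (trans (cong₂ _+_ (cong x₁ e) (trans (cong (c *_) z₂≡0) (zeroʳ c))) (+-identityˡ 0#)))
      cases p₃ z e z₃≡0 = V-≡
        (trans (solve 2 (λ x y → x := con (ℤ.+ 1) :* x :- con (ℤ.+ 0) :* y :+ con (ℤ.+ 0) :* y) refl (x₁ z)
            (x₃ z))
          (trans (cong₂ _+_ (cong x₂ e) (zeroˡ _)) (+-identityˡ 0#)))
        (trans (solve 2 (λ x y → x := con (ℤ.+ 0) :* y :- (con (ℤ.+ 0) :* y :- con (ℤ.+ 1) :* x)) refl
            (x₂ z) (x₃ z))
          (trans (cong₂ _-_ (zeroˡ _) (cong x₁ e)) (x≡y⇒x-y≡0 refl)))
        z₃≡0

    infix 4 _on_ _on?_

    _on_ : Pt → Pt → Set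
    x on ℓ = vec ℓ ∙ vec x ≡ 0#

    _on?_ : ∀ x ℓ → Dec (x on ℓ)
    x on? ℓ = ⊥? (vec ℓ) (vec x)

    ∑-joining : ∀ {x y} → x ≢ y → ∑[ ℓ ← points ] (⟦ x on? ℓ ⟧ ℕ.* ⟦ y on? ℓ ⟧) ≡ 1
    ∑-joining {x} {y} x≢y = ∑-orthogonal {vec x} {vec y} (λ e → x≢y (vec-∥ x y e))

    axis : Pt → V
    axis (p₁ _ _) = ⟨ 1# , 0# , 0# ⟩
    axis (p₂ _)   = ⟨ 0# , 1# , 0# ⟩
    axis p₃       = ⟨ 0# , 0# , 1# ⟩

    private
      e₁∙ : ∀ x → x ∙ ⟨ 1# , 0# , 0# ⟩ ≡ x₁ x
      e₁∙ ⟨ a , b , c ⟩ = solve 3 (λ a b c → a :* con (ℤ.+ 1) :+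
          (b :* con (ℤ.+ 0) :+ c :* con (ℤ.+ 0)) := a) refl a b c
      e₂∙ : ∀ x → x ∙ ⟨ 0# , 1# , 0# ⟩ ≡ x₂ x
      e₂∙ ⟨ a , b , c ⟩ = solve 3 (λ a b c → a :* con (ℤ.+ 0) :+
          (b :* con (ℤ.+ 1) :+ c :* con (ℤ.+ 0)) := b) refl a b c
      e₃∙ : ∀ x → x ∙ ⟨ 0# , 0# , 1# ⟩ ≡ x₃ x
      e₃∙ ⟨ a , b , c ⟩ = solve 3 (λ a b c → a :* con (ℤ.+ 0) :+
          (b :* con (ℤ.+ 0) :+ c :* con (ℤ.+ 1)) := c) refl a b c

      axis∙ : ∀ x y → y ∙ axis x ≡ pivot x y
      axis∙ (p₁ _ _) = e₁∙
      axis∙ (p₂ _)   = e₂∙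
      axis∙ p₃       = e₃∙

      ⟦1≟0⟧ : ⟦ 1# ≟ᶠ 0# ⟧ ≡ 0
      ⟦1≟0⟧ = ⟦⟧-no (1# ≟ᶠ 0#) 1≢0
      ⟦0≟0⟧ : ⟦ 0# ≟ᶠ 0# ⟧ ≡ 1
      ⟦0≟0⟧ = ⟦⟧-yes (0# ≟ᶠ 0#) refl

    ∑-axis : ∀ x → ∑[ y ← points ] ⟦ ⊥? (vec y) (axis x) ⟧ ≡ q ℕ.+ 1
    ∑-axis x = trans (∑-cong points λ y → cong (λ t → ⟦ t ≟ᶠ 0# ⟧) (axis∙ x (vec y))) (cases x)
      where
      ∑-0 : ∑[ b ← fs ] ⟦ b ≟ᶠ 0# ⟧ ≡ 1
      ∑-0 = allFin-once 0#
      cases : ∀ x → ∑[ y ← points ] ⟦ pivot x (vec y) ≟ᶠ 0# ⟧ ≡ q ℕ.+ 1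
      cases x@(p₁ _ _) = trans (∑-points (λ y → ⟦ pivot x (vec y) ≟ᶠ 0# ⟧)) (cong₂ ℕ._+_
        (trans (∑-cong fs λ _ → trans (∑-cong fs λ _ → ⟦1≟0⟧) (∑-zero fs)) (∑-zero fs))
        (cong₂ ℕ._+_ (trans (trans (∑-cong fs λ _ → ⟦0≟0⟧) (∑-fs 1)) (ℕₚ.*-identityʳ q)) ⟦0≟0⟧))
      cases x@(p₂ _) = trans (∑-points (λ y → ⟦ pivot x (vec y) ≟ᶠ 0# ⟧)) (cong₂ ℕ._+_
        (trans (∑-cong fs λ b → ∑-fs ⟦ b ≟ᶠ 0# ⟧)
            (trans (∑-*ˡ fs q _) (trans (cong (q ℕ.*_) ∑-0) (ℕₚ.*-identityʳ q))))
        (cong₂ ℕ._+_ (trans (∑-cong fs λ _ → ⟦1≟0⟧) (∑-zero fs)) ⟦0≟0⟧))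
      cases x@p₃ = trans (∑-points (λ y → ⟦ pivot x (vec y) ≟ᶠ 0# ⟧)) (cong₂ ℕ._+_
        (trans (∑-cong fs λ b → ∑-0) (trans (∑-fs 1) (ℕₚ.*-identityʳ q)))
        (cong₂ ℕ._+_ ∑-0 ⟦1≟0⟧))

    -- The lines through x correspond to the points of the line axis x, which misses x.
    ∑-lines-through : ∀ x → ∑[ ℓ ← points ] ⟦ x on? ℓ ⟧ ≡ q ℕ.+ 1
    ∑-lines-through x = begin
      ∑[ ℓ ← points ] ⟦ x on? ℓ ⟧
        ≡⟨ ∑-cong points (λ ℓ → trans (sym (ℕₚ.*-identityʳ _))
            (⟦⟧*-cong (x on? ℓ) (λ x∈ℓ → sym (meets ℓ x∈ℓ)))) ⟩
      ∑[ ℓ ← points ] (⟦ x on? ℓ ⟧ ℕ.* ∑[ y ← points ] (⟦ ⊥? (vec y) (vec ℓ) ⟧ ℕ.* ⟦ ⊥? (vec y) (axis x) ⟧))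
        ≡⟨ ∑-*ˡ-swap points points (λ ℓ → ⟦ x on? ℓ ⟧) _ ⟩
      ∑[ y ← points ] ∑[ ℓ ← points ] (⟦ x on? ℓ ⟧ ℕ.* (⟦ ⊥? (vec y) (vec ℓ) ⟧ ℕ.* ⟦ ⊥? (vec y) (axis x) ⟧))
        ≡⟨ ∑-cong points (λ y → trans (∑-cong points λ ℓ → shuffle ⟦ x on? ℓ ⟧ ⟦ ⊥? (vec y) (vec ℓ) ⟧
            ⟦ ⊥? (vec y) (axis x) ⟧)
             (∑-*ˡ points ⟦ ⊥? (vec y) (axis x) ⟧ _)) ⟩
      ∑[ y ← points ] (⟦ ⊥? (vec y) (axis x) ⟧ ℕ.* ∑[ ℓ ← points ] (⟦ x on? ℓ ⟧ ℕ.* ⟦ ⊥? (vec y) (vec ℓ) ⟧))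
        ≡⟨ ∑-cong points (λ y → trans (⟦⟧*-cong (⊥? (vec y) (axis x)) (joins y)) (ℕₚ.*-identityʳ _)) ⟩
      ∑[ y ← points ] ⟦ ⊥? (vec y) (axis x) ⟧
        ≡⟨ ∑-axis x ⟩
      q ℕ.+ 1 ∎
      where
      open ≡-Reasoning
      shuffle : ∀ a b c → a ℕ.* (b ℕ.* c) ≡ c ℕ.* (a ℕ.* b)
      shuffle = solve-∀
      joins : ∀ y → vec y ∙ axis x ≡ 0# → ∑[ ℓ ← points ] (⟦ x on? ℓ ⟧ ℕ.* ⟦ ⊥? (vec y) (vec ℓ) ⟧) ≡ 1
      joins y y⊥axis = trans
        (∑-cong points λ ℓ → cong (λ t → ⟦ x on? ℓ ⟧ ℕ.* ⟦ t ≟ᶠ 0# ⟧) (∙-comm (vec y) (vec ℓ)))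
        (∑-joining {x} {y} λ { refl → 1≢0 (trans (sym (pivot-vec x)) (trans (sym (axis∙ x (vec x))) y⊥axis)) })
      -- If `vec ℓ` were parallel to `axis x`, the expansion of the triple product of `vec x`,
      -- `vec ℓ` and `axis x`, read at the pivot of `ℓ`, would give 1 = 0.
      meets : ∀ ℓ → x on ℓ → ∑[ y ← points ] (⟦ ⊥? (vec y) (vec ℓ) ⟧ ℕ.* ⟦ ⊥? (vec y) (axis x) ⟧) ≡ 1
      meets ℓ x∈ℓ = ∑-orthogonal {vec ℓ} {axis x} λ ℓ⨯axis≡𝟎 → 1≢0 (begin
        1#
          ≡⟨ 1*-0* (pivot ℓ (axis x)) ⟨
        1# * 1# - 0# * pivot ℓ (axis x)
          ≡⟨ cong₂ (λ s t → s * t - 0# * pivot ℓ (axis x)) (trans (axis∙ x (vec x)) (pivot-vec x))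
              (pivot-vec ℓ) ⟨
        (vec x ∙ axis x) * pivot ℓ (vec ℓ) - 0# * pivot ℓ (axis x)
          ≡⟨ cong (λ t → (vec x ∙ axis x) * pivot ℓ (vec ℓ) - t * pivot ℓ (axis x))
              (trans (∙-comm (vec x) (vec ℓ)) x∈ℓ) ⟨
        (vec x ∙ axis x) * pivot ℓ (vec ℓ) - (vec x ∙ vec ℓ) * pivot ℓ (axis x)
          ≡⟨ pivot-linear ℓ ⟨
        pivot ℓ (((vec x ∙ axis x) • vec ℓ) ⊟ ((vec x ∙ vec ℓ) • axis x))
          ≡⟨ cong (pivot ℓ) (triple-product (vec x) (vec ℓ) (axis x)) ⟨
        pivot ℓ (vec x ⨯ (vec ℓ ⨯ axis x))
          ≡⟨ cong (λ v → pivot ℓ (vec x ⨯ v)) ℓ⨯axis≡𝟎 ⟩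
        pivot ℓ (vec x ⨯ 𝟎)
          ≡⟨ cong (pivot ℓ) (⨯-𝟎 (vec x)) ⟩
        pivot ℓ 𝟎
          ≡⟨ pivot-𝟎 ℓ ⟩
        0# ∎)
        where
        pivot-linear : ∀ ℓ {s t u v} → pivot ℓ ((s • u) ⊟ (t • v)) ≡ s * pivot ℓ u - t * pivot ℓ v
        pivot-linear (p₁ _ _) = refl
        pivot-linear (p₂ _)   = refl
        pivot-linear p₃       = refl
        ⨯-𝟎 : ∀ a → a ⨯ 𝟎 ≡ 𝟎
        ⨯-𝟎 ⟨ a , b , c ⟩ = V-≡ (component b c) (component c a) (component a b)
          where
          component : ∀ y z → y * 0# - z * 0# ≡ 0#
          component = solve 2 (λ y z → y :* con (ℤ.+ 0) :- z :* con (ℤ.+ 0) := con (ℤ.+ 0)) refl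

    Tr : Set
    Tr = F × F

    finTr : Enumeration Tr
    finTr = fin× (finFin q) (finFin q)

    trs : List Tr
    trs = Enumeration.elems finTr

    -- The line in the class ℓ with parameters (b , c) is cut out by a lift of vec ℓ, perturbed by
    -- radical multiples of b and c in the two coordinates other than the pivot.
    seg : Pt → Tr → Pt → F
    seg (p₁ _ _) (b , c) x = b * x₂ (vec x) + c * x₃ (vec x)
    seg (p₂ _)   (b , c) x = b * x₁ (vec x) + c * x₃ (vec x)
    seg p₃       (b , c) x = b * x₁ (vec x) + c * x₂ (vec x)

    cramer : ∀ {u₁ u₂ v₁ v₂} → u₁ * v₂ - u₂ * v₁ ≢ 0# → ∀ s t →
      ∑[ (b , c) ← trs ] (⟦ b * u₁ + c * u₂ ≟ᶠ s ⟧ ℕ.* ⟦ b * v₁ + c * v₂ ≟ᶠ t ⟧) ≡ 1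
    cramer {u₁} {u₂} {v₁} {v₂} δ≢0 s t with inverse _ δ≢0
    ... | δ⁻¹ , δδ⁻¹≡1 = trans (∑-cong trs λ (b , c) → trans
        (sym (⟦×⟧ (b * u₁ + c * u₂ ≟ᶠ s) (b * v₁ + c * v₂ ≟ᶠ t)))
        (⟦⟧-⇔ ((b * u₁ + c * u₂ ≟ᶠ s) ×-dec (b * v₁ + c * v₂ ≟ᶠ t))
            (×-≟ (finFin q) (finFin q) (b , c) (b₀ , c₀))
          (λ { (refl , refl) → cong₂ _,_ (determined (solve 7 (λ b c u₁ u₂ v₁ v₂ i →
                   b :* ((u₁ :* v₂ :- u₂ :* v₁) :* i) :=
                       ((b :* u₁ :+ c :* u₂) :* v₂ :- (b :* v₁ :+ c :* v₂) :* u₂) :* i) refl b c u₁ u₂ v₁ v₂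
                       δ⁻¹))
                 (determined (solve 7 (λ b c u₁ u₂ v₁ v₂ i →
                   c :* ((u₁ :* v₂ :- u₂ :* v₁) :* i) :=
                       ((b :* v₁ :+ c :* v₂) :* u₁ :- (b :* u₁ :+ c :* u₂) :* v₁) :* i) refl b c u₁ u₂ v₁ v₂
                       δ⁻¹)) })
          (λ { refl → sym (determined (solve 7 (λ s t u₁ u₂ v₁ v₂ i → s :* ((u₁ :* v₂ :- u₂ :* v₁) :* i) :=
                        (s :* v₂ :- t :* u₂) :* i :* u₁ :+ (t :* u₁ :- s :* v₁) :* i :* u₂) refl s t u₁ u₂
                            v₁ v₂ δ⁻¹))
                    , sym (determined (solve 7 (λ s t u₁ u₂ v₁ v₂ i → t :* ((u₁ :* v₂ :- u₂ :* v₁) :* i) :=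
                        (s :* v₂ :- t :* u₂) :* i :* v₁ :+ (t :* u₁ :- s :* v₁) :* i :* v₂) refl s t u₁ u₂
                            v₁ v₂ δ⁻¹)) })))
      (Enumeration.once finTr (b₀ , c₀))
      where
      b₀ c₀ : F
      b₀ = (s * v₂ - t * u₂) * δ⁻¹
      c₀ = (t * u₁ - s * v₁) * δ⁻¹
      determined : ∀ {x y} → x * ((u₁ * v₂ - u₂ * v₁) * δ⁻¹) ≡ y → x ≡ y
      determined {x} e = trans (sym (trans (cong (x *_) δδ⁻¹≡1) (*-identityʳ x))) e

    pivot-distinct : ∀ {ℓ x y} → x on ℓ → y on ℓ → x ≢ y → pivot ℓ (vec x ⨯ vec y) ≢ 0#
    pivot-distinct {ℓ} x∈ℓ y∈ℓ x≢y e = x≢y (vec-∥ _ _ (pivot-⨯ ℓ x∈ℓ y∈ℓ e))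

    -- The parameters solve two linear equations whose determinant is the pivot coordinate at `ℓ` of
    -- `vec x ⨯ vec y`, with reversed sign when the pivot is the second coordinate.
    seg-cross : ∀ {ℓ x y} → x on ℓ → y on ℓ → x ≢ y → ∀ s t →
                ∑[ b ← trs ] (⟦ seg ℓ b x ≟ᶠ s ⟧ ℕ.* ⟦ seg ℓ b y ≟ᶠ t ⟧) ≡ 1
    seg-cross {ℓ@(p₁ _ _)} x∈ℓ y∈ℓ x≢y = cramer (pivot-distinct {ℓ} x∈ℓ y∈ℓ x≢y)
    seg-cross {ℓ@(p₂ _)} {x} {y} x∈ℓ y∈ℓ x≢y = cramer λ e → pivot-distinct {ℓ} x∈ℓ y∈ℓ x≢y
      (trans (solve 4 (λ a b c d → a :* b :- c :* d := :- (c :* d :- a :* b)) refl (x₃ (vec x)) (x₁ (vec y))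
          (x₁ (vec x)) (x₃ (vec y)))
        (trans (cong -_ e) (solve 0 (:- con (ℤ.+ 0) := con (ℤ.+ 0)) refl)))
    seg-cross {p₃} x∈ℓ y∈ℓ x≢y = cramer (pivot-distinct {p₃} x∈ℓ y∈ℓ x≢y)

    geometry : Geometry q
    geometry = record
      { Pt    = Pt
      ; finPt = finPt
      ; _on_  = _on_
      ; _on?_ = _on?_
      ; Tr    = Tr
      ; finTr = finTr
      ; seg   = seg
      ; card  = length-points
      ; join  = join
      ; meet  = λ ℓ → trans (∑-cong points λ x → cong (λ t → ⟦ t ≟ᶠ 0# ⟧) (∙-comm (vec ℓ) (vec x)))
          (∑-lines-through ℓ)
      ; cross = λ {ℓ} {x} {y} → seg-cross {ℓ} {x} {y}
      }
      where
      join : ∀ x y → ∑[ ℓ ← points ] (⟦ x on? ℓ ⟧ ℕ.* ⟦ y on? ℓ ⟧) ≡ 1 ℕ.+ q ℕ.* ⟦ x ≟ᴾ y ⟧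
      join x y with x ≟ᴾ y
      ... | no x≢y   = trans (∑-joining {x} {y} x≢y) (cong suc (sym (ℕₚ.*-zeroʳ q)))
      ... | yes refl = trans (∑-cong points λ ℓ → idem (x on? ℓ)) (trans (∑-lines-through x)
                         (trans (ℕₚ.+-comm q 1) (cong suc (sym (ℕₚ.*-identityʳ q)))))
        where
        idem : ∀ {p} {P : Set p} (d : Dec P) → ⟦ d ⟧ ℕ.* ⟦ d ⟧ ≡ ⟦ d ⟧
        idem (yes _) = refl
        idem (no _)  = refl

    -- The translation a ↦ a + 1 is then a fixed-point-free involution.
    2≡0⇒2∣q : 1# + 1# ≡ 0# → 2 ∣ q
    2≡0⇒2∣q 2≡0 = divides (∑ fs ascends) (begin
      q
        ≡⟨ trans (∑-fs 1) (ℕₚ.*-identityʳ q) ⟨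
      ∑[ a ← fs ] 1
        ≡⟨ ∑-cong fs either ⟨
      ∑[ a ← fs ] (ascends a ℕ.+ ⟦ toℕ (σ a) ℕₚ.<? toℕ a ⟧)
        ≡⟨ ∑-+ fs _ _ ⟩
      ∑ fs ascends ℕ.+ ∑[ a ← fs ] ⟦ toℕ (σ a) ℕₚ.<? toℕ a ⟧
        ≡⟨ cong (∑ fs ascends ℕ.+_) (trans
             (∑-cong fs λ a → cong (λ b → ⟦ toℕ (σ a) ℕₚ.<? toℕ b ⟧) (sym (σσ a)))
             (∑-reindex (finFin q) σ σ σσ σσ ascends)) ⟩
      ∑ fs ascends ℕ.+ ∑ fs ascends
        ≡⟨ double (∑ fs ascends) ⟩
      ∑ fs ascends ℕ.* 2 ∎)
      where
      open ≡-Reasoning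
      double : ∀ n → n ℕ.+ n ≡ n ℕ.* 2
      double = solve-∀
      σ : F → F
      σ a = a + 1#
      ascends : F → ℕ
      ascends a = ⟦ toℕ a ℕₚ.<? toℕ (σ a) ⟧
      σσ : ∀ a → σ (σ a) ≡ a
      σσ a = trans (+-assoc a 1# 1#) (trans (cong (a +_) 2≡0) (+-identityʳ a))
      σ-moves : ∀ a → σ a ≢ a
      σ-moves a e = 1≢0 (trans (solve 2 (λ a o → o := a :+ o :- a) refl a 1#) (x≡y⇒x-y≡0 e))
      either : ∀ a → ⟦ toℕ a ℕₚ.<? toℕ (σ a) ⟧ ℕ.+ ⟦ toℕ (σ a) ℕₚ.<? toℕ a ⟧ ≡ 1
      either a with ℕₚ.<-cmp (toℕ a) (toℕ (σ a))
      ... | tri< lt _ gt = cong₂ ℕ._+_ (⟦⟧-yes (toℕ a ℕₚ.<? toℕ (σ a)) lt) (⟦⟧-no (toℕ (σ a) ℕₚ.<? toℕ a) gt)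
      ... | tri> lt _ gt = cong₂ ℕ._+_ (⟦⟧-no (toℕ a ℕₚ.<? toℕ (σ a)) lt) (⟦⟧-yes (toℕ (σ a) ℕₚ.<? toℕ a) gt)
      ... | tri≈ _ e _   = contradiction (sym (Finₚ.toℕ-injective e)) (σ-moves a)

    private
      -- The expansion of a 3 × 3 determinant along a row that occurs twice.
      repeated₁ : ∀ u u′ v v′ w w′ → (v * w′ - v′ * w) * u + (w * u′ - w′ * u) * v + (u * v′ - u′ * v) * w ≡ 0#
      repeated₁ = solve 6 (λ u u′ v v′ w w′ →
        (v :* w′ :- v′ :* w) :* u :+ (w :* u′ :- w′ :* u) :* v :+ (u :* v′ :- u′ :* v) :* w := con (ℤ.+ 0)) refl
      repeated₂ : ∀ u u′ v v′ w w′ → (v * w′ - v′ * w) * u′ + (w * u′ - w′ * u) * v′ +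
          (u * v′ - u′ * v) * w′ ≡ 0#
      repeated₂ = solve 6 (λ u u′ v v′ w w′ →
        (v :* w′ :- v′ :* w) :* u′ :+ (w :* u′ :- w′ :* u) :* v′ :+ (u :* v′ :- u′ :* v) :* w′ := con
            (ℤ.+ 0)) refl

    -- The coefficients are the 2 × 2 minors in the two coordinates other than the pivot; the
    -- combination therefore vanishes in these two and has the determinant of u, v, w at the pivot.
    cyclic : Pt → V → V → V → V
    cyclic x u v w = ((pivot x (v ⨯ w) • u) ⊞ (pivot x (w ⨯ u) • v)) ⊞ (pivot x (u ⨯ v) • w)

    cyclic-∙ : ∀ x u v w y → cyclic x u v w ∙ y ≡
               pivot x (v ⨯ w) * (u ∙ y) + pivot x (w ⨯ u) * (v ∙ y) + pivot x (u ⨯ v) * (w ∙ y)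
    cyclic-∙ x u v w y = generic (pivot x (v ⨯ w)) (pivot x (w ⨯ u)) (pivot x (u ⨯ v))
      where
      generic : ∀ l m n → (((l • u) ⊞ (m • v)) ⊞ (n • w)) ∙ y ≡ l * (u ∙ y) + m * (v ∙ y) + n * (w ∙ y)
      generic l m n = trans (⊞-∙ ((l • u) ⊞ (m • v)) (n • w) y) (cong₂ _+_
        (trans (⊞-∙ (l • u) (m • v) y) (cong₂ _+_ (•-∙ l u y) (•-∙ m v y))) (•-∙ n w y))

    cyclic-axis : ∀ x u v w → ∃ λ δ → cyclic x u v w ≡ δ • axis x
    cyclic-axis (p₁ _ _) u v w = _ , V-≡ (sym (*-identityʳ _))
      (trans (repeated₁ (x₂ u) (x₃ u) (x₂ v) (x₃ v) (x₂ w) (x₃ w)) (sym (zeroʳ _)))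
      (trans (repeated₂ (x₂ u) (x₃ u) (x₂ v) (x₃ v) (x₂ w) (x₃ w)) (sym (zeroʳ _)))
    cyclic-axis (p₂ _) u v w = _ , V-≡
      (trans (repeated₂ (x₃ u) (x₁ u) (x₃ v) (x₁ v) (x₃ w) (x₁ w)) (sym (zeroʳ _)))
      (sym (*-identityʳ _))
      (trans (repeated₁ (x₃ u) (x₁ u) (x₃ v) (x₁ v) (x₃ w) (x₁ w)) (sym (zeroʳ _)))
    cyclic-axis p₃ u v w = _ , V-≡
      (trans (repeated₁ (x₁ u) (x₂ u) (x₁ v) (x₂ v) (x₁ w) (x₂ w)) (sym (zeroʳ _)))
      (trans (repeated₂ (x₁ u) (x₂ u) (x₁ v) (x₂ v) (x₁ w) (x₂ w)) (sym (zeroʳ _)))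
      (sym (*-identityʳ _))

    -- Pairing `cyclic` with `vec x`, whose pivot entry is 1, isolates the factor δ, which must then
    -- be 0. This gives a dependency between three forms vanishing on `x` with explicit
    -- coefficients.
    cyclic-⊥ : ∀ x {u v w} → u ∙ vec x ≡ 0# → v ∙ vec x ≡ 0# → w ∙ vec x ≡ 0# → ∀ y →
      pivot x (v ⨯ w) * (u ∙ y) + pivot x (w ⨯ u) * (v ∙ y) + pivot x (u ⨯ v) * (w ∙ y) ≡ 0#
    cyclic-⊥ x {u} {v} {w} ux vx wx y with cyclic-axis x u v w
    ... | δ , e = begin
      pivot x (v ⨯ w) * (u ∙ y) + pivot x (w ⨯ u) * (v ∙ y) + pivot x (u ⨯ v) * (w ∙ y)
        ≡⟨ trans (sym (cyclic-∙ x u v w y)) (trans (cong (_∙ y) e) (•-∙ δ (axis x) y)) ⟩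
      δ * (axis x ∙ y)   ≡⟨ cong (_* (axis x ∙ y)) δ≡0 ⟩
      0# * (axis x ∙ y)  ≡⟨ zeroˡ _ ⟩
      0#                 ∎
      where
      open ≡-Reasoning
      vanishes : ∀ l m n → l * 0# + m * 0# + n * 0# ≡ 0#
      vanishes = solve 3 (λ l m n → l :* con (ℤ.+ 0) :+ m :* con (ℤ.+ 0) :+ n :* con (ℤ.+ 0) := con (ℤ.+ 0))
          refl
      δ≡0 : δ ≡ 0#
      δ≡0 = begin
        δ                       ≡⟨ *-identityʳ δ ⟨
        δ * 1#                  ≡⟨ cong (δ *_)
            (trans (∙-comm (axis x) (vec x)) (trans (axis∙ x (vec x)) (pivot-vec x))) ⟨
        δ * (axis x ∙ vec x)    ≡⟨ trans (cong (_∙ vec x) e) (•-∙ δ (axis x) (vec x)) ⟨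
        cyclic x u v w ∙ vec x  ≡⟨ cyclic-∙ x u v w (vec x) ⟩
        pivot x (v ⨯ w) * (u ∙ vec x) + pivot x (w ⨯ u) * (v ∙ vec x) + pivot x (u ⨯ v) * (w ∙ vec x)
          ≡⟨ cong₂ _+_ (cong₂ _+_ (cong (pivot x (v ⨯ w) *_) ux) (cong (pivot x (w ⨯ u) *_) vx))
              (cong (pivot x (u ⨯ v) *_) wx) ⟩
        pivot x (v ⨯ w) * 0# + pivot x (w ⨯ u) * 0# + pivot x (u ⨯ v) * 0#
          ≡⟨ vanishes (pivot x (v ⨯ w)) (pivot x (w ⨯ u)) (pivot x (u ⨯ v)) ⟩
        0# ∎

    private
      doubled : ∀ l m n α β γ → l * 0# + m * β + n * γ ≡ 0# → l * α + m * 0# + n * γ ≡ 0# →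
                l * α + m * β + n * 0# ≡ 0# → n * γ * (1# + 1#) ≡ 0#
      doubled l m n α β γ e f h = trans
        (solve 6 (λ l m n α β γ → n :* γ :* (con (ℤ.+ 1) :+ con (ℤ.+ 1)) :=
          (l :* con (ℤ.+ 0) :+ m :* β :+ n :* γ) :+ (l :* α :+ m :* con (ℤ.+ 0) :+ n :* γ) :-
          (l :* α :+ m :* β :+ n :* con (ℤ.+ 0))) refl l m n α β γ)
        (trans (cong₂ _-_ (cong₂ _+_ e f) h) (solve 0
            ((con (ℤ.+ 0) :+ con (ℤ.+ 0)) :- con (ℤ.+ 0) := con (ℤ.+ 0)) refl))

    -- Three linear forms vanishing on x are dependent; evaluating the dependency on the sides
    -- b - a, c - a, d - a of the parallelogram gives 2 = 0.
    parallelogram-char2 : ∀ x {ℓ₂ ℓ₃ ℓ₄} (a b c d : V) → x on ℓ₂ → x on ℓ₃ → x on ℓ₄ →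
      let _at_ = λ ℓ v → vec ℓ ∙ v in
      ℓ₂ at a ≡ ℓ₂ at b → ℓ₂ at c ≡ ℓ₂ at d →
      ℓ₃ at a ≡ ℓ₃ at c → ℓ₃ at b ≡ ℓ₃ at d → ℓ₃ at a ≢ ℓ₃ at b →
      ℓ₄ at a ≡ ℓ₄ at d → ℓ₄ at b ≡ ℓ₄ at c → ℓ₄ at a ≢ ℓ₄ at b → 1# + 1# ≡ 0#
    parallelogram-char2 x {ℓ₂} {ℓ₃} {ℓ₄} a b c d x∈ℓ₂ x∈ℓ₃ x∈ℓ₄ e₂ f₂ e₃ f₃ n₃ e₄ f₄ n₄ =
      x*y≡0⇒y≡0 {μ₄ * γ} nonzero (doubled μ₂ μ₃ μ₄ α β γ
        (side b (at ℓ₂ b (sym e₂)) refl refl)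
        (side c refl (at ℓ₃ c (sym e₃)) (cong (_- h₄ a) f₄))
        (side d (cong (_- h₂ a) f₂) (cong (_- h₃ a) f₃) (at ℓ₄ d (sym e₄))))
      where
      h₂ h₃ h₄ : V → F
      h₂ v = vec ℓ₂ ∙ v
      h₃ v = vec ℓ₃ ∙ v
      h₄ v = vec ℓ₄ ∙ v
      α β γ : F
      α = h₂ c - h₂ a
      β = h₃ b - h₃ a
      γ = h₄ b - h₄ a
      μ₂ μ₃ μ₄ : F
      μ₂ = pivot x (vec ℓ₃ ⨯ vec ℓ₄)
      μ₃ = pivot x (vec ℓ₄ ⨯ vec ℓ₂)
      μ₄ = pivot x (vec ℓ₂ ⨯ vec ℓ₃)
      dependency : ∀ v → μ₂ * h₂ v + μ₃ * h₃ v + μ₄ * h₄ v ≡ 0#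
      dependency = cyclic-⊥ x {vec ℓ₂} {vec ℓ₃} {vec ℓ₄} x∈ℓ₂ x∈ℓ₃ x∈ℓ₄
      at : ∀ ℓ v → vec ℓ ∙ v ≡ vec ℓ ∙ a → 0# ≡ vec ℓ ∙ v - vec ℓ ∙ a
      at _ _ e = sym (x≡y⇒x-y≡0 e)
      side : ∀ v {s t r} → s ≡ h₂ v - h₂ a → t ≡ h₃ v - h₃ a → r ≡ h₄ v - h₄ a → μ₂ * s + μ₃ * t + μ₄ * r ≡ 0#
      side v refl refl refl = trans (cong₂ _+_ (cong₂ _+_
        (cong (μ₂ *_) (sym (∙-⊟ (vec ℓ₂) v a))) (cong (μ₃ *_) (sym (∙-⊟ (vec ℓ₃) v a))))
            (cong (μ₄ *_) (sym (∙-⊟ (vec ℓ₄) v a))))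
        (dependency (v ⊟ a))
      -- Otherwise ℓ₂ = ℓ₃, and then `e₂` contradicts `n₃`.
      μ₄≢0 : μ₄ ≢ 0#
      μ₄≢0 e = n₃ (subst (λ ℓ → vec ℓ ∙ a ≡ vec ℓ ∙ b)
        (vec-∥ ℓ₂ ℓ₃ (pivot-⨯ x {vec ℓ₂} {vec ℓ₃} (trans (∙-comm (vec x) (vec ℓ₂)) x∈ℓ₂)
            (trans (∙-comm (vec x) (vec ℓ₃)) x∈ℓ₃) e)) e₂)
      nonzero : μ₄ * γ ≢ 0#
      nonzero e = n₄ (sym (x-y≡0⇒x≡y (h₄ b) (h₄ a) (x*y≡0⇒y≡0 μ₄≢0 e)))

  -- Arcs from positions inside the neighbour classes

  module FieldArc {q} (𝔽 : FiniteField q) where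
    open FieldPlane 𝔽
    open CommutativeRing (FiniteField.commutativeRing 𝔽) using
        (0#; +-identityˡ; +-abelianGroup; _-_) renaming (_*_ to _·_; _+_ to _⊕_)
    open AbelianGroupₚ +-abelianGroup using () renaming (x∙y⁻¹≈ε⇒x≈y to x-y≡0⇒x≡y; x≈y⇒x∙y⁻¹≈ε to x≡y⇒x-y≡0)

    -- W i is the position of the i-th point inside its neighbour class.
    field-arc : ∀ {k} (cls : Fin k → Pt) (W : Fin k → V) (g : Fin k → Pt → F) →
      (∀ ℓ b → ∑[ i ← allFin k ] (⟦ cls i on? ℓ ⟧ ℕ.* ⟦ g i ℓ ≟ᶠ seg ℓ b (cls i) ⟧) ℕ.≤ 3) →
      (∀ {i j ℓ} → cls i ≡ cls j → cls i on ℓ → g i ℓ ≡ g j ℓ → vec ℓ ∙ W i ≡ vec ℓ ∙ W j) →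
      (∀ {i j ℓ} → cls i ≡ cls j → cls i on ℓ → vec ℓ ∙ W i ≡ vec ℓ ∙ W j → g i ℓ ≡ g j ℓ) →
      (∀ {i j} → i ≢ j → cls i ≡ cls j → vec (cls i) ⨯ (W i ⊟ W j) ≢ 𝟎) →
      Arc geometry k
    field-arc cls W g ≤3 g⇒W W⇒g apart = record
      { cls = cls
      ; g   = g
      ; ≤3  = ≤3
      -- The direction joining two points of a class is the unique one orthogonal both to the class
      -- and to the difference of their positions.
      ; separated = λ {i} {j} i≢j e → trans
          (∑-cong points λ ℓ → ⟦⟧*-cong (cls i on? ℓ) λ i∈ℓ → ⟦⟧-⇔ (g j ℓ ≟ᶠ g i ℓ) (⊥? (vec ℓ) (W i ⊟ W j))
            (λ gj≡gi → trans (∙-⊟ (vec ℓ) (W i) (W j)) (x≡y⇒x-y≡0 (g⇒W e i∈ℓ (sym gj≡gi))))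
            (λ ⊥ → sym (W⇒g e i∈ℓ (x-y≡0⇒x≡y _ _ (trans (sym (∙-⊟ (vec ℓ) (W i) (W j))) ⊥)))))
          (∑-orthogonal (apart i≢j e))
      ; parallelogram = λ a b c d {ℓ₂} {ℓ₃} {ℓ₄} a≡b a≡c a≡d ∈ℓ₂ ∈ℓ₃ ∈ℓ₄ e₂ f₂ n₂ e₃ f₃ n₃ e₄ f₄ n₄ →
          2≡0⇒2∣q (parallelogram-char2 (cls a) {ℓ₂} {ℓ₃} {ℓ₄} (W a) (W b) (W c) (W d) ∈ℓ₂ ∈ℓ₃ ∈ℓ₄
            (g⇒W a≡b ∈ℓ₂ e₂) (g⇒W (trans (sym a≡c) a≡d) (subst (_on ℓ₂) a≡c ∈ℓ₂) f₂)
            (g⇒W a≡c ∈ℓ₃ e₃) (g⇒W (trans (sym a≡b) a≡d) (subst (_on ℓ₃) a≡b ∈ℓ₃) f₃) (λ e → n₃ (W⇒g a≡b ∈ℓ₃ e))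
            (g⇒W a≡d ∈ℓ₄ e₄) (g⇒W (trans (sym a≡b) a≡c) (subst (_on ℓ₄) a≡b ∈ℓ₄) f₄) (λ e → n₄ (W⇒g a≡b ∈ℓ₄ e)))
      }

    open IntegerCoefficients (FiniteField.commutativeRing 𝔽) using (solve; _:=_; _:+_; _:*_; _:-_; con)

    private
      x-0 : ∀ y → y - 0# ≡ y
      x-0 = solve 1 (λ y → y :- con (ℤ.+ 0) := y) refl

    ∥-vec : ∀ x d → vec x ⨯ d ≡ 𝟎 → d ≡ pivot x d • vec x
    ∥-vec (p₁ b c) ⟨ x , y , z ⟩ e = V-≡
      (solve 1 (λ x → x := x :* con (ℤ.+ 1)) refl x)
      (trans (solve 3 (λ b x y → y := con (ℤ.+ 1) :* y :- b :* x :+ x :* b) refl b x y)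
        (trans (cong (_⊕ x · b) (cong x₃ e)) (+-identityˡ _)))
      (trans (solve 3 (λ c x z → z := x :* c :- (c :* x :- con (ℤ.+ 1) :* z)) refl c x z)
        (trans (cong (λ t → x · c - t) (cong x₂ e)) (x-0 _)))
    ∥-vec (p₂ c) ⟨ x , y , z ⟩ e = V-≡
      (trans (solve 2 (λ x y → x := y :* con (ℤ.+ 0) :- (con (ℤ.+ 0) :* y :- con (ℤ.+ 1) :* x)) refl x y)
        (trans (cong (λ t → y · 0# - t) (cong x₃ e)) (x-0 _)))
      (solve 1 (λ x → x := x :* con (ℤ.+ 1)) refl y)
      (trans (solve 3 (λ c y z → z := con (ℤ.+ 1) :* z :- c :* y :+ y :* c) refl c y z)
        (trans (cong (_⊕ y · c) (cong x₁ e)) (+-identityˡ _)))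
    ∥-vec p₃ ⟨ x , y , z ⟩ e = V-≡
      (trans (solve 2 (λ x z → x := con (ℤ.+ 1) :* x :- con (ℤ.+ 0) :* z :+ z :* con (ℤ.+ 0)) refl x z)
        (trans (cong (_⊕ z · 0#) (cong x₂ e)) (+-identityˡ _)))
      (trans (solve 2 (λ y z → y := z :* con (ℤ.+ 0) :- (con (ℤ.+ 0) :* z :- con (ℤ.+ 1) :* y)) refl y z)
        (trans (cong (λ t → z · 0# - t) (cong x₁ e)) (x-0 _)))
      (solve 1 (λ x → x := x :* con (ℤ.+ 1)) refl z)

open Planes using (FiniteField; module FieldPlane; module FieldArc)

-- The residue field and a generator of the radical

module ResidueField {c ℓ q} (chain : ChainRing₂ c ℓ q) where
  import Algebra.Morphism.RingMonomorphism as RingMonomorphism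
  open import Function.Bundles using (Inverse; Injection)
  open import Function.Properties.Inverse using (Inverse⇒Injection)
  open import Relation.Binary.PropositionalEquality as ≡ using (_≡_; _≢_)
  open import Data.List.Relation.Unary.Enumerates.Setoid using (IsEnumeration)

  open ChainRing₂ chain using (ring; finite; residue; 0⊂rad; rad⊂R; rad²≈0; left-chain; right-chain) public
  open Ring ring hiding (zero) public
  open AbelianGroupₚ +-abelianGroup public
    using () renaming (x∙y⁻¹≈ε⇒x≈y to x-y≈0⇒x≈y; x≈y⇒x∙y⁻¹≈ε to x≈y⇒x-y≈0; ε⁻¹≈ε to -0≈0)
  open Ringₚ ring public using (-‿distribˡ-*; -‿distribʳ-*; x[y-z]≈xy-xz; [y-z]x≈yx-zx)
  open import Relation.Binary.Reasoning.Setoid setoid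

  Rad : Carrier → Set _
  Rad = rad ring

  Rad-resp : ∀ {x y} → x ≈ y → Rad x → Rad y
  Rad-resp x≈y x∈ I max = LeftIdeal.resp I x≈y (x∈ I max)

  R̄ : CommutativeRing _ _
  R̄ = record { isCommutativeRing = IsFieldOfOrder.isCommutativeRing residue }

  private module R̄ = CommutativeRing R̄

  order : HasOrder R̄.setoid q
  order = IsFieldOfOrder.order residue

  to : Carrier → Fin q
  to = Inverse.to order

  from : Fin q → Carrier
  from = Inverse.from order

  to-from : ∀ a → to (from a) ≡ a
  to-from = Inverse.strictlyInverseˡ order

  from-to : ∀ x → Rad (from (to x) - x)
  from-to = Inverse.strictlyInverseʳ order

  Rad⇒to≡ : ∀ {x y} → Rad (x - y) → to x ≡ to y
  Rad⇒to≡ = Inverse.to-cong order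

  to≡⇒Rad : ∀ {x y} → to x ≡ to y → Rad (x - y)
  to≡⇒Rad = Injection.injective (Inverse⇒Injection order)

  -- R / rad R moved onto `Fin q`. The map `from` is a monomorphism into the quotient, and along it
  -- the ring laws are pulled back.
  rawField : RawRing _ _
  rawField = record
    { Carrier = Fin q
    ; _≈_ = _≡_
    ; _+_ = λ a b → to (from a + from b)
    ; _*_ = λ a b → to (from a * from b)
    ; -_  = λ a → to (- from a)
    ; 0#  = to 0#
    ; 1#  = to 1#
    }

  𝔽-isCommutativeRing : IsCommutativeRing _≡_ (RawRing._+_ rawField) (RawRing._*_ rawField)
      (RawRing.-_ rawField) (to 0#) (to 1#)
  𝔽-isCommutativeRing = RingMonomorphism.isCommutativeRing {R₁ = rawField} {R₂ = R/rad ring} {from} (record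
    { isRingHomomorphism = record
      { isSemiringHomomorphism = record
        { isNearSemiringHomomorphism = record
          { +-isMonoidHomomorphism = record
            { isMagmaHomomorphism = record
              { isRelHomomorphism = record { cong = Inverse.from-cong order }
              ; homo = λ a b → from-to (from a + from b)
              }
            ; ε-homo = from-to 0#
            }
          ; *-homo = λ a b → from-to (from a * from b)
          }
        ; 1#-homo = from-to 1#
        }
      ; -‿homo = λ a → from-to (- from a)
      }
    ; injective = λ {a} {b} e → ≡.trans (≡.sym (to-from a)) (≡.trans (Rad⇒to≡ e) (to-from b))
    }) (IsFieldOfOrder.isCommutativeRing residue)

  private
    R̄-from-to : ∀ x → R̄._≈_ x (from (to x))
    R̄-from-to x = R̄.sym (from-to x)

  to-+ : ∀ x y → to (x + y) ≡ to (from (to x) + from (to y))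
  to-+ x y = Rad⇒to≡ (R̄.+-cong (R̄-from-to x) (R̄-from-to y))

  to-* : ∀ x y → to (x * y) ≡ to (from (to x) * from (to y))
  to-* x y = Rad⇒to≡ (R̄.*-cong (R̄-from-to x) (R̄-from-to y))

  to-cong : ∀ {x y} → x ≈ y → to x ≡ to y
  to-cong x≈y = Rad⇒to≡ (R̄.trans (R̄.reflexive ≡.refl) (≈⇒R̄ x≈y))
    where
    ≈⇒R̄ : ∀ {x y} → x ≈ y → Rad (x - y)
    ≈⇒R̄ x≈y I max = LeftIdeal.resp I (sym (x≈y⇒x-y≈0 x≈y)) (LeftIdeal.0∈ I)

  to≡0⇒Rad : ∀ {x} → to x ≡ to 0# → Rad x
  to≡0⇒Rad {x} e = Rad-resp (trans (+-congˡ -0≈0) (+-identityʳ x)) (to≡⇒Rad e)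

  Rad⇒to≡0 : ∀ {x} → Rad x → to x ≡ to 0#
  Rad⇒to≡0 {x} x∈ = Rad⇒to≡ (Rad-resp (sym (trans (+-congˡ -0≈0) (+-identityʳ x))) x∈)

  𝔽 : FiniteField q
  𝔽 = record
    { isCommutativeRing = 𝔽-isCommutativeRing
    ; 0≢1     = λ e → IsFieldOfOrder.0≉1 residue (to≡⇒Rad e)
    ; inverse = λ a a≢0 → let (y , ay≈1) = IsFieldOfOrder.inverse residue (from a)
                                             (λ e → a≢0 (≡.trans (≡.sym (to-from a)) (Rad⇒to≡ e))) in
        to y , Rad⇒to≡ (R̄.trans (R̄.*-congˡ (from-to y)) ay≈1)
    }

  module 𝔽 = CommutativeRing (FiniteField.commutativeRing 𝔽)

  -- As an intersection of left ideals the radical is not visibly closed under multiplication from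
  -- the right; multiplicativity of the residue map provides this.
  Rad-*ˡ : ∀ {x} y → Rad x → Rad (x * y)
  Rad-*ˡ {x} y x∈ = to≡0⇒Rad (≡.trans (to-* x y) (≡.trans (≡.cong (𝔽._* to y) (Rad⇒to≡0 x∈)) (𝔽.zeroˡ (to y))))

  Rad-*ʳ : ∀ x {y} → Rad y → Rad (x * y)
  Rad-*ʳ x {y} y∈ = to≡0⇒Rad (≡.trans (to-* x y) (≡.trans (≡.cong (to x 𝔽.*_) (Rad⇒to≡0 y∈)) (𝔽.zeroʳ (to x))))

  -- A residual inverse gives x y = 1 + e with e in the radical, and (1 + e)(1 - e) = 1 because e² =
  -- 0.
  right-inverse : ∀ x → to x ≢ to 0# → ∃ λ y → x * y ≈ 1#
  right-inverse x x≢0 = let (y , xy≈1) = IsFieldOfOrder.inverse residue x (λ e → x≢0 (Rad⇒to≡ e))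
                            e = x * y - 1# in
    y * (1# - e) , (begin
      x * (y * (1# - e))    ≈⟨ *-assoc x y (1# - e) ⟨
      x * y * (1# - e)      ≈⟨ *-congʳ (recover (x * y)) ⟩
      (e + 1#) * (1# - e)   ≈⟨ distribʳ (1# - e) e 1# ⟩
      e * (1# - e) + 1# * (1# - e)
        ≈⟨ +-cong (trans (x[y-z]≈xy-xz e 1# e) (+-cong (*-identityʳ e) (-‿cong (rad²≈0 xy≈1 xy≈1))))
            (*-identityˡ _) ⟩
      (e - 0#) + (1# - e)   ≈⟨ +-cong (trans (+-congˡ -0≈0) (+-identityʳ e)) (+-comm 1# (- e)) ⟩
      e + (- e + 1#)        ≈⟨ +-assoc e (- e) 1# ⟨
      e - e + 1#            ≈⟨ +-congʳ (-‿inverseʳ e) ⟩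
      0# + 1#               ≈⟨ +-identityˡ 1# ⟩
      1#                    ∎)
    where
    recover : ∀ z → z ≈ (z - 1#) + 1#
    recover z = sym (trans (+-assoc z (- 1#) 1#) (trans (+-congˡ (-‿inverseˡ 1#)) (+-identityʳ z)))

  to-1-unit : ∀ {x y} → x * y ≈ 1# → to y ≢ to 0#
  to-1-unit {x} {y} xy≈1 y≡0 = FiniteField.0≢1 𝔽
      (≡.sym (≡.trans (to-cong (sym xy≈1)) (Rad⇒to≡0 (Rad-*ʳ x (to≡0⇒Rad y≡0)))))

  unit : ∀ x → to x ≢ to 0# → ∃ λ y → x * y ≈ 1# × y * x ≈ 1#
  unit x x≢0 = let (y , xy≈1) = right-inverse x x≢0
                   (z , yz≈1) = right-inverse y (to-1-unit xy≈1) in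
    y , xy≈1 , (begin
      y * x             ≈⟨ *-identityʳ (y * x) ⟨
      y * x * 1#        ≈⟨ *-congˡ yz≈1 ⟨
      y * x * (y * z)   ≈⟨ *-assoc (y * x) y z ⟨
      y * x * y * z     ≈⟨ *-congʳ (*-assoc y x y) ⟩
      y * (x * y) * z   ≈⟨ *-congʳ (trans (*-congˡ xy≈1) (*-identityʳ y)) ⟩
      y * z             ≈⟨ yz≈1 ⟩
      1#                ∎)

  infix 4 _≟ᴿ_
  _≟ᴿ_ : ∀ x y → Dec (x ≈ y)
  x ≟ᴿ y = map′ (Injection.injective (Inverse⇒Injection inv)) (Inverse.to-cong inv)
             (Inverse.to inv x Finₚ.≟ Inverse.to inv y)
    where inv = proj₂ finite

  enumeration : IsEnumeration setoid (Finite.enum finite)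
  enumeration = Finite.enum-complete finite

  -- The hypothesis `0⊂rad` merely refutes that the radical is 0, so an element is extracted by
  -- finite search, with membership in the radical decided through `to`.
  uniformiser : ∃ λ π → Rad π × ¬ (π ≈ 0#)
  uniformiser with Finite.∃? setoid enumeration
      {P = λ x → to x ≡ to 0# × ¬ (x ≈ 0#)}
      (λ x≈y (e , ¬0) → ≡.trans (to-cong (sym x≈y)) e , λ y≈0 → ¬0 (trans x≈y y≈0))
      (λ x → (to x Finₚ.≟ to 0#) ×-dec ¬? (x ≟ᴿ 0#))
  ... | yes (π , e , ¬0) = π , to≡0⇒Rad e , ¬0
  ... | no none = contradiction (λ {x} x∈ → decidable-stable (x ≟ᴿ 0#) λ x≉0 → none (x , Rad⇒to≡0 x∈ , x≉0))
      (proj₂ 0⊂rad)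

  π : Carrier
  π = proj₁ uniformiser

  π∈Rad : Rad π
  π∈Rad = proj₁ (proj₂ uniformiser)

  π≉0 : ¬ (π ≈ 0#)
  π≉0 = proj₂ (proj₂ uniformiser)

  1∉Rad : ¬ Rad 1#
  1∉Rad 1∈ = proj₂ rad⊂R λ {x} _ → Rad-resp (*-identityˡ x) (Rad-*ˡ x 1∈)

  private
    π*? : ∀ x → Dec (∃ λ r → π * r ≈ x)
    π*? x = Finite.∃? setoid enumeration (λ r≈s e → trans (*-congˡ (sym r≈s)) e) (λ r → π * r ≟ᴿ x)

    *π? : ∀ x → Dec (∃ λ r → r * π ≈ x)
    *π? x = Finite.∃? setoid enumeration (λ r≈s e → trans (*-congʳ (sym r≈s)) e) (λ r → r * π ≟ᴿ x)

    πR : RightIdeal ring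
    πR = record
      { Mem      = λ x → True (π*? x)
      ; mem?     = λ x → map′ fromWitness toWitness (π*? x)
      ; resp     = λ x≈y x∈ → let (r , e) = toWitness x∈ in fromWitness (r , trans e x≈y)
      ; 0∈       = fromWitness (0# , zeroʳ π)
      ; +-closed = λ x∈ y∈ → let (r , e) = toWitness x∈ ; (s , e′) = toWitness y∈ in
                     fromWitness (r + s , trans (distribˡ π r s) (+-cong e e′))
      ; *-closed = λ t x∈ → let (r , e) = toWitness x∈ in
                     fromWitness (r * t , trans (sym (*-assoc π r t)) (*-congʳ e))
      }

    Rπ : LeftIdeal ring
    Rπ = record
      { Mem      = λ x → True (*π? x)
      ; mem?     = λ x → map′ fromWitness toWitness (*π? x)
      ; resp     = λ x≈y x∈ → let (r , e) = toWitness x∈ in fromWitness (r , trans e x≈y)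
      ; 0∈       = fromWitness (0# , zeroˡ π)
      ; +-closed = λ x∈ y∈ → let (r , e) = toWitness x∈ ; (s , e′) = toWitness y∈ in
                     fromWitness (r + s , trans (distribʳ π r s) (+-cong e e′))
      ; *-closed = λ t x∈ → let (r , e) = toWitness x∈ in
                     fromWitness (t * r , trans (*-assoc t r π) (*-congˡ e))
      }

  -- By the chain condition πR is R, the radical or 0; it lies in the radical, which misses 1, and
  -- it contains π ≠ 0.
  right-generated : ∀ {x} → Rad x → ∃ λ r → π * r ≈ x
  right-generated x∈ with right-chain πR
  ... | inj₁ (_ , U⊆πR) = let (r , πr≈1) = toWitness (U⊆πR {1#} _) in
    contradiction (Rad-resp πr≈1 (Rad-*ˡ r π∈Rad)) 1∉Rad
  ... | inj₂ (inj₁ (_ , rad⊆πR)) = toWitness (rad⊆πR x∈)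
  ... | inj₂ (inj₂ (πR⊆0 , _)) = contradiction (πR⊆0 (fromWitness (1# , *-identityʳ π))) π≉0

  left-generated : ∀ {x} → Rad x → ∃ λ r → r * π ≈ x
  left-generated x∈ with left-chain Rπ
  ... | inj₁ (_ , U⊆Rπ) = let (r , rπ≈1) = toWitness (U⊆Rπ {1#} _) in
    contradiction (Rad-resp rπ≈1 (Rad-*ʳ r π∈Rad)) 1∉Rad
  ... | inj₂ (inj₁ (_ , rad⊆Rπ)) = toWitness (rad⊆Rπ x∈)
  ... | inj₂ (inj₂ (Rπ⊆0 , _)) = contradiction (Rπ⊆0 (fromWitness (1# , *-identityˡ π))) π≉0

  *π≈0⇒to≡0 : ∀ {x} → x * π ≈ 0# → to x ≡ to 0#
  *π≈0⇒to≡0 {x} xπ≈0 = decidable-stable (to x Finₚ.≟ to 0#) λ x≢0 →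
    let (y , _ , yx≈1) = unit x x≢0 in π≉0 (begin
      π              ≈⟨ *-identityˡ π ⟨
      1# * π         ≈⟨ *-congʳ yx≈1 ⟨
      y * x * π      ≈⟨ *-assoc y x π ⟩
      y * (x * π)    ≈⟨ *-congˡ xπ≈0 ⟩
      y * 0#         ≈⟨ zeroʳ y ⟩
      0#             ∎)

  π*≈0⇒to≡0 : ∀ {x} → π * x ≈ 0# → to x ≡ to 0#
  π*≈0⇒to≡0 {x} πx≈0 = decidable-stable (to x Finₚ.≟ to 0#) λ x≢0 →
    let (y , xy≈1 , _) = unit x x≢0 in π≉0 (begin
      π              ≈⟨ *-identityʳ π ⟨
      π * 1#         ≈⟨ *-congˡ xy≈1 ⟨
      π * (x * y)    ≈⟨ *-assoc π x y ⟨
      π * x * y      ≈⟨ *-congʳ πx≈0 ⟩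
      0# * y         ≈⟨ zeroˡ y ⟩
      0#             ∎)

  private
    to-difference : ∀ {x y} → to (x - y) ≡ to 0# → to x ≡ to y
    to-difference e = Rad⇒to≡ (to≡0⇒Rad e)

  -- Multiplication by π on either side identifies the residue field with the radical. For
  -- noncommutative R the two identifications can differ by an automorphism, so both are recorded.
  *π-cong : ∀ {x y} → to x ≡ to y → x * π ≈ y * π
  *π-cong {x} {y} e = x-y≈0⇒x≈y _ _ (trans (sym ([y-z]x≈yx-zx π x y)) (rad²≈0 (to≡⇒Rad e) π∈Rad))

  *π-injective : ∀ {x y} → x * π ≈ y * π → to x ≡ to y
  *π-injective {x} {y} e = to-difference (*π≈0⇒to≡0 (trans ([y-z]x≈yx-zx π x y) (x≈y⇒x-y≈0 e)))

  π*-cong : ∀ {x y} → to x ≡ to y → π * x ≈ π * y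
  π*-cong {x} {y} e = x-y≈0⇒x≈y _ _ (trans (sym (x[y-z]≈xy-xz π x y)) (rad²≈0 π∈Rad (to≡⇒Rad e)))

  π*-injective : ∀ {x y} → π * x ≈ π * y → to x ≡ to y
  π*-injective {x} {y} e = to-difference (π*≈0⇒to≡0 (trans (x[y-z]≈xy-xz π x y) (x≈y⇒x-y≈0 e)))

-- Coordinates for the points and lines of PHG(2,R)

module Coordinates {c ℓ q} (chain : ChainRing₂ c ℓ q) where
  open import Algebra.Module.Bundles using (RightModule)
  open import Function.Bundles using (mk⇔; Equivalence)
  open import Relation.Binary.PropositionalEquality as ≡ using (_≡_; _≢_)

  open ResidueField chain
  open FieldPlane 𝔽 hiding (_≟ᶠ_)
  open FieldArc 𝔽 using (∥-vec)
  open PHG ring finite using (R³; Point; Line; _≈ᴾ_; _On_; ∣_∣)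
  open RightModule R³ using (_≈ᴹ_; _+ᴹ_; _*ᵣ_; 0ᴹ; ≈ᴹ-refl; ≈ᴹ-sym; ≈ᴹ-trans; *ᵣ-congʳ; *ᵣ-congˡ;
      *ᵣ-assoc; *ᵣ-identityʳ; +ᴹ-identityʳ; *ᵣ-zeroʳ) renaming (Carrierᴹ to M)
  open Free R³ using (lincomb)
  open CommutativeSemigroupₚ (AbelianGroup.commutativeSemigroup +-abelianGroup) using (interchange)
  open import Relation.Binary.Reasoning.Setoid setoid

  infixl 7 _⊙_
  -- Vectors carry their scalars on the right, so a linear form has its coefficients on the left and
  -- is itself scaled from the left.
  _⊙_ : M → M → Carrier
  (a₁ , a₂ , a₃) ⊙ (v₁ , v₂ , v₃) = a₁ * v₁ + (a₂ * v₂ + a₃ * v₃)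

  ⊙-cong : ∀ {a b v w} → a ≈ᴹ b → v ≈ᴹ w → a ⊙ v ≈ b ⊙ w
  ⊙-cong (e₁ , e₂ , e₃) (f₁ , f₂ , f₃) = +-cong (*-cong e₁ f₁) (+-cong (*-cong e₂ f₂) (*-cong e₃ f₃))

  ⊙-+ : ∀ a v w → a ⊙ (v +ᴹ w) ≈ a ⊙ v + a ⊙ w
  ⊙-+ (a₁ , a₂ , a₃) (v₁ , v₂ , v₃) (w₁ , w₂ , w₃) = trans
    (+-cong (distribˡ a₁ v₁ w₁) (trans (+-cong (distribˡ a₂ v₂ w₂) (distribˡ a₃ v₃ w₃)) (interchange _ _ _ _)))
    (interchange _ _ _ _)

  +-⊙ : ∀ a b v → (a +ᴹ b) ⊙ v ≈ a ⊙ v + b ⊙ v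
  +-⊙ (a₁ , a₂ , a₃) (b₁ , b₂ , b₃) (v₁ , v₂ , v₃) = trans
    (+-cong (distribʳ v₁ a₁ b₁) (trans (+-cong (distribʳ v₂ a₂ b₂) (distribʳ v₃ a₃ b₃)) (interchange _ _ _ _)))
    (interchange _ _ _ _)

  ⊙-* : ∀ a v r → a ⊙ (v *ᵣ r) ≈ (a ⊙ v) * r
  ⊙-* (a₁ , a₂ , a₃) (v₁ , v₂ , v₃) r = sym (trans (distribʳ r _ _) (+-cong (*-assoc a₁ v₁ r)
    (trans (distribʳ r _ _) (+-cong (*-assoc a₂ v₂ r) (*-assoc a₃ v₃ r)))))

  infixr 7 _*ₗ_
  _*ₗ_ : Carrier → M → M
  r *ₗ (v₁ , v₂ , v₃) = r * v₁ , r * v₂ , r * v₃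

  *-⊙ : ∀ r a v → (r *ₗ a) ⊙ v ≈ r * (a ⊙ v)
  *-⊙ r (a₁ , a₂ , a₃) (v₁ , v₂ , v₃) = sym (trans (distribˡ r _ _) (+-cong (sym (*-assoc r a₁ v₁))
    (trans (distribˡ r _ _) (+-cong (sym (*-assoc r a₂ v₂)) (sym (*-assoc r a₃ v₃))))))

  reduce : M → V
  reduce (v₁ , v₂ , v₃) = ⟨ to v₁ , to v₂ , to v₃ ⟩

  to-⊙ : ∀ a v → to (a ⊙ v) ≡ reduce a ∙ reduce v
  to-⊙ (a₁ , a₂ , a₃) (v₁ , v₂ , v₃) = ≡.trans (to-+ _ _) (≡.cong₂ 𝔽._+_ (to-* a₁ v₁)
    (≡.trans (to-+ _ _) (≡.cong₂ 𝔽._+_ (to-* a₂ v₂) (to-* a₃ v₃))))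

  lift : Pt → M
  lift (p₁ b c) = 1# , from b , from c
  lift (p₂ c)   = 0# , 1# , from c
  lift p₃       = 0# , 0# , 1#

  reduce-lift : ∀ x → reduce (lift x) ≡ vec x
  reduce-lift (p₁ b c) = V-≡ ≡.refl (to-from b) (to-from c)
  reduce-lift (p₂ c)   = V-≡ ≡.refl ≡.refl (to-from c)
  reduce-lift p₃       = ≡.refl

  -- The entry at the pivot is 0, so that the perturbed equation keeps coefficient 1 there.
  offset : Pt → Tr → M
  offset (p₁ _ _) (b , c) = 0# , from b , from c
  offset (p₂ _)   (b , c) = from b , 0# , from c
  offset p₃       (b , c) = from b , from c , 0#

  offset-∙ : ∀ ℓ b x → reduce (offset ℓ b) ∙ vec x ≡ seg ℓ b x
  offset-∙ (p₁ _ _) (b , c) x = ≡.trans (≡.cong₂ 𝔽._+_ (𝔽.zeroˡ _)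
      (≡.cong₂ (λ s t → s 𝔽.* x₂ (vec x) 𝔽.+ t 𝔽.* x₃ (vec x)) (to-from b) (to-from c)))
    (𝔽.+-identityˡ _)
  offset-∙ (p₂ _) (b , c) x = ≡.cong₂ 𝔽._+_ (≡.cong (𝔽._* x₁ (vec x)) (to-from b))
    (≡.trans (≡.cong₂ 𝔽._+_ (𝔽.zeroˡ _) (≡.cong (𝔽._* x₃ (vec x)) (to-from c))) (𝔽.+-identityˡ _))
  offset-∙ p₃ (b , c) x = ≡.cong₂ 𝔽._+_ (≡.cong (𝔽._* x₁ (vec x)) (to-from b))
    (≡.trans (≡.cong₂ 𝔽._+_ (≡.cong (𝔽._* x₂ (vec x)) (to-from c)) (𝔽.zeroˡ _)) (𝔽.+-identityʳ _))

  -- With π on the left, the perturbation contributes π times a value that matters only modulo the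
  -- radical; for a point of class x this residue is `seg ℓ b x`.
  equation : Pt → Tr → M
  equation ℓ b = lift ℓ +ᴹ π *ₗ offset ℓ b

  lincomb₂ : ∀ (v : Fin 2 → M) r → lincomb v r ≈ᴹ v zero *ᵣ r zero +ᴹ v (suc zero) *ᵣ r (suc zero)
  lincomb₂ v r = RightModule.+ᴹ-congˡ R³ (+ᴹ-identityʳ _)

  lincomb₁ : ∀ (v : Fin 1 → M) r → lincomb v r ≈ᴹ v zero *ᵣ r zero
  lincomb₁ v r = +ᴹ-identityʳ _

  kernel : (a : M) → Submodule R³
  kernel a = record
    { Mem      = λ v → True (a ⊙ v ≟ᴿ 0#)
    ; mem?     = λ v → map′ fromWitness toWitness (a ⊙ v ≟ᴿ 0#)
    ; resp     = λ v≈w v∈ → fromWitness (trans (⊙-cong (≈ᴹ-refl {a}) (≈ᴹ-sym v≈w)) (toWitness v∈))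
    ; 0∈       = fromWitness (trans (⊙-cong (≈ᴹ-refl {a}) (≈ᴹ-sym (*ᵣ-zeroʳ 0ᴹ)))
        (trans (⊙-* a 0ᴹ 0#) (zeroʳ _)))
    ; +-closed = λ {v} {w} v∈ w∈ → fromWitness
        (trans (⊙-+ a v w) (trans (+-cong (toWitness v∈) (toWitness w∈)) (+-identityˡ 0#)))
    ; *-closed = λ r {v} v∈ → fromWitness (trans (⊙-* a v r) (trans (*-congʳ (toWitness v∈)) (zeroˡ r)))
    }

  -- f and g are the coordinates with respect to the basis u , v of the kernel.
  kernelLine : ∀ a (u v : M) (f g : M → Carrier) →
    (∀ {v w} → v ≈ᴹ w → f v ≈ f w) → (∀ {v w} → v ≈ᴹ w → g v ≈ g w) →
    (∀ r s → f (u *ᵣ r +ᴹ v *ᵣ s) ≈ r) → (∀ r s → g (u *ᵣ r +ᴹ v *ᵣ s) ≈ s) →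
    f 0ᴹ ≈ 0# → g 0ᴹ ≈ 0# →
    a ⊙ u ≈ 0# → a ⊙ v ≈ 0# →
    (∀ w → a ⊙ w ≈ 0# → u *ᵣ f w +ᴹ v *ᵣ g w ≈ᴹ w) → Line
  kernelLine a u v f g f-cong g-cong f-basis g-basis f0 g0 au≈0 av≈0 spanned =
    kernel a , basis , independent , λ w → mk⇔
      (λ w∈ → coordinate w , ≈ᴹ-trans (lincomb₂ basis (coordinate w)) (spanned w (toWitness w∈)))
      (λ (r , e) → fromWitness (begin
        a ⊙ w
            ≈⟨ ⊙-cong (≈ᴹ-refl {a}) (≈ᴹ-trans (≈ᴹ-sym e) (lincomb₂ basis r)) ⟩
        a ⊙ (u *ᵣ r zero +ᴹ v *ᵣ r (suc zero))             ≈⟨ ⊙-+ a _ _ ⟩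
        a ⊙ (u *ᵣ r zero) + a ⊙ (v *ᵣ r (suc zero))        ≈⟨ +-cong (⊙-* a u _) (⊙-* a v _) ⟩
        (a ⊙ u) * r zero + (a ⊙ v) * r (suc zero)          ≈⟨ +-cong (*-congʳ au≈0) (*-congʳ av≈0) ⟩
        0# * r zero + 0# * r (suc zero)                    ≈⟨ +-cong (zeroˡ _) (zeroˡ _) ⟩
        0# + 0#                                            ≈⟨ +-identityˡ 0# ⟩
        0#                                                 ∎))
    where
    basis : Fin 2 → M
    basis zero    = u
    basis (suc _) = v
    coordinate : M → Fin 2 → Carrier
    coordinate w zero    = f w
    coordinate w (suc _) = g w
    independent : ∀ r → lincomb basis r ≈ᴹ 0ᴹ → ∀ i → r i ≈ 0#
    independent r e zero       = trans (sym (f-basis _ (r (suc zero))))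
        (trans (f-cong (≈ᴹ-trans (≈ᴹ-sym (lincomb₂ basis r)) e)) f0)
    independent r e (suc zero) = trans (sym (g-basis (r zero) _))
        (trans (g-cong (≈ᴹ-trans (≈ᴹ-sym (lincomb₂ basis r)) e)) g0)

  private
    1*+0* : ∀ r s → 1# * r + 0# * s ≈ r
    1*+0* r s = trans (+-cong (*-identityˡ r) (zeroˡ s)) (+-identityʳ r)
    0*+1* : ∀ r s → 0# * r + 1# * s ≈ s
    0*+1* r s = trans (+-cong (zeroˡ r) (*-identityˡ s)) (+-identityˡ s)
    1+π0 : 1# + π * 0# ≈ 1#
    1+π0 = trans (+-congˡ (zeroʳ π)) (+-identityʳ 1#)

    solved : ∀ {o} a b {x y z} → o ≈ 1# → o * x + (a * y + b * z) ≈ 0# → - a * y + - b * z ≈ x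
    solved {o} a b {x} {y} {z} o≈1 e = begin
      - a * y + - b * z            ≈⟨ +-cong (-‿distribˡ-* a y) (-‿distribˡ-* b z) ⟨
      - (a * y) + - (b * z)        ≈⟨ -‿+-comm (a * y) (b * z) ⟩
      - (a * y + b * z)            ≈⟨ inverseˡ-unique x _
          (trans (+-congʳ (sym (trans (*-congʳ o≈1) (*-identityˡ x)))) e) ⟨
      x                            ∎
      where
      open import Algebra.Properties.AbelianGroup +-abelianGroup using (inverseˡ-unique) renaming
          (⁻¹-∙-comm to -‿+-comm)

    pivot-cancel : ∀ {o} a b → o ≈ 1# → o * - a + (a * 1# + b * 0#) ≈ 0#
    pivot-cancel a b o≈1 = trans (+-cong (trans (*-congʳ o≈1) (*-identityˡ (- a)))
      (trans (+-cong (*-identityʳ a) (zeroʳ b)) (+-identityʳ a))) (-‿inverseˡ a)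

    pivot-cancel′ : ∀ {o} a b → o ≈ 1# → o * - b + (a * 0# + b * 1#) ≈ 0#
    pivot-cancel′ a b o≈1 = trans (+-cong (trans (*-congʳ o≈1) (*-identityˡ (- b)))
      (trans (+-cong (zeroʳ a) (*-identityʳ b)) (+-identityˡ b))) (-‿inverseˡ b)

    x∙yz≈y∙xz : ∀ x y z → x + (y + z) ≈ y + (x + z)
    x∙yz≈y∙xz x y z = trans (sym (+-assoc x y z)) (trans (+-congʳ (+-comm x y)) (+-assoc y x z))

    x∙yz≈z∙xy : ∀ x y z → x + (y + z) ≈ z + (x + y)
    x∙yz≈z∙xy x y z = trans (sym (+-assoc x y z)) (+-comm (x + y) z)

  -- The pivot coefficient is 1, so the equation can be solved for the pivot coordinate and the
  -- other two coordinates are free.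
  line : Pt → Tr → Line
  line ℓ@(p₁ _ _) t = kernelLine (equation ℓ t) (- a , 1# , 0#) (- b , 0# , 1#)
    (λ (_ , w₂ , _) → w₂) (λ (_ , _ , w₃) → w₃) (λ (_ , e , _) → e) (λ (_ , _ , e) → e) 1*+0* 0*+1* refl refl
    (pivot-cancel a b 1+π0) (pivot-cancel′ a b 1+π0)
    (λ (w₁ , w₂ , w₃) e → solved a b 1+π0 e , 1*+0* w₂ w₃ , 0*+1* w₂ w₃)
    where
    a b : Carrier
    a = proj₁ (proj₂ (equation ℓ t))
    b = proj₂ (proj₂ (equation ℓ t))
  line ℓ@(p₂ _) t = kernelLine (equation ℓ t) (1# , - a , 0#) (0# , - b , 1#)
    (λ (w₁ , _ , _) → w₁) (λ (_ , _ , w₃) → w₃) (λ (e , _ , _) → e) (λ (_ , _ , e) → e) 1*+0* 0*+1* refl refl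
    (trans (x∙yz≈y∙xz _ _ _) (pivot-cancel a b 1+π0)) (trans (x∙yz≈y∙xz _ _ _) (pivot-cancel′ a b 1+π0))
    (λ (w₁ , w₂ , w₃) e → 1*+0* w₁ w₃ , solved a b 1+π0 (trans (x∙yz≈y∙xz _ _ _) e) , 0*+1* w₁ w₃)
    where
    a b : Carrier
    a = proj₁ (equation ℓ t)
    b = proj₂ (proj₂ (equation ℓ t))
  line ℓ@p₃ t = kernelLine (equation ℓ t) (1# , 0# , - a) (0# , 1# , - b)
    (λ (w₁ , _ , _) → w₁) (λ (_ , w₂ , _) → w₂) (λ (e , _ , _) → e) (λ (_ , e , _) → e) 1*+0* 0*+1* refl refl
    (trans (x∙yz≈z∙xy _ _ _) (pivot-cancel a b 1+π0)) (trans (x∙yz≈z∙xy _ _ _) (pivot-cancel′ a b 1+π0))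
    (λ (w₁ , w₂ , w₃) e → 1*+0* w₁ w₂ , 0*+1* w₁ w₂ , solved a b 1+π0 (trans (sym (x∙yz≈z∙xy _ _ _)) e))
    where
    a b : Carrier
    a = proj₁ (equation ℓ t)
    b = proj₁ (proj₂ (equation ℓ t))

  line-∋ : ∀ ℓ t {v} → equation ℓ t ⊙ v ≈ 0# → ∣ line ℓ t ∣ v
  line-∋ (p₁ _ _) _ e = fromWitness e
  line-∋ (p₂ _)   _ e = fromWitness e
  line-∋ p₃       _ e = fromWitness e

  -- The basis vector of a free module of rank 1 is nonzero modulo the radical, since otherwise π
  -- would annihilate it; a unit then normalises its residue.
  coordinates : ∀ P → ∃ λ x → ∃ λ v → reduce v ≡ vec x × ∣ P ∣ v × (∀ w → ∣ P ∣ w → ∃ λ r → v *ᵣ r ≈ᴹ w)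
  coordinates (S , basis , independent , spans) =
    let (x , r , vx≡r•v₀) = normalise (reduce v₀) v₀-unimodular
        ρ = from r
        reduced = ≡.trans (reduce-* ρ) (≡.trans (≡.cong (_• reduce v₀) (to-from r)) (≡.sym vx≡r•v₀))
        (ρ⁻¹ , ρρ⁻¹≈1 , _) = unit ρ λ ρ≡0 → vec≢𝟎 x
            (≡.trans vx≡r•v₀ (≡.trans (≡.cong (_• reduce v₀) (≡.trans (≡.sym (to-from r)) ρ≡0))
            (0•≡𝟎 (reduce v₀))))
    in x , v₀ *ᵣ ρ , reduced , Equivalence.from (spans _) ((λ _ → ρ) , lincomb₁ basis (λ _ → ρ)) , λ w w∈ →
      let (s , e) = Equivalence.to (spans w) w∈ in ρ⁻¹ * s zero ,
      ≈ᴹ-trans (*ᵣ-assoc v₀ ρ (ρ⁻¹ * s zero)) (≈ᴹ-trans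
        (*ᵣ-congˡ {v₀} (trans (sym (*-assoc ρ ρ⁻¹ (s zero))) (trans (*-congʳ ρρ⁻¹≈1) (*-identityˡ (s zero)))))
        (≈ᴹ-trans (≈ᴹ-sym (lincomb₁ basis s)) e))
    where
    v₀ : M
    v₀ = basis zero
    reduce-* : ∀ ρ → reduce (v₀ *ᵣ ρ) ≡ to ρ • reduce v₀
    reduce-* ρ = V-≡ (component (proj₁ v₀)) (component (proj₁ (proj₂ v₀))) (component (proj₂ (proj₂ v₀)))
      where
      component : ∀ v → to (v * ρ) ≡ to ρ 𝔽.* to v
      component v = ≡.trans (to-* v ρ) (𝔽.*-comm (to v) (to ρ))
    0•≡𝟎 : ∀ v → to 0# • v ≡ 𝟎
    0•≡𝟎 v = V-≡ (𝔽.zeroˡ _) (𝔽.zeroˡ _) (𝔽.zeroˡ _)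
    vec≢𝟎 : ∀ x → vec x ≢ 𝟎
    vec≢𝟎 x e = FiniteField.0≢1 𝔽 (≡.trans (≡.sym (pivot-𝟎 x))
        (≡.trans (≡.cong (pivot x) (≡.sym e)) (pivot-vec x)))
    v₀-unimodular : reduce v₀ ≢ 𝟎
    v₀-unimodular e = π≉0 (independent (λ _ → π) (≈ᴹ-trans (lincomb₁ basis (λ _ → π))
      (annihilated (≡.cong x₁ e) , annihilated (≡.cong x₂ e) , annihilated (≡.cong x₃ e))) zero)
      where
      annihilated : ∀ {v} → to v ≡ to 0# → v * π ≈ 0#
      annihilated v≡0 = rad²≈0 (to≡0⇒Rad v≡0) π∈Rad

  cls : Point → Pt
  cls P = proj₁ (coordinates P)

  gen : Point → M
  gen P = proj₁ (proj₂ (coordinates P))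

  reduce-gen : ∀ P → reduce (gen P) ≡ vec (cls P)
  reduce-gen P = proj₁ (proj₂ (proj₂ (coordinates P)))

  gen∈ : ∀ P → ∣ P ∣ (gen P)
  gen∈ P = proj₁ (proj₂ (proj₂ (proj₂ (coordinates P))))

  generates : ∀ P w → ∣ P ∣ w → ∃ λ r → gen P *ᵣ r ≈ᴹ w
  generates P = proj₂ (proj₂ (proj₂ (proj₂ (coordinates P))))

  gen-on : ∀ P ℓ t → equation ℓ t ⊙ gen P ≈ 0# → P On line ℓ t
  gen-on P ℓ t e {w} w∈ = let (r , gr≈w) = generates P w w∈ in line-∋ ℓ t
    (trans (⊙-cong (≈ᴹ-refl {equation ℓ t}) (≈ᴹ-sym gr≈w))
        (trans (⊙-* (equation ℓ t) (gen P) r) (trans (*-congʳ e) (zeroˡ r))))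

  to-lift-⊙ : ∀ ℓ v → to (lift ℓ ⊙ v) ≡ vec ℓ ∙ reduce v
  to-lift-⊙ ℓ v = ≡.trans (to-⊙ (lift ℓ) v) (≡.cong (_∙ reduce v) (reduce-lift ℓ))

  lift-⊙-Rad : ∀ P ℓ → cls P on ℓ → Rad (- (lift ℓ ⊙ gen P))
  lift-⊙-Rad P ℓ P∈ℓ = Rad-resp (trans (sym (-‿distribʳ-* _ 1#)) (-‿cong (*-identityʳ _)))
    (Rad-*ˡ (- 1#) (to≡0⇒Rad (≡.trans (to-lift-⊙ ℓ (gen P)) (≡.trans (≡.cong (vec ℓ ∙_) (reduce-gen P)) P∈ℓ))))

  -- The `0#` off `ℓ` is a placeholder that makes `g` total; every statement about `g` assumes or
  -- checks incidence.
  segment : ∀ P ℓ → Dec (cls P on ℓ) → Carrier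
  segment P ℓ (yes P∈ℓ) = proj₁ (right-generated (lift-⊙-Rad P ℓ P∈ℓ))
  segment P ℓ (no _)    = 0#

  g : Point → Pt → Fin q
  g P ℓ = to (segment P ℓ (cls P on? ℓ))

  g-spec : ∀ P ℓ → cls P on ℓ → π * from (g P ℓ) ≈ - (lift ℓ ⊙ gen P)
  g-spec P ℓ P∈ℓ = trans (π*-cong (to-from (g P ℓ))) (spec (cls P on? ℓ))
    where
    spec : ∀ d → π * segment P ℓ d ≈ - (lift ℓ ⊙ gen P)
    spec (yes P∈ℓ) = proj₂ (right-generated (lift-⊙-Rad P ℓ P∈ℓ))
    spec (no P∉ℓ)  = contradiction P∈ℓ P∉ℓ

  -- On the generator of P, `lift ℓ` takes the value -π g and the perturbation adds π `seg`, so they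
  -- cancel.
  on-line : ∀ P ℓ t → cls P on ℓ → g P ℓ ≡ seg ℓ t (cls P) → P On line ℓ t
  on-line P ℓ t P∈ℓ g≡seg = gen-on P ℓ t (begin
    equation ℓ t ⊙ gen P
      ≈⟨ +-⊙ (lift ℓ) (π *ₗ offset ℓ t) (gen P) ⟩
    lift ℓ ⊙ gen P + (π *ₗ offset ℓ t) ⊙ gen P
      ≈⟨ +-congˡ (*-⊙ π (offset ℓ t) (gen P)) ⟩
    lift ℓ ⊙ gen P + π * (offset ℓ t ⊙ gen P)
      ≈⟨ +-congˡ (trans (π*-cong offset≡g) (g-spec P ℓ P∈ℓ)) ⟩
    lift ℓ ⊙ gen P - lift ℓ ⊙ gen P
      ≈⟨ -‿inverseʳ _ ⟩
    0# ∎)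
    where
    offset≡g : to (offset ℓ t ⊙ gen P) ≡ to (from (g P ℓ))
    offset≡g = ≡.trans (to-⊙ (offset ℓ t) (gen P)) (≡.trans (≡.cong (reduce (offset ℓ t) ∙_) (reduce-gen P))
      (≡.trans (offset-∙ ℓ t (cls P)) (≡.trans (≡.sym g≡seg) (≡.sym (to-from (g P ℓ))))))

  displacement : ∀ v x → reduce v ≡ vec x → ∃ λ w → lift x +ᴹ w *ᵣ π ≈ᴹ v
  displacement (v₁ , v₂ , v₃) x e =
    let e′ = ≡.trans e (≡.sym (reduce-lift x))
        (w₁ , f₁) = component (≡.cong x₁ e′)
        (w₂ , f₂) = component (≡.cong x₂ e′)
        (w₃ , f₃) = component (≡.cong x₃ e′)
    in (w₁ , w₂ , w₃) , f₁ , f₂ , f₃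
    where
    component : ∀ {a b} → to a ≡ to b → ∃ λ w → b + w * π ≈ a
    component {a} {b} a≡b = let (w , wπ≈a-b) = left-generated (to≡⇒Rad a≡b) in
      w , trans (+-congˡ wπ≈a-b) (trans (+-comm b (a - b))
          (trans (+-assoc a (- b) b) (trans (+-congˡ (-‿inverseˡ b)) (+-identityʳ a))))

  w : Point → M
  w P = proj₁ (displacement (gen P) (cls P) (reduce-gen P))

  gen-w : ∀ P → lift (cls P) +ᴹ w P *ᵣ π ≈ᴹ gen P
  gen-w P = proj₂ (displacement (gen P) (cls P) (reduce-gen P))

  -- Another generator with the same residue is a multiple by some 1 + a π; it shifts this position
  -- by a multiple of `vec (cls P)`, which every direction through the class annihilates.
  W : Point → V
  W P = reduce (w P)

  lift-gen : ∀ P ℓ → lift ℓ ⊙ gen P ≈ lift ℓ ⊙ lift (cls P) + (lift ℓ ⊙ w P) * π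
  lift-gen P ℓ = trans (⊙-cong (≈ᴹ-refl {lift ℓ}) (≈ᴹ-sym (gen-w P)))
      (trans (⊙-+ (lift ℓ) _ _) (+-congˡ (⊙-* (lift ℓ) (w P) π)))

  -- For points of one class the values of `lift ℓ` share the summand `lift ℓ ⊙ lift (cls P)`;
  -- cancelling it leaves the position multiplied by π from the right.
  g⇒W : ∀ P Q ℓ → cls P ≡ cls Q → cls P on ℓ → g P ℓ ≡ g Q ℓ → vec ℓ ∙ W P ≡ vec ℓ ∙ W Q
  g⇒W P Q ℓ P≡Q P∈ℓ gP≡gQ = ≡.trans (≡.sym (to-lift-⊙ ℓ (w P))) (≡.trans
    (*π-injective (+-cancelˡ (lift ℓ ⊙ lift (cls P)) _ _ (begin
      lift ℓ ⊙ lift (cls P) + (lift ℓ ⊙ w P) * π  ≈⟨ lift-gen P ℓ ⟨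
      lift ℓ ⊙ gen P                              ≈⟨ -‿injective (begin
          - (lift ℓ ⊙ gen P)   ≈⟨ g-spec P ℓ P∈ℓ ⟨
          π * from (g P ℓ)     ≡⟨ ≡.cong (λ a → π * from a) gP≡gQ ⟩
          π * from (g Q ℓ)     ≈⟨ g-spec Q ℓ (≡.subst (_on ℓ) P≡Q P∈ℓ) ⟩
          - (lift ℓ ⊙ gen Q)   ∎) ⟩
      lift ℓ ⊙ gen Q                              ≈⟨ lift-gen Q ℓ ⟩
      lift ℓ ⊙ lift (cls Q) + (lift ℓ ⊙ w Q) * π  ≡⟨ ≡.cong (λ x → lift ℓ ⊙ lift x + (lift ℓ ⊙ w Q) * π) P≡Q ⟨
      lift ℓ ⊙ lift (cls P) + (lift ℓ ⊙ w Q) * π  ∎)))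
    (to-lift-⊙ ℓ (w Q)))
    where
    open import Algebra.Properties.AbelianGroup +-abelianGroup using () renaming
        (∙-cancelˡ to +-cancelˡ; ⁻¹-injective to -‿injective)

  W⇒g : ∀ P Q ℓ → cls P ≡ cls Q → cls P on ℓ → vec ℓ ∙ W P ≡ vec ℓ ∙ W Q → g P ℓ ≡ g Q ℓ
  W⇒g P Q ℓ P≡Q P∈ℓ WP≡WQ = ≡.trans (≡.sym (to-from (g P ℓ))) (≡.trans (π*-injective (begin
    π * from (g P ℓ)                                   ≈⟨ g-spec P ℓ P∈ℓ ⟩
    - (lift ℓ ⊙ gen P)                                 ≈⟨ -‿cong (lift-gen P ℓ) ⟩
    - (lift ℓ ⊙ lift (cls P) + (lift ℓ ⊙ w P) * π)
        ≡⟨ ≡.cong (λ x → - (lift ℓ ⊙ lift x + (lift ℓ ⊙ w P) * π)) P≡Q ⟩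
    - (lift ℓ ⊙ lift (cls Q) + (lift ℓ ⊙ w P) * π)
      ≈⟨ -‿cong (+-congˡ (*π-cong (≡.trans (to-lift-⊙ ℓ (w P)) (≡.trans WP≡WQ (≡.sym (to-lift-⊙ ℓ (w Q))))))) ⟩
    - (lift ℓ ⊙ lift (cls Q) + (lift ℓ ⊙ w Q) * π)     ≈⟨ -‿cong (lift-gen Q ℓ) ⟨
    - (lift ℓ ⊙ gen Q)                                 ≈⟨ g-spec Q ℓ (≡.subst (_on ℓ) P≡Q P∈ℓ) ⟨
    π * from (g Q ℓ)                                   ∎)) (to-from (g Q ℓ)))

  -- Moving w by a times the class vector multiplies the generator by 1 + a π.
  contained : ∀ P Q → cls P ≡ cls Q → ∀ a → W P ≡ W Q ⊞ a • vec (cls Q) → ∀ {v} → ∣ P ∣ v → ∣ Q ∣ v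
  contained P Q P≡Q a WP≡ {v} v∈P =
    let (r , gr≈v) = generates P v v∈P in
    Submodule.resp (proj₁ Q) (≈ᴹ-trans (*ᵣ-congʳ {r} gQu≈gP) gr≈v)
      (Submodule.*-closed (proj₁ Q) r (Submodule.*-closed (proj₁ Q) u (gen∈ Q)))
    where
    u : Carrier
    u = 1# + from a * π
    component : ∀ l z z′ → to z ≡ to z′ 𝔽.+ a 𝔽.* to l → (l + z′ * π) * u ≈ l + z * π
    component l z z′ e = begin
      (l + z′ * π) * (1# + from a * π)
        ≈⟨ trans (distribˡ _ 1# _) (+-cong (*-identityʳ _) (distribʳ _ l (z′ * π))) ⟩
      (l + z′ * π) + (l * (from a * π) + z′ * π * (from a * π))
        ≈⟨ +-congˡ (trans (+-congˡ (rad²≈0 (Rad-*ʳ z′ π∈Rad) (Rad-*ʳ (from a) π∈Rad))) (+-identityʳ _)) ⟩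
      (l + z′ * π) + l * (from a * π)
        ≈⟨ trans (+-assoc l _ _) (+-congˡ (+-congˡ (sym (*-assoc l (from a) π)))) ⟩
      l + (z′ * π + l * from a * π)
        ≈⟨ +-congˡ (distribʳ π z′ (l * from a)) ⟨
      l + (z′ + l * from a) * π
        ≈⟨ +-congˡ (*π-cong (≡.trans (to-+ z′ (l * from a))
            (≡.trans (≡.cong (to z′ 𝔽.+_) (≡.trans (to-* l (from a))
             (≡.trans (≡.cong (to l 𝔽.*_) (to-from a)) (𝔽.*-comm (to l) a)))) (≡.sym e)))) ⟩
      l + z * π ∎
    W-components : W P ≡ W Q ⊞ a • reduce (lift (cls Q))
    W-components = ≡.trans WP≡ (≡.cong (λ v → W Q ⊞ a • v) (≡.sym (reduce-lift (cls Q))))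
    gQu≈gP : gen Q *ᵣ u ≈ᴹ gen P
    gQu≈gP = ≈ᴹ-trans (*ᵣ-congʳ {u} (≈ᴹ-sym (gen-w Q))) (≈ᴹ-trans
      (component _ _ _ (≡.cong x₁ W-components) , component _ _ _ (≡.cong x₂ W-components) , component _ _ _
          (≡.cong x₃ W-components))
      (≡.subst (λ x → lift x +ᴹ w P *ᵣ π ≈ᴹ gen P) P≡Q (gen-w P)))

  -- If the positions differed by a multiple of the class vector, `contained` would apply in both
  -- directions and the points would coincide.
  apart : ∀ P Q → ¬ (P ≈ᴾ Q) → cls P ≡ cls Q → vec (cls P) ⨯ (W P ⊟ W Q) ≢ 𝟎
  apart P Q P≉Q P≡Q e = P≉Q
    ( contained P Q P≡Q a (≡.trans (moved (W P) (W Q) (∥-vec x (W P ⊟ W Q) e))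
        (≡.cong (λ y → W Q ⊞ a • vec y) P≡Q))
    , contained Q P (≡.sym P≡Q) (𝔽.- a) (moved′ (W P) (W Q) (∥-vec x (W P ⊟ W Q) e)) )
    where
    open IntegerCoefficients (FiniteField.commutativeRing 𝔽) using (solve; _:=_; _:+_; _:*_; _:-_; :-_)
    x : Pt
    x = cls P
    a : Fin q
    a = pivot x (W P ⊟ W Q)
    moved : ∀ v v′ {a d} → v ⊟ v′ ≡ a • d → v ≡ v′ ⊞ a • d
    moved v v′ e = V-≡ (component (≡.cong x₁ e)) (component (≡.cong x₂ e)) (component (≡.cong x₃ e))
      where
      component : ∀ {y y′ z} → y 𝔽.- y′ ≡ z → y ≡ y′ 𝔽.+ z
      component {y} {y′} ≡.refl = solve 2 (λ y y′ → y := y′ :+ (y :- y′)) ≡.refl y y′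
    moved′ : ∀ v v′ {a d} → v ⊟ v′ ≡ a • d → v′ ≡ v ⊞ (𝔽.- a) • d
    moved′ v v′ {a} e = V-≡ (component (≡.cong x₁ e)) (component (≡.cong x₂ e)) (component (≡.cong x₃ e))
      where
      component : ∀ {y y′ z} → y 𝔽.- y′ ≡ a 𝔽.* z → y′ ≡ y 𝔽.+ 𝔽.- a 𝔽.* z
      component {y} {y′} {z} e = ≡.trans (solve 2 (λ y y′ → y′ := y :- (y :- y′)) ≡.refl y y′)
        (≡.trans (≡.cong (λ t → y 𝔽.- t) e) (solve 3 (λ y a z → y :- a :* z := y :+ :- a :* z) ≡.refl y a z))

-- From projective arcs to the combinatorial model

module ArcReduction {c ℓ q} (chain : ChainRing₂ c ℓ q) where
  open import Data.Nat.Base using (ℕ; _*_; _≤_)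
  import Data.Nat.Properties as ℕₚ
  open import Relation.Binary.PropositionalEquality

  open ResidueField chain using (ring; finite; 𝔽)
  open FieldPlane 𝔽 using (geometry; _≟ᶠ_; _on?_; seg)
  open Coordinates chain
  open PHG ring finite hiding (∑) renaming (_on?_ to _on?ᴸ_)

  module _ {k} {K : Point → ℕ} (arc : IsArc k 3 K) (projective : IsProjective K) where
    open IsArc arc using (total; line≤)

    support : List Point
    support = filter (λ P → K P ℕₚ.≟ 1) points

    ⟦K≟1⟧ : ∀ P → ⟦ K P ℕₚ.≟ 1 ⟧ ≡ K P
    ⟦K≟1⟧ P with projective P
    ... | inj₁ e = trans (cong (λ v → ⟦ v ℕₚ.≟ 1 ⟧) e) (sym e)
    ... | inj₂ e = trans (cong (λ v → ⟦ v ℕₚ.≟ 1 ⟧) e) (sym e)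

    length-support : length support ≡ k
    length-support = begin
      length support                          ≡⟨ trans (∑-const support 1) (ℕₚ.*-identityʳ _) ⟨
      ∑[ _ ← support ] 1                      ≡⟨ ∑-filter (λ P → K P ℕₚ.≟ 1) points (λ _ → 1) ⟩
      ∑[ P ← points ] (⟦ K P ℕₚ.≟ 1 ⟧ * 1)    ≡⟨ ∑-cong points (λ P → trans (ℕₚ.*-identityʳ _) (⟦K≟1⟧ P)) ⟩
      ∑ points K                              ≡⟨ total ⟩
      k                                       ∎
      where open ≡-Reasoning

    pt : Fin (length support) → Point
    pt = lookup support

    distinct : ∀ {i j} → i ≢ j → ¬ (pt i ≈ᴾ pt j)
    distinct = lookup-AllPairs (λ {P} {Q} P≉Q (Q⊆P , P⊆Q) → P≉Q (P⊆Q , Q⊆P))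
      (AllPairsₚ.filter⁺ (λ P → K P ℕₚ.≟ 1) points-unique)

    -- By `on-line` each index counted gives a support point on `line ℓ t`, where the arc has at
    -- most three points.
    at-most-3 : ∀ ℓ t → ∑[ i ← allFin (length support) ]
        (⟦ cls (pt i) on? ℓ ⟧ * ⟦ g (pt i) ℓ ≟ᶠ seg ℓ t (cls (pt i)) ⟧) ≤ 3
    at-most-3 ℓ t = begin
      ∑[ i ← allFin (length support) ] (⟦ cls (pt i) on? ℓ ⟧ * ⟦ g (pt i) ℓ ≟ᶠ seg ℓ t (cls (pt i)) ⟧)
        ≤⟨ ∑-mono (allFin (length support)) (λ i → incident (pt i)) ⟩
      ∑[ i ← allFin (length support) ] ⟦ pt i on?ᴸ L ⟧
        ≡⟨ ∑-lookup support (λ P → ⟦ P on?ᴸ L ⟧) ⟩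
      ∑[ P ← support ] ⟦ P on?ᴸ L ⟧
        ≡⟨ ∑-filter (λ P → K P ℕₚ.≟ 1) points (λ P → ⟦ P on?ᴸ L ⟧) ⟩
      ∑[ P ← points ] (⟦ K P ℕₚ.≟ 1 ⟧ * ⟦ P on?ᴸ L ⟧)
        ≡⟨ ∑-cong points (λ P → trans (cong (_* ⟦ P on?ᴸ L ⟧) (⟦K≟1⟧ P)) (ℕₚ.*-comm (K P) _)) ⟩
      ∑[ P ← points ] (⟦ P on?ᴸ L ⟧ * K P)
        ≡⟨ ∑-filter (_on?ᴸ L) points K ⟨
      ∑ (filter (_on?ᴸ L) points) K
        ≤⟨ line≤ L ⟩
      3 ∎
      where
      open ℕₚ.≤-Reasoning
      L : Line
      L = line ℓ t
      incident : ∀ P → ⟦ cls P on? ℓ ⟧ * ⟦ g P ℓ ≟ᶠ seg ℓ t (cls P) ⟧ ≤ ⟦ P on?ᴸ L ⟧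
      incident P = ℕₚ.≤-trans (ℕₚ.≤-reflexive (sym (⟦×⟧ (cls P on? ℓ) (g P ℓ ≟ᶠ seg ℓ t (cls P)))))
        (⟦⟧-mono ((cls P on? ℓ) ×-dec (g P ℓ ≟ᶠ seg ℓ t (cls P))) (P on?ᴸ L)
            (λ (P∈ℓ , e) {v} → on-line P ℓ t P∈ℓ e {v}))

    plane-arc : Arc geometry k
    plane-arc = subst (Arc geometry) length-support (FieldArc.field-arc 𝔽
      (cls ∘ pt) (W ∘ pt) (g ∘ pt) at-most-3
      (λ {i} {j} {ℓ} → g⇒W (pt i) (pt j) ℓ)
      (λ {i} {j} {ℓ} → W⇒g (pt i) (pt j) ℓ)
      (λ {i} {j} i≢j → apart (pt i) (pt j) (distinct i≢j)))

-- The bounds on 𝔪 3 R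

open import Data.Nat using (ℕ; _+_; _*_; _∸_; _^_; _≤_)
open import Data.Nat.Divisibility using (_∣_)
open import Data.Nat.Base using (>-nonZero; s≤s; z≤n)
import Data.Nat.Properties as ℕₚ
open import Data.Nat.Tactic.RingSolver using (solve-∀)
open import Data.Product using (_×_)
open import Relation.Binary.PropositionalEquality
open import Relation.Nullary using (¬_)

theorem4p12 : ∀ {c ℓ} (q : ℕ) → IsPrimePower q → 5 ≤ q → (R : ChainRing₂ c ℓ q) →
    (¬ (2 ∣ q) → 𝔪 3 R ≤ (2 * q ^ 2 ∸ 2 * q) + 4) ×
    (2 ∣ q → 𝔪 3 R ≤ (2 * q ^ 2 ∸ q) + 4)
theorem4p12 q _ 5≤q R =
  let (k , (K , is-arc , projective) , _) = PHG.largest (ChainRing₂.ring R) (ChainRing₂.finite R) 3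
      arc = ArcReduction.plane-arc R is-arc projective
  in (λ odd → subtract (2 * q) (ℕₚ.*-monoʳ-≤ 2 q≤q²) (ArcBounds.odd-bound 5≤q _ arc odd))
   , (λ even → subtract q (ℕₚ.≤-trans (ℕₚ.m≤n*m q 2) (ℕₚ.*-monoʳ-≤ 2 q≤q²))
       (ArcBounds.even-bound 5≤q _ arc even))
  where
  q≤q² : q ≤ q ^ 2
  q≤q² = ℕₚ.≤-trans (ℕₚ.m≤m*n q q {{>-nonZero (ℕₚ.≤-trans (s≤s z≤n) 5≤q)}})
      (ℕₚ.≤-reflexive (cong (q *_) (sym (ℕₚ.*-identityʳ q))))
  -- The counting bounds are additive; `d ≤ 2 * q ^ 2` ensures that the truncated subtraction in the
  -- theorem loses nothing.
  subtract : ∀ {k} d → d ≤ 2 * q ^ 2 → k + d ≤ 2 * (q * q) + 4 → k ≤ (2 * q ^ 2 ∸ d) + 4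
  subtract {k} d d≤ bound = ℕₚ.+-cancelʳ-≤ d k _ (ℕₚ.≤-trans bound (ℕₚ.≤-reflexive (begin
    2 * (q * q) + 4            ≡⟨ cong (λ v → 2 * (q * v) + 4) (ℕₚ.*-identityʳ q) ⟨
    2 * q ^ 2 + 4              ≡⟨ cong (_+ 4) (ℕₚ.m∸n+n≡m d≤) ⟨
    2 * q ^ 2 ∸ d + d + 4      ≡⟨ swap (2 * q ^ 2 ∸ d) d ⟩
    2 * q ^ 2 ∸ d + 4 + d      ∎)))
    where
    open ≡-Reasoning
    swap : ∀ a b → a + b + 4 ≡ a + 4 + b
    swap = solve-∀
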